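{- Suppose $M/K$ is obtained by general normal magnification from $L/K$ through $J/K$. (1) Let the unique descending chain for $L/K$ be $L=N_0\supsetneq N_1\supsetneq\dots\supsetneq N_k$ and the unique descending chain for $J/K$ be $J=N'_0\supsetneq N'_1\supsetneq\dots\supsetneq N'_{k'}$. Then the unique descending chain for $M/K$ is $$M=N_0N'_0\supsetneq N_1N'_1\supsetneq\dots\supsetneq N_{k'}N'_{k'}\supsetneq N_{k'+1}N'_{k'}\supsetneq\dots\supsetneq N_kN'_{k'}$$ if $k\ge k'$, and $$M=N_0N'_0\supsetneq N_1N'_1\supsetneq\dots\supsetneq N_kN'_k\supsetneq N_kN'_{k+1}\supsetneq\dots\supsetneq N_kN'_{k'}$$ if $k<k'$. (2) Let the unique ascending chain for $L/K$ be $K=F_0\subsetneq F_1\subsetneq\dots\subsetneq F_l$ and the unique ascending chain for $J/K$ be $K=F'_0\subsetneq F'_1\subsetneq\dots\subsetneq F'_{l'}$. Then the unique ascending chain for $M/K$ is $$K=F_0F'_0\subsetneq F_1F'_1\subsetneq\dots\subsetneq F_{l'}F'_{l'}\subsetneq F_{l'+1}F'_{l'}\subsetneq\dots\subsetneq F_lF'_{l'}$$ if $l\ge l'$, and $$K=F_0F'_0\subsetneq F_1F'_1\subsetneq\dots\subsetneq F_lF'_l\subsetneq F_lF'_{l+1}\subsetneq\dots\subsetneq F_lF'_{l'}$$ if $l<l'$.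
   Context: $K$ is any field (not necessarily perfect) with a fixed algebraic closure $\bar K$; all extensions are finite and contained in $\bar K$. A finite extension $M/K$ is obtained by general normal magnification from a subextension $L/K$ through a finite extension $J/K$ if $[L:K]>1$, the normal closures $\tilde L,\tilde J$ of $L/K,J/K$ in $\bar K$ are linearly disjoint over $K$, and $LJ=M$. For a finite extension $E/K$ there is a unique intermediate field $N$ such that $E/N$ is Galois of maximum possible degree, namely $N=E^{\mathrm{Aut}(E/K)}$; and a unique largest Galois subextension $F/K$ of $E/K$. The unique descending chain for $E/K$ is the strictly descending chain $E=N_0\supsetneq N_1\supsetneq\dots\supsetneq N_k$ in which $N_i$ is the unique intermediate field of $N_{i-1}/K$ with $N_{i-1}/N_i$ Galois of maximum possible degree, continued until it stabilizes (so $|\mathrm{Aut}(N_k/K)|=1$). The unique ascending chain for $E/K$ is the strictly ascending chain $K=F_0\subsetneq F_1\subsetneq\dots\subsetneq F_l$ in which $F_j$ is the largest Galois subextension of $E/F_{j-1}$, continued until it stabilizes (so the largest Galois subextension of $E/F_l$ is $F_l$). Chains may consist of a single field. -}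

module Defs where

open import Level using (Level; suc)
open import Algebra.Apartness.Bundles using (HeytingField; HeytingCommutativeRing)
open import Algebra.Bundles using (CommutativeRing)
import Algebra.Properties.CommutativeMonoid.Sum as Sum
open import Data.Fin.Base using (Fin)
open import Data.List.Base using (List; []; _∷_; foldr; map)
open import Data.List.Relation.Unary.All using (All)
open import Data.Nat.Base as ℕ using (ℕ)
open import Data.Product.Base using (∃; ∃-syntax; _×_)
open import Data.Sum.Base using (_⊎_)
open import Data.Vec.Functional using (Vector)
open import Relation.Binary.Definitions using (_Respects_)
open import Relation.Nullary.Negation using (¬_)
open import Relation.Unary as Pred using (Pred)

-- In the presence of excluded middle, a Heyting field is the same thing as a
-- field: tightness makes its apartness relation equivalent to inequality.
-- All fields under consideration are subfields of the fixed field K̄.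
module FieldExtensions {ℓ : Level} (K̄ : HeytingField ℓ ℓ ℓ) where

  open HeytingField K̄ using (Carrier; _≈_; _+_; _*_; -_; 0#; 1#; heytingCommutativeRing)
  open CommutativeRing (HeytingCommutativeRing.commutativeRing heytingCommutativeRing)
    using (+-commutativeMonoid)
  open Sum +-commutativeMonoid using (sum)

  infix 4 _∈_ _⊆_ _⊂_ _≐_ _≈ₚ_

  record Subfield : Set (suc ℓ) where
    field
      Member    : Pred Carrier ℓ
      respects  : Member Respects _≈_
      0-closed  : Member 0#
      1-closed  : Member 1#
      +-closed  : ∀ {x y} → Member x → Member y → Member (x + y)
      *-closed  : ∀ {x y} → Member x → Member y → Member (x * y)
      neg-closed : ∀ {x} → Member x → Member (- x)
      inv-closed : ∀ {x y} → x * y ≈ 1# → Member x → Member y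

  open Subfield

  _∈_ : Carrier → Subfield → Set ℓ
  x ∈ E = Member E x

  _⊆_ _⊂_ _≐_ : Subfield → Subfield → Set ℓ
  E ⊆ F = Member E Pred.⊆ Member F
  E ⊂ F = Member E Pred.⊂ Member F
  E ≐ F = Member E Pred.≐ Member F

  data Generated (S : Pred Carrier ℓ) : Pred Carrier ℓ where
    gen  : ∀ {x} → S x → Generated S x
    resp : ∀ {x y} → x ≈ y → Generated S x → Generated S y
    zero : Generated S 0#
    one  : Generated S 1#
    add  : ∀ {x y} → Generated S x → Generated S y → Generated S (x + y)
    mul  : ∀ {x y} → Generated S x → Generated S y → Generated S (x * y)
    neg  : ∀ {x} → Generated S x → Generated S (- x)
    inv  : ∀ {x y} → x * y ≈ 1# → Generated S x → Generated S y

  subfieldGeneratedBy : Pred Carrier ℓ → Subfield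
  subfieldGeneratedBy S = record
    { Member     = Generated S
    ; respects   = resp
    ; 0-closed   = zero
    ; 1-closed   = one
    ; +-closed   = add
    ; *-closed   = mul
    ; neg-closed = neg
    ; inv-closed = inv
    }

  infixl 7 _∙_

  -- The compositum EF.
  _∙_ : Subfield → Subfield → Subfield
  E ∙ F = subfieldGeneratedBy (Member E Pred.∪ Member F)

  -- Polynomials over K̄ are lists of coefficients, constant term first; they
  -- are compared coefficientwise, so trailing zeros are irrelevant.
  Poly : Set ℓ
  Poly = List Carrier

  coeff : Poly → ℕ → Carrier
  coeff []      _         = 0#
  coeff (a ∷ _) ℕ.zero    = a
  coeff (_ ∷ f) (ℕ.suc n) = coeff f n

  _≈ₚ_ : Poly → Poly → Set ℓ
  f ≈ₚ g = ∀ n → coeff f n ≈ coeff g n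

  infixl 6 _+ₚ_
  infixl 7 _*ₚ_

  _+ₚ_ : Poly → Poly → Poly
  []      +ₚ g       = g
  (a ∷ f) +ₚ []      = a ∷ f
  (a ∷ f) +ₚ (b ∷ g) = (a + b) ∷ (f +ₚ g)

  _*ₚ_ : Poly → Poly → Poly
  []      *ₚ g = []
  (a ∷ f) *ₚ g = map (a *_) g +ₚ (0# ∷ (f *ₚ g))

  X-_ : Carrier → Poly
  X- r = - r ∷ 1# ∷ []

  eval : Poly → Carrier → Carrier
  eval f x = foldr (λ a y → a + x * y) 0# f

  Root : Poly → Carrier → Set ℓ
  Root f x = eval f x ≈ 0#

  _over_ : Poly → Subfield → Set ℓ
  f over K = All (_∈ K) f

  Constant : Poly → Set ℓ
  Constant f = ∀ n → coeff f (ℕ.suc n) ≈ 0#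

  NonZero : Poly → Set ℓ
  NonZero f = ∃[ n ] ¬ (coeff f n ≈ 0#)

  record Irreducible (K : Subfield) (f : Poly) : Set ℓ where
    field
      coefficients : f over K
      nonConstant  : ¬ Constant f
      noFactors    : ∀ g h → g over K → h over K → f ≈ₚ g *ₚ h → Constant g ⊎ Constant h

  SplitsOver : Subfield → Poly → Set ℓ
  SplitsOver E f = ∃[ c ] ∃[ rs ]
    c ∈ E × All (_∈ E) rs × f ≈ₚ foldr (λ r g → (X- r) *ₚ g) (c ∷ []) rs

  NoMultipleRoot : Poly → Set ℓ
  NoMultipleRoot f = ∀ r g → ¬ (f ≈ₚ (X- r) *ₚ ((X- r) *ₚ g))

  AlgebraicOver : Subfield → Carrier → Set ℓ
  AlgebraicOver K x = ∃[ f ] f over K × NonZero f × Root f x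

  record IsAlgebraicClosureOf (K : Subfield) : Set ℓ where
    field
      algebraic            : ∀ x → AlgebraicOver K x
      algebraically-closed : ∀ f → ¬ Constant f → ∃[ x ] Root f x

  combination : ∀ {n} → Vector Carrier n → Vector Carrier n → Carrier
  combination c b = sum (λ i → c i * b i)

  LinearlyIndependent : Subfield → ∀ {n} → Vector Carrier n → Set ℓ
  LinearlyIndependent K {n} b =
    ∀ (c : Vector Carrier n) → (∀ i → c i ∈ K) → combination c b ≈ 0# → ∀ i → c i ≈ 0#

  record IsBasis (K E : Subfield) {n : ℕ} (b : Vector Carrier n) : Set ℓ where
    field
      members     : ∀ i → b i ∈ E
      independent : LinearlyIndependent K b
      spanning    : ∀ {x} → x ∈ E →
                    ∃ λ (c : Vector Carrier n) → (∀ i → c i ∈ K) × x ≈ combination c b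

  -- Degree K E n says [E : K] = n.
  Degree : Subfield → Subfield → ℕ → Set ℓ
  Degree K E n = ∃ λ (b : Vector Carrier n) → IsBasis K E b

  -- In every relation on extensions below the base field is the first argument.
  record IsFinite (K E : Subfield) : Set ℓ where
    field
      base⊆  : K ⊆ E
      degree : ∃[ n ] Degree K E n

  record IsNormal (K E : Subfield) : Set ℓ where
    field
      base⊆     : K ⊆ E
      algebraic : ∀ {x} → x ∈ E → AlgebraicOver K x
      splits    : ∀ f → Irreducible K f → (∃[ x ] x ∈ E × Root f x) → SplitsOver E f

  -- The irreducible polynomials over K with root x are exactly the nonzero
  -- K-multiples of the minimal polynomial of x, whose roots are sought in K̄.
  record IsSeparable (K E : Subfield) : Set ℓ where
    field
      base⊆     : K ⊆ E
      algebraic : ∀ {x} → x ∈ E → AlgebraicOver K x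
      separable : ∀ {x} → x ∈ E → ∀ f → Irreducible K f → Root f x → NoMultipleRoot f

  record IsGalois (K E : Subfield) : Set ℓ where
    field
      finite    : IsFinite K E
      normal    : IsNormal K E
      separable : IsSeparable K E

  record IsNormalClosure (K E Ẽ : Subfield) : Set (suc ℓ) where
    field
      contains : E ⊆ Ẽ
      normal   : IsNormal K Ẽ
      smallest : ∀ F → E ⊆ F → IsNormal K F → Ẽ ⊆ F

  LinearlyDisjoint : Subfield → Subfield → Subfield → Set ℓ
  LinearlyDisjoint K E F =
    ∀ {n} (a : Vector Carrier n) → (∀ i → a i ∈ E) →
    LinearlyIndependent K a → LinearlyIndependent F a

  record IsGeneralNormalMagnification (K L J M : Subfield) : Set (suc ℓ) where
    field
      L-finite   : IsFinite K L
      J-finite   : IsFinite K J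
      M-finite   : IsFinite K M
      L-proper   : ∃[ n ] Degree K L n × 1 ℕ.< n
      L̃ J̃        : Subfield
      L̃-closure  : IsNormalClosure K L L̃
      J̃-closure  : IsNormalClosure K J J̃
      disjoint   : LinearlyDisjoint K L̃ J̃
      compositum : L ∙ J ≐ M

  record HasMaximalGaloisDegree (K E N : Subfield) : Set (suc ℓ) where
    field
      base⊆   : K ⊆ N
      galois  : IsGalois N E
      maximal : ∀ N′ → K ⊆ N′ → IsGalois N′ E →
                ∀ {d d′} → Degree N E d → Degree N′ E d′ → d′ ℕ.≤ d

  -- N is the unique intermediate field of E/K with E/N Galois of maximum
  -- possible degree.
  record IsMaximalGaloisBase (K E N : Subfield) : Set (suc ℓ) where
    field
      hasMaximalDegree : HasMaximalGaloisDegree K E N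
      unique           : ∀ N′ → HasMaximalGaloisDegree K E N′ → N′ ≐ N

  record IsLargestGaloisSubextension (K E F : Subfield) : Set (suc ℓ) where
    field
      ⊆top    : F ⊆ E
      galois  : IsGalois K F
      largest : ∀ F′ → F′ ⊆ E → IsGalois K F′ → F′ ⊆ F

  -- A chain with members indexed 0, …, k is given by a sequence of which only
  -- the terms with index at most k are relevant.
  record IsDescendingChain (K E : Subfield) (k : ℕ) (N : ℕ → Subfield) : Set (suc ℓ) where
    field
      start  : N 0 ≐ E
      strict : ∀ i → i ℕ.< k → N (ℕ.suc i) ⊂ N i
      step   : ∀ i → i ℕ.< k → IsMaximalGaloisBase K (N i) (N (ℕ.suc i))
      stable : IsMaximalGaloisBase K (N k) (N k)

  record IsAscendingChain (K E : Subfield) (l : ℕ) (F : ℕ → Subfield) : Set (suc ℓ) where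
    field
      start  : F 0 ≐ K
      strict : ∀ j → j ℕ.< l → F j ⊂ F (ℕ.suc j)
      step   : ∀ j → j ℕ.< l → IsLargestGaloisSubextension (F j) E (F (ℕ.suc j))
      stable : IsLargestGaloisSubextension (F l) E (F l)

{-# OPTIONS --safe #-}
module Submission where

-- Polynomials are identified with their functions, since K̄ is algebraically
-- closed.  The basic fact (generated-fixed) is that if E is generated over A by
-- separable elements whose conjugates lie in E, then every element of E fixed
-- by all A-endomorphisms of E lies in A; conversely (Artin), if only elements
-- of N are fixed, then E/N is Galois, because ∏ (X − s), over the roots s in E
-- of a polynomial over the base, is fixed.  Hence the maximal Galois base of
-- E/K is the fixed field of the K-endomorphisms of E.
--
-- (1) By linear disjointness L̃ ∩ A J = A for K ⊆ A ⊆ L, so an endomorphism of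
-- X X′ (X ⊆ L, X′ ⊆ J) preserves X and X′ and fixes N N′, where N and N′ are
-- the maximal Galois bases of X and X′; and X X′ is Galois over N N′, so N N′
-- is exactly the fixed field of X X′.
--
-- (2) Let B and B′ be the largest Galois subextensions of L/A and J/A′, and let
-- y lie in a Galois extension of A A′ inside L J.  Write y = ∑ eⱼ bⱼ with eⱼ ∈ L
-- and (bⱼ) a basis of J/K.  As L̃ and J are linearly disjoint, all A-conjugates
-- of eⱼ are in L.  For a suitable power q of the characteristic exponent every
-- eⱼ^q is separable over A, so eⱼ^q ∈ B and y^q ∈ B J; as y is separable,
-- y ∈ B J.  Symmetrically y ∈ L B′, and B J ∩ L B′ = B B′.

open import Defs
open import Level using (Level; Lift; lift)
open import Axiom.ExcludedMiddle using (ExcludedMiddle)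
open import Algebra.Apartness.Bundles using (HeytingField; HeytingCommutativeRing)
open import Algebra.Bundles using (CommutativeRing; RawRing)
import Algebra.Properties.CommutativeSemiring.Binomial as Binomial
import Algebra.Properties.CommutativeSemiring.Exp as CommutativeSemiringExp
import Algebra.Properties.Ring as RingProperties
import Algebra.Properties.Semiring.Exp as SemiringExp
import Algebra.Properties.Semiring.Mult as SemiringMult
import Algebra.Properties.Semiring.Sum as SemiringSum
import Algebra.Solver.Ring as RingSolver
open import Algebra.Solver.Ring.AlmostCommutativeRing using
    (AlmostCommutativeRing; fromCommutativeRing; _-Raw-AlmostCommutative⟶_; -raw-almostCommutative⟶)
open import Data.Empty using (⊥-elim)
open import Data.Fin.Base using (Fin; toℕ; fromℕ; inject₁; punchIn)
import Data.Fin.Properties as Fin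
open import Data.List.Base using (List; []; _∷_; _∷ʳ_; _++_; length; map; foldr; zipWith; replicate; tabulate; drop)
open import Data.List.Properties using (length-zipWith; length-map; length-++; length-replicate; length-drop; map-id)
open import Data.List.Relation.Unary.All as All using (All; []; _∷_)
import Data.List.Relation.Unary.All.Properties as All
open import Data.List.Relation.Unary.AllPairs using (AllPairs; []; _∷_)
open import Data.List.Relation.Unary.Any as Any using (Any; here; there)
open import Data.Maybe.Base using (Maybe; just; nothing)
open import Data.Nat.Base as ℕ using (ℕ; _≤_; _<_; _≥_; z≤n; s≤s; _⊓_; _∸_; _!)
open import Data.Nat.Combinatorics using (_C_; nCn≡1; nCk≡n!/k![n-k]!; k![n∸k]!∣n!)
open import Data.Nat.DivMod using (_/_; _%_; m/n*n≡m; m≡m%n+[m/n]*n; m%n<n; m<n⇒m%n≡m; [m+n]%n≡m%n)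
open import Data.Nat.Induction using (<-rec)
import Data.Nat.Properties as ℕ
open import Data.Product.Base using (∃; ∃-syntax; _×_; _,_; proj₁; proj₂)
open import Data.Sum.Base using (_⊎_; inj₁; inj₂)
open import Data.Vec.Functional as Vector using (Vector)
open import Data.Vec.Functional.Properties using (insertAt-lookup; insertAt-punchIn)
open import Relation.Binary.PropositionalEquality.Core as ≡ using (_≡_)
open import Relation.Nullary.Decidable.Core using (Dec; yes; no)
open import Relation.Nullary.Negation.Core using (¬_)
open import Relation.Unary using (Pred)

-- Degrees enter part (1) only through inclusions. The fixed field of the K-endomorphisms of E lies
-- in every N with E/N Galois, so E has the largest degree over it, and a competitor of the same
-- degree contains it and therefore equals it. No group orders and no tower law are involved, and
-- endomorphisms take the place of automorphisms throughout.
--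
-- Linear disjointness is needed for the normal closures because a homomorphism may move elements of
-- L out of L, but never out of L̃.
--
-- The detour through q-th powers in part (2) is due to inseparability. Separability of y does not
-- visibly pass to its coordinates eⱼ; only their conjugates are under control. Additivity of the
-- q-th power makes the eⱼ separable all at once, and separability of y is what allows the power to
-- be undone at the end.
--
-- Chains of different lengths are reconciled by repeating the last member of the shorter one: its
-- stability says precisely that such a repetition is again a valid step.

module Magnification {ℓ : Level} (em : ExcludedMiddle (Level.suc ℓ)) (K̄ : HeytingField ℓ ℓ ℓ) where
  open import Data.Fin.Base using (zero; suc)
  open import Data.Nat.Base using (zero; suc)
  open FieldExtensions K̄ public
  open HeytingField K̄ public using (Carrier; _≈_; _+_; _*_; -_; 0#; 1#; heytingCommutativeRing)
  open HeytingField K̄ using (tight; #⇒invertible; invertible⇒#; #-irrefl)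

  -- Field arithmetic and classical reasoning in `K̄`

  ring : CommutativeRing ℓ ℓ
  ring = HeytingCommutativeRing.commutativeRing heytingCommutativeRing

  open CommutativeRing ring public using
    ( refl; sym; trans; setoid; reflexive; +-cong; +-congˡ; +-congʳ; *-cong; *-congˡ; *-congʳ; -‿cong
    ; +-identityˡ; +-identityʳ; *-identityˡ; *-identityʳ; zeroˡ; zeroʳ; -‿inverseˡ; -‿inverseʳ
    ; +-assoc; +-comm; *-assoc; *-comm; distribˡ; distribʳ; semiring; commutativeSemiring)
  open SemiringMult semiring using (×-homo-+; ×1-homo-*; ×-congʳ; ×-congˡ; ×-homo-1; ×-assoc-*) renaming (_×_ to _·_)
  open RingProperties (CommutativeRing.ring ring) public using
      (-‿involutive; -0#≈0#; -‿distribˡ-*; -‿distribʳ-*; -‿+-comm)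

  open import Relation.Binary.Reasoning.Setoid setoid hiding (start)

  private
    almost : AlmostCommutativeRing ℓ ℓ
    almost = fromCommutativeRing ring

    -- Formal differences of natural numbers as coefficients, so that the
    -- solver recognises cancellation.
    differences : RawRing _ _
    differences = record
      { Carrier = ℕ × ℕ ; _≈_ = _≡_
      ; _+_ = λ (a , b) (c , d) → a ℕ.+ c , b ℕ.+ d
      ; _*_ = λ (a , b) (c , d) → a ℕ.* c ℕ.+ b ℕ.* d , a ℕ.* d ℕ.+ b ℕ.* c
      ; -_ = λ (a , b) → b , a
      ; 0# = 0 , 0 ; 1# = 1 , 0 }

    ⟦_⟧ : ℕ × ℕ → Carrier
    ⟦ a , b ⟧ = (a · 1#) + - (b · 1#)

    module NS = RingSolver (AlmostCommutativeRing.rawRing almost) almost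
      (-raw-almostCommutative⟶ almost) (λ _ _ → nothing)

    +-swap : ∀ a b c d → (a + c) + - (b + d) ≈ (a + - b) + (c + - d)
    +-swap = NS.solve 4 (λ a b c d → (a NS.:+ c) NS.:+ NS.:- (b NS.:+ d) NS.:= (a NS.:+ NS.:- b) NS.:+
        (c NS.:+ NS.:- d)) refl

    expand : ∀ a b c d → (a + b) * (c + d) ≈ (a * c + b * d) + (a * d + b * c)
    expand = NS.solve 4 (λ a b c d → (a NS.:+ b) NS.:* (c NS.:+ d) NS.:= (a NS.:* c NS.:+ b NS.:* d) NS.:+
        (a NS.:* d NS.:+ b NS.:* c)) refl

    *-swap : ∀ a b c d → (a * c + b * d) + - (a * d + b * c) ≈ (a + - b) * (c + - d)
    *-swap a b c d = sym (trans (expand a (- b) c (- d)) (+-cong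
      (+-congˡ (trans (sym (-‿distribˡ-* b (- d))) (trans (-‿cong (sym (-‿distribʳ-* b d))) (-‿involutive _))))
      (trans (+-cong (sym (-‿distribʳ-* a d)) (sym (-‿distribˡ-* b c))) (-‿+-comm _ _))))

    hom* : ∀ a b c d → (a ℕ.* c ℕ.+ b ℕ.* d) · 1# ≈ (a · 1#) * (c · 1#) + (b · 1#) * (d · 1#)
    hom* a b c d = trans (×-homo-+ 1# (a ℕ.* c) (b ℕ.* d)) (+-cong (×1-homo-* a c) (×1-homo-* b d))

    cancel : ∀ {a b c d} → a + d ≈ c + b → a + - b ≈ c + - d
    cancel {a} {b} {c} {d} e = begin
      a + - b ≈⟨ +-congʳ (trans (sym (+-identityʳ a)) (trans (+-congˡ (sym (-‿inverseʳ d)))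
          (sym (+-assoc a d (- d))))) ⟩
      (a + d + - d) + - b ≈⟨ +-congʳ (+-congʳ e) ⟩
      (c + b + - d) + - b
        ≈⟨ +-congʳ (trans (+-assoc c b (- d)) (trans (+-congˡ (+-comm b (- d))) (sym (+-assoc c (- d) b)))) ⟩
      (c + - d + b) + - b ≈⟨ trans (+-assoc _ b (- b)) (trans (+-congˡ (-‿inverseʳ b)) (+-identityʳ _)) ⟩
      c + - d ∎

    morphism : differences -Raw-AlmostCommutative⟶ almost
    morphism = record
      { ⟦_⟧ = ⟦_⟧
      ; +-homo = λ (a , b) (c , d) → trans (+-cong (×-homo-+ 1# a c) (-‿cong (×-homo-+ 1# b d)))
                   (+-swap (a · 1#) (b · 1#) (c · 1#) (d · 1#))
      ; *-homo = λ (a , b) (c , d) → trans (+-cong (hom* a b c d) (-‿cong (hom* a b d c)))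
                   (*-swap (a · 1#) (b · 1#) (c · 1#) (d · 1#))
      ; -‿homo = λ (a , b) → trans (+-comm (b · 1#) (- (a · 1#)))
                   (trans (+-congˡ (sym (-‿involutive (b · 1#)))) (-‿+-comm (a · 1#) (- (b · 1#))))
      ; 0-homo = -‿inverseʳ 0#
      ; 1-homo = trans (+-cong (+-identityʳ 1#) -0#≈0#) (+-identityʳ 1#) }

    _≟_ : ∀ x y → Maybe (⟦ x ⟧ ≈ ⟦ y ⟧)
    (a , b) ≟ (c , d) with a ℕ.+ d ℕ.≟ c ℕ.+ b
    ... | yes e = just (cancel (trans (sym (×-homo-+ 1# a d))
        (trans (reflexive (≡.cong (_· 1#) e)) (×-homo-+ 1# c b))))
    ... | no  _ = nothing

  module Solver = RingSolver differences almost morphism _≟_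
  open Solver public using (solve; _:=_; _:+_; _:*_; _:-_; :-_)

  abstract
    dec : (P : Set ℓ) → Dec P
    dec P with em {Lift (Level.suc ℓ) P}
    ... | yes (lift p) = yes p
    ... | no ¬p        = no λ p → ¬p (lift p)

  by-contradiction : {P : Set ℓ} → ¬ ¬ P → P
  by-contradiction {P} ¬¬p with dec P
  ... | yes p = p
  ... | no ¬p = ⊥-elim (¬¬p ¬p)

  -- Nontriviality is hidden in the apartness: the difference of `1#` and `0#` is invertible, so
  -- they are apart, and apartness is irreflexive.
  1≉0 : ¬ 1# ≈ 0#
  1≉0 1≈0 = #-irrefl 1≈0 (invertible⇒# (1# , e , trans (*-comm _ _) e))
    where e : 1# * (1# + - 0#) ≈ 1#
          e = trans (*-identityˡ _) (trans (+-congˡ -0#≈0#) (+-identityʳ 1#))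

  inverse : ∀ {x} → ¬ x ≈ 0# → ∃[ y ] x * y ≈ 1#
  inverse {x} x≉0 with #⇒invertible {x} {0#} (by-contradiction λ ¬x#0 → x≉0 (proj₁ (tight x 0#) ¬x#0))
  ... | y , _ , e = y , trans (*-congʳ (sym (trans (+-congˡ -0#≈0#) (+-identityʳ x)))) e

  integral : ∀ {x y} → x * y ≈ 0# → ¬ x ≈ 0# → y ≈ 0#
  integral {x} {y} xy≈0 x≉0 with inverse x≉0
  ... | x⁻¹ , e = begin
    y             ≈⟨ *-identityˡ y ⟨
    1# * y        ≈⟨ *-congʳ e ⟨
    x * x⁻¹ * y   ≈⟨ solve 3 (λ x z y → x :* z :* y := z :* (x :* y)) refl x x⁻¹ y ⟩
    x⁻¹ * (x * y) ≈⟨ *-congˡ xy≈0 ⟩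
    x⁻¹ * 0#      ≈⟨ zeroʳ x⁻¹ ⟩
    0#            ∎

  +-cancel : ∀ {a b c} → a + c ≈ b + c → a ≈ b
  +-cancel {a} {b} {c} e = trans (sym (a+c-c a)) (trans (+-congʳ e) (a+c-c b))
    where a+c-c : ∀ a → a + c + - c ≈ a
          a+c-c a = solve 2 (λ a c → a :+ c :- c := a) refl a c

  ≈⇒-≈0 : ∀ {a b} → a ≈ b → a + - b ≈ 0#
  ≈⇒-≈0 {a} {b} e = trans (+-congʳ e) (-‿inverseʳ b)

  -≈0⇒≈ : ∀ {a b} → a + - b ≈ 0# → a ≈ b
  -≈0⇒≈ {a} {b} e = +-cancel (trans e (sym (-‿inverseʳ b)))

  least : (P : ℕ → Set ℓ) → ∀ n → P n → ∃[ m ] P m × (∀ k → k < m → ¬ P k)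
  least P = <-rec (λ n → P n → ∃[ m ] P m × (∀ k → k < m → ¬ P k)) step
    where
    step : ∀ n → (∀ {k} → k < n → P k → ∃[ m ] P m × (∀ k → k < m → ¬ P k)) →
           P n → ∃[ m ] P m × (∀ k → k < m → ¬ P k)
    step n rec p with dec (∃[ k ] k < n × P k)
    ... | yes (k , k<n , q) = rec k<n q
    ... | no  none          = n , p , λ k k<n q → none (k , k<n , q)

  open Subfield

  -- Polynomials

  -- The value at `x` of the polynomial with lower coefficients `t` and coefficient `e` in degree
  -- `length t`. The case `e = 0#` is `eval` and the case `e = 1#` is `monic`, so synthetic division
  -- is treated once for both.
  horner : Carrier → Poly → Carrier → Carrier
  horner e t x = foldr (λ a y → a + x * y) e t

  -- The monic polynomial whose lower coefficients are t.
  monic : Poly → Carrier → Carrier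
  monic = horner 1#

  scale : Carrier → Poly → Poly
  scale c = map (c *_)

  horner-cong : ∀ {e e′} t {x y} → e ≈ e′ → x ≈ y → horner e t x ≈ horner e′ t y
  horner-cong []      e x≈y = e
  horner-cong (a ∷ t) e x≈y = +-congˡ (*-cong x≈y (horner-cong t e x≈y))

  horner-closed : ∀ (E : Subfield) {e t x} → e ∈ E → t over E → x ∈ E → horner e t x ∈ E
  horner-closed E e∈ []         x∈ = e∈
  horner-closed E e∈ (a∈ ∷ t∈) x∈ = +-closed E a∈ (*-closed E x∈ (horner-closed E e∈ t∈ x∈))

  eval-vanishing : ∀ f x → (∀ n → coeff f n ≈ 0#) → eval f x ≈ 0#
  eval-vanishing []      x z = refl
  eval-vanishing (a ∷ f) x z = trans (+-cong (z 0) (trans (*-congˡ (eval-vanishing f x (λ n → z (suc n)))) (zeroʳ x)))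
      (+-identityˡ 0#)

  eval-≈ₚ : ∀ f g x → f ≈ₚ g → eval f x ≈ eval g x
  eval-≈ₚ []      g       x e = sym (eval-vanishing g x (λ n → sym (e n)))
  eval-≈ₚ (a ∷ f) []      x e = eval-vanishing (a ∷ f) x e
  eval-≈ₚ (a ∷ f) (b ∷ g) x e = +-cong (e 0) (*-congˡ (eval-≈ₚ f g x (λ n → e (suc n))))

  eval-scale : ∀ c f x → eval (scale c f) x ≈ c * eval f x
  eval-scale c []      x = sym (zeroʳ c)
  eval-scale c (a ∷ f) x = trans (+-congˡ (*-congˡ (eval-scale c f x)))
    (solve 4 (λ c a x y → c :* a :+ x :* (c :* y) := c :* (a :+ x :* y)) refl c a x (eval f x))

  eval-+ₚ : ∀ f g x → eval (f +ₚ g) x ≈ eval f x + eval g x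
  eval-+ₚ []      g       x = sym (+-identityˡ _)
  eval-+ₚ (a ∷ f) []      x = sym (+-identityʳ _)
  eval-+ₚ (a ∷ f) (b ∷ g) x = trans (+-congˡ (*-congˡ (eval-+ₚ f g x)))
    (solve 5 (λ a b x y z → (a :+ b) :+ x :* (y :+ z) := (a :+ x :* y) :+ (b :+ x :* z)) refl a b x (eval f x)
        (eval g x))

  eval-*ₚ : ∀ f g x → eval (f *ₚ g) x ≈ eval f x * eval g x
  eval-*ₚ []      g x = sym (zeroˡ _)
  eval-*ₚ (a ∷ f) g x = begin
    eval (scale a g +ₚ (0# ∷ f *ₚ g)) x      ≈⟨ eval-+ₚ (scale a g) (0# ∷ f *ₚ g) x ⟩
    eval (scale a g) x + (0# + x * eval (f *ₚ g) x)
      ≈⟨ +-cong (eval-scale a g x) (trans (+-identityˡ _) (*-congˡ (eval-*ₚ f g x))) ⟩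
    a * eval g x + x * (eval f x * eval g x)
      ≈⟨ solve 4 (λ a x y z → a :* z :+ x :* (y :* z) := (a :+ x :* y) :* z) refl a x (eval f x) (eval g x) ⟩
    (a + x * eval f x) * eval g x            ∎

  eval-X- : ∀ r x → eval (X- r) x ≈ x + - r
  eval-X- r x = trans (+-congˡ (trans (*-congˡ (trans (+-congˡ (zeroʳ x)) (+-identityʳ 1#))) (*-identityʳ x)))
      (+-comm (- r) x)

  eval-constant : ∀ c x → eval (c ∷ []) x ≈ c
  eval-constant c x = trans (+-congˡ (zeroʳ x)) (+-identityʳ c)

  eval-∷ʳ : ∀ t c x → eval (t ∷ʳ c) x ≈ horner c t x
  eval-∷ʳ []      c x = eval-constant c x
  eval-∷ʳ (a ∷ t) c x = +-congˡ (*-congˡ (eval-∷ʳ t c x))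

  -ₚ_ : Poly → Poly
  -ₚ_ = scale (- 1#)

  eval--ₚ : ∀ f x → eval (-ₚ f) x ≈ - eval f x
  eval--ₚ f x = trans (eval-scale (- 1#) f x) (trans (sym (-‿distribˡ-* 1# _)) (-‿cong (*-identityˡ _)))

  coeff-+ₚ : ∀ f g n → coeff (f +ₚ g) n ≈ coeff f n + coeff g n
  coeff-+ₚ []      g       n       = sym (+-identityˡ _)
  coeff-+ₚ (a ∷ f) []      n       = sym (+-identityʳ _)
  coeff-+ₚ (a ∷ f) (b ∷ g) zero    = refl
  coeff-+ₚ (a ∷ f) (b ∷ g) (suc n) = coeff-+ₚ f g n

  coeff-scale : ∀ c f n → coeff (scale c f) n ≈ c * coeff f n
  coeff-scale c []      n       = sym (zeroʳ c)
  coeff-scale c (a ∷ f) zero    = refl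
  coeff-scale c (a ∷ f) (suc n) = coeff-scale c f n

  coeff-last : ∀ t c → coeff (t ∷ʳ c) (length t) ≡ c
  coeff-last []      c = ≡.refl
  coeff-last (a ∷ t) c = coeff-last t c

  module _ (E : Subfield) where
    scale-over : ∀ {c f} → c ∈ E → f over E → scale c f over E
    scale-over c∈ []         = []
    scale-over c∈ (a∈ ∷ f∈) = *-closed E c∈ a∈ ∷ scale-over c∈ f∈

    +ₚ-over : ∀ {f g} → f over E → g over E → (f +ₚ g) over E
    +ₚ-over []         g∈         = g∈
    +ₚ-over (a∈ ∷ f∈) []         = a∈ ∷ f∈
    +ₚ-over (a∈ ∷ f∈) (b∈ ∷ g∈) = +-closed E a∈ b∈ ∷ +ₚ-over f∈ g∈

    *ₚ-over : ∀ {f g} → f over E → g over E → (f *ₚ g) over E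
    *ₚ-over []         g∈ = []
    *ₚ-over (a∈ ∷ f∈) g∈ = +ₚ-over (scale-over a∈ g∈) (0-closed E ∷ *ₚ-over f∈ g∈)

    -1-closed : - 1# ∈ E
    -1-closed = neg-closed E (1-closed E)

    -ₚ-over : ∀ {f} → f over E → (-ₚ f) over E
    -ₚ-over = scale-over -1-closed

    ∷ʳ-over : ∀ {t c} → t over E → c ∈ E → (t ∷ʳ c) over E
    ∷ʳ-over []         c∈ = c∈ ∷ []
    ∷ʳ-over (a∈ ∷ t∈) c∈ = a∈ ∷ ∷ʳ-over t∈ c∈

  over-⊆ : ∀ E F {f} → E ⊆ F → f over E → f over F
  over-⊆ E F E⊆F = All.map E⊆F

  -- Unlike `_+ₚ_` this keeps the length, on which degree bounds rest; since `zipWith` truncates, it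
  -- is sensible only for lists of equal length.
  addScaled : Carrier → Poly → Poly → Poly
  addScaled k = zipWith (λ a b → a + k * b)

  horner-addScaled : ∀ k {e e′} s t x → length s ≡ length t →
    horner (e + k * e′) (addScaled k s t) x ≈ horner e s x + k * horner e′ t x
  horner-addScaled k []      []      x _ = refl
  horner-addScaled k {e} {e′} (a ∷ s) (b ∷ t) x l = trans
      (+-congˡ (*-congˡ (horner-addScaled k s t x (ℕ.suc-injective l))))
    (solve 6 (λ a k b x y z → (a :+ k :* b) :+ x :* (y :+ k :* z) := (a :+ x :* y) :+ k :* (b :+ x :* z))
      refl a k b x (horner e s x) (horner e′ t x))

  addScaled-over : ∀ (E : Subfield) {k s t} → k ∈ E → s over E → t over E → addScaled k s t over E
  addScaled-over E k∈ []         t∈         = []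
  addScaled-over E k∈ (a∈ ∷ s∈) []         = []
  addScaled-over E k∈ (a∈ ∷ s∈) (b∈ ∷ t∈) = +-closed E a∈ (*-closed E k∈ b∈) ∷ addScaled-over E k∈ s∈ t∈

  addScaled-length : ∀ k s t → length s ≡ length t → length (addScaled k s t) ≡ length s
  addScaled-length k s t l = ≡.trans (length-zipWith _ s t) (ℕ.m≤n⇒m⊓n≡m (ℕ.≤-reflexive l))

  -- The quotient of a polynomial with tail t by X − r (synthetic division); it does not depend on the constant term.
  quotient : Carrier → Carrier → Poly → Poly
  quotient e r []      = []
  quotient e r (b ∷ t) = horner e (b ∷ t) r ∷ quotient e r t

  quotient-length : ∀ e r t → length (quotient e r t) ≡ length t
  quotient-length e r []      = ≡.refl
  quotient-length e r (b ∷ t) = ≡.cong suc (quotient-length e r t)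

  quotient-over : ∀ (E : Subfield) {e r t} → e ∈ E → r ∈ E → t over E → quotient e r t over E
  quotient-over E e∈ r∈ []         = []
  quotient-over E e∈ r∈ (b∈ ∷ t∈) = horner-closed E e∈ (b∈ ∷ t∈) r∈ ∷ quotient-over E e∈ r∈ t∈

  horner-quotient : ∀ e r a t x →
    horner e (a ∷ t) x ≈ (x + - r) * horner e (quotient e r t) x + horner e (a ∷ t) r
  horner-quotient e r a []      x = solve 4 (λ a x e r → a :+ x :* e := (x :- r) :* e :+ (a :+ r :* e)) refl a x e r
  horner-quotient e r a (b ∷ t) x = begin
    a + x * horner e (b ∷ t) x
      ≈⟨ +-congˡ (*-congˡ (horner-quotient e r b t x)) ⟩
    a + x * ((x + - r) * Q + T)
      ≈⟨ solve 5 (λ a x r Q T → a :+ x :* ((x :- r) :* Q :+ T) := (x :- r) :* (T :+ x :* Q) :+ (a :+ r :* T)) refl a x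
          r Q T ⟩
    (x + - r) * (T + x * Q) + (a + r * T) ∎
    where Q = horner e (quotient e r t) x ; T = horner e (b ∷ t) r

  root-quotient : ∀ e r a t → horner e (a ∷ t) r ≈ 0# →
    ∀ x → horner e (a ∷ t) x ≈ (x + - r) * horner e (quotient e r t) x
  root-quotient e r a t z x = trans (horner-quotient e r a t x) (trans (+-congˡ z) (+-identityʳ _))

  linears : List Carrier → Carrier → Carrier
  linears rs x = foldr (λ r y → (x + - r) * y) 1# rs

  linears-root : ∀ rs {x} → Any (x ≈_) rs → linears rs x ≈ 0#
  linears-root (r ∷ rs) (here e)  = trans (*-congʳ (≈⇒-≈0 e)) (zeroˡ _)
  linears-root (r ∷ rs) (there i) = trans (*-congˡ (linears-root rs i)) (zeroʳ _)

  root-linears : ∀ rs {x} → linears rs x ≈ 0# → Any (x ≈_) rs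
  root-linears []       e = ⊥-elim (1≉0 e)
  root-linears (r ∷ rs) {x} e with dec (x + - r ≈ 0#)
  ... | yes z = here (-≈0⇒≈ z)
  ... | no  n = there (root-linears rs (integral e n))

  Distinct : List Carrier → Set ℓ
  Distinct = AllPairs (λ x y → ¬ x ≈ y)

  -- A list of length n has degree below n, so n distinct roots already suffice. Dividing by X - z
  -- leaves the other roots as roots of the quotient because they differ from z.
  too-many-roots : ∀ w zs → length w ≤ length zs → Distinct zs → All (λ z → eval w z ≈ 0#) zs → ∀ x → eval w x ≈ 0#
  too-many-roots []      zs       _         _         _        x = refl
  too-many-roots (a ∷ t) (z ∷ zs) (s≤s l) (d ∷ ds) (e ∷ es) x =
    trans (root-quotient 0# z a t e x) (trans (*-congˡ q≈0) (zeroʳ _))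
    where
    roots : ∀ {zs} → All (λ y → ¬ z ≈ y) zs → All (λ y → eval (a ∷ t) y ≈ 0#) zs → All
        (λ y → eval (quotient 0# z t) y ≈ 0#) zs
    roots []       []       = []
    roots (d ∷ ds) (e′ ∷ es) = integral (trans (sym (root-quotient 0# z a t e _)) e′)
        (λ y-z≈0 → d (sym (-≈0⇒≈ y-z≈0))) ∷ roots ds es
    q≈0 = too-many-roots (quotient 0# z t) zs (ℕ.≤-trans (ℕ.≤-reflexive (quotient-length 0# z t)) l) ds (roots d es) x

  -- The derivative of a polynomial with tail t.
  tailDerivative : Poly → Poly
  tailDerivative []      = []
  tailDerivative (b ∷ t) = (b ∷ t) +ₚ (0# ∷ tailDerivative t)

  -- For f with tail `t` the quotient is (f(X) - f(r)) / (X - r), whose value at `r` is f′(r).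
  -- Multiple roots are detected through this identity.
  quotient-derivative : ∀ r t → eval (quotient 0# r t) r ≈ eval (tailDerivative t) r
  quotient-derivative r []      = refl
  quotient-derivative r (b ∷ t) = sym (trans (eval-+ₚ (b ∷ t) (0# ∷ tailDerivative t) r)
    (+-congˡ (trans (+-identityˡ _) (*-congˡ (sym (quotient-derivative r t))))))

  -- Polynomial functions over an algebraically closed field

  module _ (closed : ∀ f → ¬ Constant f → ∃[ x ] Root f x) where

    surjective : ∀ f → ¬ Constant f → ∀ c → ∃[ x ] eval f x ≈ c
    surjective f ¬const c with closed ((- c ∷ []) +ₚ f) (λ const → ¬const λ n →
                                 trans (trans (sym (+-identityˡ _)) (sym (coeff-+ₚ (- c ∷ []) f (suc n)))) (const n))
    ... | x , e = x , -≈0⇒≈ (trans (+-comm _ _) (trans (+-congʳ (sym (eval-constant (- c) x)))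
        (trans (sym (eval-+ₚ (- c ∷ []) f x)) e)))

    constant-eval : ∀ f → Constant f → ∀ x → eval f x ≈ coeff f 0
    constant-eval []      c x = refl
    constant-eval (a ∷ f) c x = trans (+-congˡ (trans (*-congˡ (eval-vanishing f x c)) (zeroʳ x))) (+-identityʳ a)

    -- A nonconstant polynomial attains the value 1, so a vanishing one is constant, and then its
    -- value is its constant coefficient.
    vanishing-coeff : ∀ f → (∀ x → eval f x ≈ 0#) → ∀ n → coeff f n ≈ 0#
    vanishing-coeff f z n with dec (Constant f)
    ... | no ¬c = ⊥-elim (1≉0 (let x , e = surjective f ¬c 1# in trans (sym e) (z x)))
    vanishing-coeff f z zero    | yes c = trans (sym (constant-eval f c 0#)) (z 0#)
    vanishing-coeff f z (suc n) | yes c = c n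

    extensionality : ∀ f g → (∀ x → eval f x ≈ eval g x) → f ≈ₚ g
    extensionality f g e n = -≈0⇒≈ (trans (+-congˡ (sym coeff--ₚ)) (trans (sym (coeff-+ₚ f (-ₚ g) n)) (vanishing-coeff (f +ₚ (-ₚ g)) z n)))
      where
      coeff--ₚ : coeff (-ₚ g) n ≈ - coeff g n
      coeff--ₚ = trans (coeff-scale (- 1#) g n) (trans (sym (-‿distribˡ-* 1# _)) (-‿cong (*-identityˡ _)))
      z : ∀ x → eval (f +ₚ (-ₚ g)) x ≈ 0#
      z x = trans (eval-+ₚ f (-ₚ g) x) (trans (+-congˡ (eval--ₚ g x)) (≈⇒-≈0 (e x)))

    third-element : ∃[ c ] ¬ c ≈ 0# × ¬ c ≈ 1#
    -- A root of X² - X - 1, which takes the value -1 at both 0 and 1.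
    third-element with closed (- 1# ∷ - 1# ∷ 1# ∷ []) (λ const → 1≉0 (const 1))
    ... | c , e = c , (λ c≈0 → -1≉0 (trans (at0 c≈0) e)) , (λ c≈1 → -1≉0 (trans (at1 c≈1) e))
      where
      -1≉0 : ¬ - 1# ≈ 0#
      -1≉0 e = 1≉0 (trans (sym (-‿involutive 1#)) (trans (-‿cong e) -0#≈0#))
      at0 : c ≈ 0# → - 1# ≈ _
      at0 c≈0 = sym (trans (+-congˡ (trans (*-congʳ c≈0) (zeroˡ _))) (+-identityʳ _))
      at1 : c ≈ 1# → - 1# ≈ _
      at1 c≈1 = sym (trans (+-congˡ (trans (*-cong c≈1
          (trans (+-congˡ (trans (*-congʳ c≈1) (trans (*-identityˡ _) (trans (+-congˡ (zeroʳ c)) (+-identityʳ _)))))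
          (-‿inverseˡ 1#))) (zeroʳ 1#))) (+-identityʳ _))

    -- `w` vanishes away from `s`, so a nonzero value can be attained at `s` only. A nonconstant `w`
    -- would attain both 1 and the third element there; hence `w` is constant and may be evaluated
    -- at `s + 1`, which differs from `s`.
    cancel-linear : ∀ s w → (∀ x → (x + - s) * eval w x ≈ 0#) → ∀ x → eval w x ≈ 0#
    cancel-linear s w z = everywhere
      where
      away : ∀ x → ¬ x ≈ s → eval w x ≈ 0#
      away x x≉s = integral (z x) (λ e → x≉s (-≈0⇒≈ e))
      attained-at-s : ∀ c x → ¬ c ≈ 0# → eval w x ≈ c → eval w s ≈ c
      attained-at-s c x c≉0 e with dec (x ≈ s)
      ... | yes x≈s = trans (horner-cong w refl (sym x≈s)) e
      ... | no  x≉s = ⊥-elim (c≉0 (trans (sym e) (away x x≉s)))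
      const : Constant w
      const = by-contradiction λ ¬c → let c , c≉0 , c≉1 = third-element
                                          x , ex = surjective w ¬c c
                                          y , ey = surjective w ¬c 1#
                                      in c≉1 (trans (sym (attained-at-s c x c≉0 ex)) (attained-at-s 1# y 1≉0 ey))
      everywhere : ∀ x → eval w x ≈ 0#
      everywhere x = trans (constant-eval w const x) (trans (sym (constant-eval w const (s + 1#)))
          (away (s + 1#) λ e →
        1≉0 (trans (sym (trans (+-congʳ (-‿inverseˡ s)) (+-identityˡ 1#)))
            (trans (+-assoc (- s) s 1#) (trans (+-congˡ e) (-‿inverseˡ s))))))

    monic-nonconstant : ∀ a t → ¬ Constant ((a ∷ t) ∷ʳ 1#)
    monic-nonconstant a t c = 1≉0 (trans (sym (reflexive (coeff-last t 1#))) (c (length t)))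

    monic-splits : ∀ n t → length t ≡ n → ∃[ zs ] length zs ≡ n × (∀ x → monic t x ≈ linears zs x)
    monic-splits zero    []      l = [] , ≡.refl , λ _ → refl
    monic-splits (suc n) (a ∷ t) l with closed ((a ∷ t) ∷ʳ 1#) (monic-nonconstant a t)
    ... | r , e with monic-splits n (quotient 1# r t) (≡.trans (quotient-length 1# r t) (ℕ.suc-injective l))
    ... | zs , l′ , h = r ∷ zs , ≡.cong suc l′ , λ x →
          trans (root-quotient 1# r a t (trans (sym (eval-∷ʳ (a ∷ t) 1# r)) e) x) (*-congˡ (h x))

  module OverBase (K : Subfield) (closure : IsAlgebraicClosureOf K) where
    open IsAlgebraicClosureOf closure renaming (algebraically-closed to closed)

    -- Minimal polynomials and separability

    Vanishing : Poly → Set ℓ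
    Vanishing f = ∀ x → eval f x ≈ 0#

    -- Trailing zeros may hide the leading coefficient, so at each entry it is asked whether the
    -- rest of the list vanishes as a function; if it does, that entry is the leading coefficient.
    normalise : ∀ (F : Subfield) f → f over F → ¬ Vanishing f →
      ∃[ c ] ∃[ t ] c ∈ F × ¬ c ≈ 0# × t over F × length t < length f × (∀ x → eval f x ≈ c * monic t x)
    normalise F []      f∈        f≢0 = ⊥-elim (f≢0 λ _ → refl)
    normalise F (a ∷ f) (a∈ ∷ f∈) f≢0 with dec (Vanishing f)
    ... | yes f≡0 = a , [] , a∈ , a≉0 , [] , s≤s z≤n , λ x → trans (a+0 x) (sym (*-identityʳ a))
      where
      a+0 : ∀ x → eval (a ∷ f) x ≈ a
      a+0 x = trans (+-congˡ (trans (*-congˡ (f≡0 x)) (zeroʳ x))) (+-identityʳ a)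
      a≉0 : ¬ a ≈ 0#
      a≉0 a≈0 = f≢0 λ x → trans (a+0 x) a≈0
    ... | no f≢0′ with normalise F f f∈ f≢0′
    ... | c , t , c∈ , c≉0 , t∈ , l , e with inverse c≉0
    ... | c⁻¹ , cc⁻¹≈1 = c , a * c⁻¹ ∷ t , c∈ , c≉0 , *-closed F a∈ (inv-closed F cc⁻¹≈1 c∈) ∷ t∈ , s≤s l , λ x →
        begin
        a + x * eval f x
          ≈⟨ +-cong (trans (sym (*-identityʳ a)) (*-congˡ (sym cc⁻¹≈1))) (*-congˡ (e x)) ⟩
        a * (c * c⁻¹) + x * (c * monic t x)
          ≈⟨ solve 5 (λ a c d x m → a :* (c :* d) :+ x :* (c :* m) := c :* (a :* d :+ x :* m)) refl a c c⁻¹ x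
          (monic t x) ⟩
        c * (a * c⁻¹ + x * monic t x)     ∎

    -- A minimal polynomial, without its leading coefficient 1.
    record MinimalPolynomial (F : Subfield) (z : Carrier) : Set ℓ where
      field
        lower   : Poly
        lower∈  : lower over F
        root    : monic lower z ≈ 0#
        -- Length at most `length lower` means degree strictly below that of the minimal polynomial,
        -- whose full list `poly` is one entry longer.
        minimal : ∀ r → r over F → length r ≤ length lower → eval r z ≈ 0# → Vanishing r

      poly : Poly
      poly = lower ∷ʳ 1#

      degree : ℕ
      degree = length lower

      poly∈ : poly over F
      poly∈ = ∷ʳ-over F lower∈ (1-closed F)

      eval-poly : ∀ x → eval poly x ≈ monic lower x
      eval-poly = eval-∷ʳ lower 1#

      roots : List Carrier
      roots = proj₁ (monic-splits closed degree lower ≡.refl)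

      roots-length : length roots ≡ degree
      roots-length = proj₁ (proj₂ (monic-splits closed degree lower ≡.refl))

      factors : ∀ x → monic lower x ≈ linears roots x
      factors = proj₂ (proj₂ (monic-splits closed degree lower ≡.refl))

      root⇒any : ∀ {r} → monic lower r ≈ 0# → Any (r ≈_) roots
      root⇒any e = root-linears roots (trans (sym (factors _)) e)

      any⇒root : ∀ {r} → Any (r ≈_) roots → monic lower r ≈ 0#
      any⇒root i = trans (factors _) (linears-root roots i)

      poly-nonconstant : ¬ Constant poly
      poly-nonconstant with lower in eq
      ... | []    = ⊥-elim (1≉0 (trans (reflexive (≡.cong (λ t → monic t z) (≡.sym eq))) root))
      ... | a ∷ t = monic-nonconstant closed a t

    algebraic-over : ∀ F → K ⊆ F → ∀ z → AlgebraicOver F z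
    algebraic-over F K⊆F z with algebraic z
    ... | f , f∈ , f≢0 , e = f , over-⊆ K F K⊆F f∈ , f≢0 , e

    nonzero⇒nonvanishing : ∀ f → NonZero f → ¬ Vanishing f
    nonzero⇒nonvanishing f (n , c≉0) z = c≉0 (vanishing-coeff closed f z n)

    annihilator : ∀ F z f → f over F → ¬ Vanishing f → eval f z ≈ 0# → ∃[ t ] t over F × length t < length f × monic t
        z ≈ 0#
    annihilator F z f f∈ f≢0 e with normalise F f f∈ f≢0
    ... | c , t , c∈ , c≉0 , t∈ , l , f≈ct = t , t∈ , l , integral (trans (sym (f≈ct z)) e) c≉0

    abstract
      minimalPolynomial : ∀ F → K ⊆ F → ∀ z → MinimalPolynomial F z
      minimalPolynomial F K⊆F z = from-algebraic (algebraic-over F K⊆F z)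
        where
        HasDegree : ℕ → Set ℓ
        HasDegree n = ∃[ t ] length t ≡ n × t over F × monic t z ≈ 0#
        from-least : ∃[ n ] HasDegree n × (∀ k → k < n → ¬ HasDegree k) → MinimalPolynomial F z
        from-least (_ , (t , ≡.refl , t∈ , e) , smallest) = record
          { lower = t ; lower∈ = t∈ ; root = e
          ; minimal = λ r r∈ l er → by-contradiction λ r≢0 →
              let s , s∈ , l′ , es = annihilator F z r r∈ r≢0 er
              in smallest (length s) (ℕ.≤-trans l′ l) (s , ≡.refl , s∈ , es) }
        from-algebraic : AlgebraicOver F z → MinimalPolynomial F z
        from-algebraic (f , f∈ , f≢0 , e) =
          let t , t∈ , _ , e′ = annihilator F z f f∈ (nonzero⇒nonvanishing f f≢0) e
          in from-least (least HasDegree _ (t , ≡.refl , t∈ , e′))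

    unsnoc : ∀ F n f → f over F → length f ≡ suc n → ∃[ s ] ∃[ c ] f ≡ s ∷ʳ c × length s ≡ n × s over F × c ∈ F
    unsnoc F n       []          f∈          ()
    unsnoc F zero    (a ∷ [])    (a∈ ∷ [])   _ = [] , a , ≡.refl , ≡.refl , [] , a∈
    unsnoc F (suc n) (a ∷ b ∷ f) (a∈ ∷ f∈) l with unsnoc F n (b ∷ f) f∈ (ℕ.suc-injective l)
    ... | s , c , eq , l′ , s∈ , c∈ = a ∷ s , c , ≡.cong (a ∷_) eq , ≡.cong suc l′ , a∈ ∷ s∈ , c∈

    division : ∀ (F : Subfield) t → t over F → ∀ g → g over F →
      ∃[ q ] ∃[ r ] q over F × r over F × length r ≡ length t × (∀ x → eval g x ≈ eval q x * monic t x + eval r x)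
    division F t t∈ [] [] = [] , replicate (length t) 0# , [] , zeros (length t) , length-replicate (length t) ,
        λ x → sym (trans (+-cong (zeroˡ _) (eval-zeros (length t) x)) (+-identityˡ 0#))
      where
      zeros : ∀ n → replicate n 0# over F
      zeros zero    = []
      zeros (suc n) = 0-closed F ∷ zeros n
      eval-zeros : ∀ n x → eval (replicate n 0#) x ≈ 0#
      eval-zeros zero    x = refl
      eval-zeros (suc n) x = trans (+-identityˡ _) (trans (*-congˡ (eval-zeros n x)) (zeroʳ x))
    division F t t∈ (a ∷ g) (a∈ ∷ g∈) with division F t t∈ g g∈
    -- The remainder for `a ∷ g` starts as `a ∷ r`, one entry too long. Its top coefficient `c` is
    -- cleared by subtracting `c` times the divisor, and `c` becomes the constant coefficient of the
    -- new quotient.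
    ... | q , r , q∈ , r∈ , l , e with unsnoc F (length t) (a ∷ r) (a∈ ∷ r∈) (≡.cong suc l)
    ... | s , c , eq , l′ , s∈ , c∈ = c ∷ q , addScaled (- c) s t , c∈ ∷ q∈ , addScaled-over F (neg-closed F c∈) s∈ t∈
        ,
          ≡.trans (addScaled-length (- c) s t l′) l′ , identity
      where
      remainder : ∀ x → a + x * eval r x ≈ eval (addScaled (- c) s t) x + c * monic t x
      remainder x = begin
        eval (a ∷ r) x                                   ≡⟨ ≡.cong (λ f → eval f x) eq ⟩
        eval (s ∷ʳ c) x                                  ≈⟨ eval-∷ʳ s c x ⟩
        horner c s x
          ≈⟨ solve 2 (λ h d → h := h :- d :+ d) refl _ (c * monic t x) ⟩
        horner c s x + - (c * monic t x) + c * monic t x ≈⟨ +-congʳ (+-congˡ (-‿distribˡ-* c _)) ⟩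
        horner c s x + - c * monic t x + c * monic t x   ≈⟨ +-congʳ (horner-addScaled (- c) s t x l′) ⟨
        horner (c + - c * 1#) (addScaled (- c) s t) x + c * monic t x
          ≈⟨ +-congʳ (horner-cong (addScaled (- c) s t) (trans (+-congˡ (*-identityʳ _)) (-‿inverseʳ c)) refl) ⟩
        eval (addScaled (- c) s t) x + c * monic t x     ∎
      identity : ∀ x → a + x * eval g x ≈ (c + x * eval q x) * monic t x + eval (addScaled (- c) s t) x
      identity x = begin
        a + x * eval g x
          ≈⟨ +-congˡ (*-congˡ (e x)) ⟩
        a + x * (eval q x * monic t x + eval r x)
          ≈⟨ solve 5 (λ a x q m r → a :+ x :* (q :* m :+ r) := x :* (q :* m) :+ (a :+ x :* r)) refl a x (eval q x)
              (monic t x) (eval r x) ⟩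
        x * (eval q x * monic t x) + (a + x * eval r x)
          ≈⟨ +-congˡ (remainder x) ⟩
        x * (eval q x * monic t x) + (eval (addScaled (- c) s t) x + c * monic t x)
          ≈⟨ solve 5 (λ c x q m r → x :* (q :* m) :+ (r :+ c :* m) := (c :+ x :* q) :* m :+ r) refl c x (eval q x)
              (monic t x) (eval (addScaled (- c) s t) x) ⟩
        (c + x * eval q x) * monic t x + eval (addScaled (- c) s t) x ∎

    module _ {F z} (m : MinimalPolynomial F z) where
      open MinimalPolynomial m

      reduce : ∀ g → g over F → ∃[ q ] ∃[ r ] q over F × r over F × length r ≡ degree × eval g z ≈ eval r z ×
          (∀ x → eval g x ≈ eval q x * monic lower x + eval r x)
      reduce g g∈ with division F lower lower∈ g g∈
      ... | q , r , q∈ , r∈ , l , e = q , r , q∈ , r∈ , l , trans (e z)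
          (trans (+-congʳ (trans (*-congˡ root) (zeroʳ _))) (+-identityˡ _)) , e

      divides : ∀ g → g over F → eval g z ≈ 0# → ∃[ q ] q over F × (∀ x → eval g x ≈ eval q x * monic lower x)
      divides g g∈ gz≈0 with reduce g g∈
      ... | q , r , q∈ , r∈ , l , gz≈rz , e = q , q∈ , λ x →
        trans (e x) (trans (+-congˡ (minimal r r∈ (ℕ.≤-reflexive l) (trans (sym gz≈rz) gz≈0) x)) (+-identityʳ _))

    cancel-linears : ∀ zs w → (∀ x → linears zs x * eval w x ≈ 0#) → Vanishing w
    cancel-linears []       w e x = trans (sym (*-identityˡ _)) (e x)
    cancel-linears (z ∷ zs) w e = cancel-linear closed z w λ x →
      trans (*-congʳ (sym (eval-X- z x))) (trans (sym (eval-*ₚ (X- z) w x))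
          (cancel-linears zs ((X- z) *ₚ w) (λ x → begin
        linears zs x * eval ((X- z) *ₚ w) x ≈⟨ *-congˡ (trans (eval-*ₚ (X- z) w x) (*-congʳ (eval-X- z x))) ⟩
        linears zs x * ((x + - z) * eval w x)
          ≈⟨ solve 3 (λ l d w → l :* (d :* w) := d :* l :* w) refl (linears zs x) (x + - z) (eval w x) ⟩
        (x + - z) * linears zs x * eval w x ≈⟨ e x ⟩
        0# ∎) x))

    cancel-monic : ∀ t w → (∀ x → monic t x * eval w x ≈ 0#) → Vanishing w
    cancel-monic t w e with monic-splits closed (length t) t ≡.refl
    ... | zs , _ , h = cancel-linears zs w λ x → trans (*-congʳ (sym (h x))) (e x)

    -- If m = g h, then `z` is a root of one factor, say g. So m divides g, say g = q m, whence m (1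
    -- - q h) = 0 and q h = 1. A nonconstant h would have a root, where this reads 0 = 1.
    minimalPolynomial-irreducible : ∀ {F z} (m : MinimalPolynomial F z) → Irreducible F (MinimalPolynomial.poly m)
    minimalPolynomial-irreducible {F} {z} m = record
      { coefficients = poly∈ ; nonConstant = poly-nonconstant ; noFactors = noFactors }
      where
      open MinimalPolynomial m
      cofactor-constant : ∀ g h → g over F → (∀ x → monic lower x ≈ eval g x * eval h x) → eval g z ≈ 0# → Constant h
      cofactor-constant g h g∈ e gz≈0 with divides m g g∈ gz≈0
      ... | q , q∈ , g≈qm = by-contradiction λ ¬c → let x , hx≈0 = closed h ¬c in
          1≉0 (trans (sym (trans (+-congˡ (trans (-‿cong (trans (*-congˡ hx≈0) (zeroʳ _))) -0#≈0#)) (+-identityʳ 1#)))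
                     (trans (sym (eval-w x)) (cancel-monic lower w mw≈0 x)))
        where
        w : Poly
        w = (1# ∷ []) +ₚ (-ₚ (q *ₚ h))
        eval-w : ∀ x → eval w x ≈ 1# + - (eval q x * eval h x)
        eval-w x = trans (eval-+ₚ (1# ∷ []) (-ₚ (q *ₚ h)) x) (+-cong (eval-constant 1# x) (trans (eval--ₚ (q *ₚ h) x) (-‿cong (eval-*ₚ q h x))))
        mw≈0 : ∀ x → monic lower x * eval w x ≈ 0#
        mw≈0 x = begin
          monic lower x * eval w x ≈⟨ *-congˡ (eval-w x) ⟩
          monic lower x * (1# + - (eval q x * eval h x))
            ≈⟨ solve 4 (λ m o q h → m :* (o :- q :* h) := m :* o :- (q :* m) :* h) refl (monic lower x) 1# (eval q x)
            (eval h x) ⟩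
          monic lower x * 1# + - ((eval q x * monic lower x) * eval h x)
            ≈⟨ ≈⇒-≈0 (trans (*-identityʳ _) (trans (e x) (*-congʳ (g≈qm x)))) ⟩
          0# ∎
      noFactors : ∀ g h → g over F → h over F → poly ≈ₚ g *ₚ h → Constant g ⊎ Constant h
      noFactors g h g∈ h∈ eq with dec (eval g z ≈ 0#)
      ... | yes gz≈0 = inj₂ (cofactor-constant g h g∈ product gz≈0)
        where
        product : ∀ x → monic lower x ≈ eval g x * eval h x
        product x = trans (sym (eval-poly x)) (trans (eval-≈ₚ poly (g *ₚ h) x eq) (eval-*ₚ g h x))
      ... | no gz≉0 = inj₁ (cofactor-constant h g h∈ (λ x → trans (product x) (*-comm _ _))
          (integral (trans (sym (product z)) root) gz≉0))
        where
        product : ∀ x → monic lower x ≈ eval g x * eval h x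
        product x = trans (sym (eval-poly x)) (trans (eval-≈ₚ poly (g *ₚ h) x eq) (eval-*ₚ g h x))

    irreducible-associate : ∀ {F z} (m : MinimalPolynomial F z) g → Irreducible F g → Root g z →
      ∃[ c ] ¬ c ≈ 0# × (∀ x → eval g x ≈ c * monic (MinimalPolynomial.lower m) x)
    irreducible-associate {F} {z} m g irr gz≈0 = from-divides (divides m g (Irreducible.coefficients irr) gz≈0)
      where
      open MinimalPolynomial m
      from-divides : ∃[ q ] q over F × (∀ x → eval g x ≈ eval q x * monic lower x) → _
      from-divides (q , q∈ , g≈qm) = from-factors (Irreducible.noFactors irr q poly q∈ poly∈
          (extensionality closed g (q *ₚ poly) λ x → trans (g≈qm x)
              (trans (*-congˡ (sym (eval-poly x))) (sym (eval-*ₚ q poly x)))))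
        where
        from-factors : Constant q ⊎ Constant poly → ∃[ c ] ¬ c ≈ 0# × (∀ x → eval g x ≈ c * monic lower x)
        from-factors (inj₂ c) = ⊥-elim (poly-nonconstant c)
        from-factors (inj₁ c) = coeff q 0 , (λ q₀≈0 → Irreducible.nonConstant irr λ n →
            vanishing-coeff closed g (λ x → trans (g≈q₀m x) (trans (*-congʳ q₀≈0) (zeroˡ _))) (suc n)) , g≈q₀m
          where
          g≈q₀m : ∀ x → eval g x ≈ coeff q 0 * monic lower x
          g≈q₀m x = trans (g≈qm x) (*-congʳ (constant-eval closed q c x))

    Separable : Poly → Set ℓ
    Separable f = ∀ r g → ¬ (∀ x → eval f x ≈ (x + - r) * ((x + - r) * eval g x))

    eval-double : ∀ r g x → eval ((X- r) *ₚ ((X- r) *ₚ g)) x ≈ (x + - r) * ((x + - r) * eval g x)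
    eval-double r g x = trans (eval-*ₚ (X- r) ((X- r) *ₚ g) x)
        (*-cong (eval-X- r x) (trans (eval-*ₚ (X- r) g x) (*-congʳ (eval-X- r x))))

    separable⇒noMultipleRoot : ∀ f → Separable f → NoMultipleRoot f
    separable⇒noMultipleRoot f s r g e = s r g λ x → trans (eval-≈ₚ f ((X- r) *ₚ ((X- r) *ₚ g)) x e)
        (eval-double r g x)

    noMultipleRoot⇒separable : ∀ f → NoMultipleRoot f → Separable f
    noMultipleRoot⇒separable f s r g e = s r g (extensionality closed f ((X- r) *ₚ ((X- r) *ₚ g)) λ x → trans (e x)
        (sym (eval-double r g x)))

    separable-factor : ∀ f q g → (∀ x → eval f x ≈ eval q x * eval g x) → Separable f → Separable g
    separable-factor f q g f≈qg s r h g≈ = s r (q *ₚ h) λ x → begin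
      eval f x                                       ≈⟨ f≈qg x ⟩
      eval q x * eval g x                            ≈⟨ *-congˡ (g≈ x) ⟩
      eval q x * ((x + - r) * ((x + - r) * eval h x))
        ≈⟨ solve 3 (λ q d h → q :* (d :* (d :* h)) := d :* (d :* (q :* h))) refl (eval q x) (x + - r) (eval h x) ⟩
      (x + - r) * ((x + - r) * (eval q x * eval h x)) ≈⟨ *-congˡ (*-congˡ (eval-*ₚ q h x)) ⟨
      (x + - r) * ((x + - r) * eval (q *ₚ h) x)      ∎

    linearPoly : List Carrier → Carrier → Poly
    linearPoly rs c = foldr (λ r g → (X- r) *ₚ g) (c ∷ []) rs

    eval-linearPoly : ∀ rs c x → eval (linearPoly rs c) x ≈ linears rs x * c
    eval-linearPoly []       c x = trans (eval-constant c x) (sym (*-identityˡ c))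
    eval-linearPoly (r ∷ rs) c x = trans (eval-*ₚ (X- r) (linearPoly rs c) x)
        (trans (*-cong (eval-X- r x) (eval-linearPoly rs c x)) (sym (*-assoc _ _ _)))

    any-∈ : ∀ E {rs r} → All (_∈ E) rs → Any (r ≈_) rs → r ∈ E
    any-∈ E (r∈ ∷ _)  (here e)  = respects E (sym e) r∈
    any-∈ E (_ ∷ rs∈) (there i) = any-∈ E rs∈ i

    tabulate-any : ∀ {P : Pred Carrier ℓ} rs → (∀ {x} → Any (x ≈_) rs → P x) → All P rs
    tabulate-any []       f = []
    tabulate-any (r ∷ rs) f = f (here refl) ∷ tabulate-any rs (λ i → f (there i))

    splits⇒roots∈ : ∀ E f → SplitsOver E f → ¬ Vanishing f → ∀ {r} → Root f r → r ∈ E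
    splits⇒roots∈ E f (c , rs , c∈ , rs∈ , f≈) f≢0 {r} e =
      any-∈ E rs∈ (root-linears rs (integral (trans (*-comm c _) (trans (sym (factors r)) e)) c≉0))
      where
      factors : ∀ x → eval f x ≈ linears rs x * c
      factors x = trans (eval-≈ₚ f (linearPoly rs c) x f≈) (eval-linearPoly rs c x)
      c≉0 : ¬ c ≈ 0#
      c≉0 c≈0 = f≢0 λ x → trans (factors x) (trans (*-congˡ c≈0) (zeroʳ _))

    roots∈⇒splits : ∀ E n f → length f ≡ n → f over E → (∀ {r} → Root f r → r ∈ E) → SplitsOver E f
    roots∈⇒splits E n [] l f∈ roots∈ = 0# , [] , 0-closed E , [] , λ { zero → refl ; (suc n) → refl }
    roots∈⇒splits E (suc n) (a ∷ f) l (a∈ ∷ f∈) roots∈ with dec (Constant (a ∷ f))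
    ... | yes c = a , [] , a∈ , [] , λ { zero → refl ; (suc n) → c n }
    ... | no ¬c with closed (a ∷ f) ¬c
    ... | r , e with roots∈⇒splits E n (quotient 0# r f) (≡.trans (quotient-length 0# r f) (ℕ.suc-injective l))
                       (quotient-over E (0-closed E) (roots∈ e) f∈)
                       (λ {s} es → roots∈ (trans (root-quotient 0# r a f e s) (trans (*-congˡ es) (zeroʳ _))))
    ... | c , rs , c∈ , rs∈ , q≈ = c , r ∷ rs , c∈ , roots∈ e ∷ rs∈ , extensionality closed (a ∷ f)
        (linearPoly (r ∷ rs) c) λ x →
          trans (root-quotient 0# r a f e x) (trans (*-cong (sym (eval-X- r x))
              (eval-≈ₚ (quotient 0# r f) (linearPoly rs c) x q≈)) (sym (eval-*ₚ (X- r) (linearPoly rs c) x)))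

    minimalPolynomial-nonvanishing : ∀ {F z} (m : MinimalPolynomial F z) → ¬ Vanishing (MinimalPolynomial.poly m)
    minimalPolynomial-nonvanishing m v = MinimalPolynomial.poly-nonconstant m λ n → vanishing-coeff closed
        (MinimalPolynomial.poly m) v (suc n)

    -- z is separable over A and all its conjugates over A lie in E.
    record Galoisian (A E : Subfield) (z : Carrier) : Set ℓ where
      field
        poly      : Poly
        poly∈     : poly over A
        root      : Root poly z
        separable : Separable poly
        roots∈    : ∀ {r} → Root poly r → r ∈ E

    -- The reason why `Galoisian` does not insist on the minimal polynomial: the same separable
    -- polynomial serves over every larger base, where the minimal polynomial may change.
    galoisian-mono : ∀ A A′ E E′ {z} → A ⊆ A′ → E ⊆ E′ → Galoisian A E z → Galoisian A′ E′ z
    galoisian-mono A A′ E E′ A⊆A′ E⊆E′ g = record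
      { poly = poly ; poly∈ = over-⊆ A A′ A⊆A′ poly∈ ; root = root ; separable = separable ; roots∈ = λ e → E⊆E′
          (roots∈ e) }
      where open Galoisian g

    galoisian-minimalPolynomial : ∀ {A E z} → Galoisian A E z → (m : MinimalPolynomial A z) → Separable
        (MinimalPolynomial.poly m)
    galoisian-minimalPolynomial g m with divides m (Galoisian.poly g) (Galoisian.poly∈ g) (Galoisian.root g)
    ... | q , _ , e = separable-factor (Galoisian.poly g) q (MinimalPolynomial.poly m)
        (λ x → trans (e x) (*-congˡ (sym (MinimalPolynomial.eval-poly m x)))) (Galoisian.separable g)

    normal-roots∈ : ∀ A E {z} → IsNormal A E → (m : MinimalPolynomial A z) → z ∈ E → ∀ {r} → monic
        (MinimalPolynomial.lower m) r ≈ 0# → r ∈ E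
    normal-roots∈ A E normal m z∈ e =
      splits⇒roots∈ E poly (IsNormal.splits normal poly (minimalPolynomial-irreducible m)
          (_ , z∈ , trans (eval-poly _) root))
        (minimalPolynomial-nonvanishing m) (trans (eval-poly _) e)
      where open MinimalPolynomial m

    galois⇒galoisian : ∀ A E → K ⊆ A → IsGalois A E → ∀ {z} → z ∈ E → Galoisian A E z
    galois⇒galoisian A E K⊆A galois {z} z∈ = record
      { poly = poly ; poly∈ = poly∈ ; root = z-root
      ; separable = noMultipleRoot⇒separable poly (IsSeparable.separable (IsGalois.separable galois) z∈ poly
          (minimalPolynomial-irreducible m) z-root)
      ; roots∈ = λ e → normal-roots∈ A E (IsGalois.normal galois) m z∈ (trans (sym (eval-poly _)) e) }
      where
      m = minimalPolynomial A K⊆A z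
      open MinimalPolynomial m
      z-root = trans (eval-poly z) root

    -- An irreducible polynomial with root `x` is a constant multiple of the minimal polynomial of
    -- `x`, which divides the polynomial witnessing `Galoisian A E x`. Membership of the roots in
    -- `E` and the absence of multiple roots are inherited from that witness.
    galoisian⇒galois : ∀ A E → K ⊆ A → IsFinite A E → (∀ {z} → z ∈ E → Galoisian A E z) → IsGalois A E
    galoisian⇒galois A E K⊆A finite good = record
      { finite = finite
      ; normal = record
        { base⊆ = base⊆ ; algebraic = λ {x} _ → algebraic-over A K⊆A x
        ; splits = λ f irr (x , x∈ , e) → roots∈⇒splits E _ f ≡.refl (over-⊆ A E base⊆ (Irreducible.coefficients irr))
            (λ er → Galoisian.roots∈ (good x∈) (conjugate x∈ f irr e er)) }
      ; separable = record
        { base⊆ = base⊆ ; algebraic = λ {x} _ → algebraic-over A K⊆A x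
        ; separable = λ x∈ f irr e → separable⇒noMultipleRoot f (separable x∈ f irr e) } }
      where
      open IsFinite finite using (base⊆)
      module _ {x} (x∈ : x ∈ E) f (irr : Irreducible A f) (e : Root f x) where
        m = minimalPolynomial A K⊆A x
        open MinimalPolynomial m
        module G = Galoisian (good x∈)
        associate : ∃[ c ] ¬ c ≈ 0# × (∀ x → eval f x ≈ c * monic lower x)
        associate = irreducible-associate m f irr e
        factor : ∃[ q ] q over A × (∀ y → eval G.poly y ≈ eval q y * monic lower y)
        factor = divides m G.poly G.poly∈ G.root
        conjugate : ∀ {r} → Root f r → Root G.poly r
        conjugate er = let c , c≉0 , f≈cm = associate ; q , _ , g≈qm = factor in
          trans (g≈qm _) (trans (*-congˡ (integral (trans (sym (f≈cm _)) er) c≉0)) (zeroʳ _))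
        separable : Separable f
        separable r g f≈ = galoisian-minimalPolynomial (good x∈) m r (scale c⁻¹ g) λ y → begin
          eval poly y                                   ≈⟨ eval-poly y ⟩
          monic lower y                                 ≈⟨ *-identityˡ _ ⟨
          1# * monic lower y                            ≈⟨ *-congʳ cc⁻¹≈1 ⟨
          c * c⁻¹ * monic lower y
            ≈⟨ solve 3 (λ c d m → c :* d :* m := d :* (c :* m)) refl c c⁻¹ (monic lower y) ⟩
          c⁻¹ * (c * monic lower y)                     ≈⟨ *-congˡ (trans (sym (f≈cm y)) (f≈ y)) ⟩
          c⁻¹ * ((y + - r) * ((y + - r) * eval g y))
            ≈⟨ solve 3 (λ c d g → c :* (d :* (d :* g)) := d :* (d :* (c :* g))) refl c⁻¹ (y + - r) (eval g y) ⟩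
          (y + - r) * ((y + - r) * (c⁻¹ * eval g y))    ≈⟨ *-congˡ (*-congˡ (eval-scale c⁻¹ g y)) ⟨
          (y + - r) * ((y + - r) * eval (scale c⁻¹ g) y) ∎
          where
          c = proj₁ associate
          f≈cm = proj₂ (proj₂ associate)
          c⁻¹ = proj₁ (inverse (proj₁ (proj₂ associate)))
          cc⁻¹≈1 = proj₂ (inverse (proj₁ (proj₂ associate)))

    -- Simple extensions and homomorphisms

    -- Negatives and inverses are left out: a subring containing `K` has them, everything being
    -- algebraic over `K`. This keeps inductions over `adjoin` and the field structure of spans
    -- short.
    record IsSubring (R : Pred Carrier ℓ) : Set ℓ where
      field
        ∈-resp : ∀ {x y} → x ≈ y → R x → R y
        +-∈    : ∀ {x y} → R x → R y → R (x + y)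
        *-∈    : ∀ {x y} → R x → R y → R (x * y)

    subfield-isSubring : ∀ F → IsSubring (Member F)
    subfield-isSubring F = record { ∈-resp = respects F ; +-∈ = +-closed F ; *-∈ = *-closed F }

    module _ {R : Pred Carrier ℓ} (isSubring : IsSubring R) where
      open IsSubring isSubring

      eval-∈ : ∀ {f x} → R 0# → All R f → R x → R (eval f x)
      eval-∈ 0∈ []         x∈ = 0∈
      eval-∈ 0∈ (a∈ ∷ f∈) x∈ = +-∈ a∈ (*-∈ x∈ (eval-∈ 0∈ f∈ x∈))

      module _ (K⊆R : ∀ {x} → x ∈ K → R x) where

        neg-∈ : ∀ {x} → R x → R (- x)
        neg-∈ {x} x∈ = ∈-resp (trans (sym (-‿distribˡ-* 1# x)) (-‿cong (*-identityˡ x))) (*-∈ (K⊆R (-1-closed K)) x∈)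

        -- Multiplying an algebraic equation for x⁻¹ by a power of x expresses x⁻¹ as a polynomial in x.
        inverse-∈ : ∀ {x y} → x * y ≈ 1# → R x → R y
        inverse-∈ {x} {y} xy≈1 x∈ = ∈-resp (sym y≈-u) (neg-∈ u∈)
          where
          clear : ∀ {t} → t over K → ∃[ p ] ∃[ u ] R p × R u × monic t y * p ≈ 1# + x * u
          clear []         = 1# , 0# , K⊆R (1-closed K) , K⊆R (0-closed K) ,
            trans (*-identityˡ _) (trans (sym (+-identityʳ _)) (+-congˡ (sym (zeroʳ x))))
          clear (_∷_ {a} {t} a∈ t∈) with clear t∈
          ... | p , u , p∈ , u∈ , e = p * x , a * p + u , *-∈ p∈ x∈ , +-∈ (*-∈ (K⊆R a∈) p∈) u∈ , (begin
            (a + y * monic t y) * (p * x)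
              ≈⟨ solve 5 (λ a y m p x → (a :+ y :* m) :* (p :* x) := a :* p :* x :+ (m :* p) :* (x :* y)) refl a y
              (monic t y) p x ⟩
            a * p * x + (monic t y * p) * (x * y)  ≈⟨ +-congˡ (trans (*-cong e xy≈1) (*-identityʳ _)) ⟩
            a * p * x + (1# + x * u)
              ≈⟨ solve 5 (λ a p x o u → a :* p :* x :+ (o :+ x :* u) := o :+ x :* (a :* p :+ u)) refl a p x 1# u ⟩
            1# + x * (a * p + u)                   ∎)
          m = minimalPolynomial K (λ x∈ → x∈) y
          open MinimalPolynomial m
          u = proj₁ (proj₂ (clear lower∈))
          u∈ = proj₁ (proj₂ (proj₂ (proj₂ (clear lower∈))))
          y≈-u : y ≈ - u
          y≈-u = -≈0⇒≈ (begin
            y + - - u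
              ≈⟨ +-cong (sym (*-identityʳ y)) (trans (-‿involutive u)
              (trans (sym (*-identityˡ u)) (*-congʳ (sym xy≈1)))) ⟩
            y * 1# + x * y * u    ≈⟨ solve 4 (λ x y o u → y :* o :+ x :* y :* u := y :* (o :+ x :* u)) refl x y 1# u ⟩
            y * (1# + x * u)
              ≈⟨ *-congˡ (trans (sym (proj₂ (proj₂ (proj₂ (proj₂ (clear lower∈)))))) (trans (*-congʳ root) (zeroˡ _)))
              ⟩
            y * 0#                ≈⟨ zeroʳ y ⟩
            0#                    ∎)

        subringField : Subfield
        subringField = record
          { Member = R ; respects = ∈-resp ; 0-closed = K⊆R (0-closed K) ; 1-closed = K⊆R (1-closed K)
          ; +-closed = +-∈ ; *-closed = *-∈ ; neg-closed = neg-∈ ; inv-closed = inverse-∈ }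

    module _ (F : Subfield) (K⊆F : K ⊆ F) (z : Carrier) where

      -- The ring F[z], which is already the field F(z) because `z` is algebraic.
      Adjoined : Pred Carrier ℓ
      Adjoined y = ∃[ g ] g over F × y ≈ eval g z

      adjoined-base : ∀ {x} → x ∈ F → Adjoined x
      adjoined-base {x} x∈ = x ∷ [] , x∈ ∷ [] , sym (eval-constant x z)

      abstract
        adjoin : Subfield
        adjoin = subringField {R = Adjoined} (record
          { ∈-resp = λ e (g , g∈ , e′) → g , g∈ , trans (sym e) e′
          ; +-∈ = λ (g , g∈ , e) (h , h∈ , e′) → g +ₚ h , +ₚ-over F g∈ h∈ , trans (+-cong e e′) (sym (eval-+ₚ g h z))
          ; *-∈ = λ (g , g∈ , e) (h , h∈ , e′) → g *ₚ h , *ₚ-over F g∈ h∈ , trans (*-cong e e′) (sym (eval-*ₚ g h z))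
              })
          (λ x∈ → adjoined-base (K⊆F x∈))

        adjoined : ∀ {y} → y ∈ adjoin → Adjoined y
        adjoined y∈ = y∈

        adjoined⁻¹ : ∀ {y} → Adjoined y → y ∈ adjoin
        adjoined⁻¹ y∈ = y∈

      base⊆adjoin : F ⊆ adjoin
      base⊆adjoin x∈ = adjoined⁻¹ (adjoined-base x∈)

      eval-X : ∀ x → eval (0# ∷ 1# ∷ []) x ≈ x
      eval-X x = trans (+-identityˡ _) (trans (*-congˡ (eval-constant 1# x)) (*-identityʳ x))

      generator∈ : z ∈ adjoin
      generator∈ = adjoined⁻¹ (0# ∷ 1# ∷ [] , 0-closed F ∷ 1-closed F ∷ [] , sym (eval-X z))

      K⊆adjoin : K ⊆ adjoin
      K⊆adjoin x∈ = base⊆adjoin (K⊆F x∈)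

      adjoin-least : ∀ {R} → IsSubring R → (∀ {x} → x ∈ F → R x) → R z → ∀ {x} → x ∈ adjoin → R x
      adjoin-least isSubring F⊆R z∈ x∈ = let g , g∈ , e = adjoined x∈ in
        IsSubring.∈-resp isSubring (sym e) (eval-∈ isSubring (F⊆R (0-closed F)) (All.map F⊆R g∈) z∈)

    adjoinList : (F : Subfield) → K ⊆ F → List Carrier → Subfield
    adjoinList F K⊆F []       = F
    adjoinList F K⊆F (z ∷ zs) = adjoinList (adjoin F K⊆F z) (K⊆adjoin F K⊆F z) zs

    base⊆adjoinList : ∀ F (K⊆F : K ⊆ F) zs → F ⊆ adjoinList F K⊆F zs
    base⊆adjoinList F K⊆F []       x∈ = x∈
    base⊆adjoinList F K⊆F (z ∷ zs) x∈ = base⊆adjoinList (adjoin F K⊆F z) (K⊆adjoin F K⊆F z) zs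
        (base⊆adjoin F K⊆F z x∈)

    generators∈ : ∀ F (K⊆F : K ⊆ F) zs → All (_∈ adjoinList F K⊆F zs) zs
    generators∈ F K⊆F []       = []
    generators∈ F K⊆F (z ∷ zs) = base⊆adjoinList (adjoin F K⊆F z) (K⊆adjoin F K⊆F z) zs (generator∈ F K⊆F z) ∷
        generators∈ (adjoin F K⊆F z) (K⊆adjoin F K⊆F z) zs

    adjoinList-least : ∀ F (K⊆F : K ⊆ F) zs {R} → IsSubring R → (∀ {x} → x ∈ F → R x) → All R zs → ∀ {x} → x ∈
        adjoinList F K⊆F zs → R x
    adjoinList-least F K⊆F []       isSubring F⊆R []          = F⊆R
    adjoinList-least F K⊆F (z ∷ zs) isSubring F⊆R (z∈ ∷ zs∈) =
      adjoinList-least (adjoin F K⊆F z) (K⊆adjoin F K⊆F z) zs isSubring (adjoin-least F K⊆F z isSubring F⊆R z∈) zs∈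

    -- σ restricts to a ring homomorphism F → K̄ over A; its values outside F are junk.
    record Hom (A F : Subfield) (σ : Carrier → Carrier) : Set ℓ where
      field
        fixes  : ∀ {x} → x ∈ A → σ x ≈ x
        cong   : ∀ {x y} → x ∈ F → x ≈ y → σ x ≈ σ y
        +-homo : ∀ {x y} → x ∈ F → y ∈ F → σ (x + y) ≈ σ x + σ y
        *-homo : ∀ {x y} → x ∈ F → y ∈ F → σ (x * y) ≈ σ x * σ y

    hom-restrict : ∀ A A′ F F′ {σ} → A ⊆ A′ → F ⊆ F′ → Hom A′ F′ σ → Hom A F σ
    hom-restrict A A′ F F′ A⊆A′ F⊆F′ hom = record
      { fixes = λ x∈ → fixes (A⊆A′ x∈) ; cong = λ x∈ → cong (F⊆F′ x∈)
      ; +-homo = λ x∈ y∈ → +-homo (F⊆F′ x∈) (F⊆F′ y∈) ; *-homo = λ x∈ y∈ → *-homo (F⊆F′ x∈) (F⊆F′ y∈) }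
      where open Hom hom

    hom-id : ∀ A F → Hom A F (λ x → x)
    hom-id A F = record { fixes = λ _ → refl ; cong = λ _ e → e ; +-homo = λ _ _ → refl ; *-homo = λ _ _ → refl }

    module _ {A F : Subfield} {σ : Carrier → Carrier} (hom : Hom A F σ) where
      open Hom hom

      0-homo : σ 0# ≈ 0#
      0-homo = fixes (0-closed A)

      1-homo : σ 1# ≈ 1#
      1-homo = fixes (1-closed A)

      neg-homo : ∀ {x} → x ∈ F → σ (- x) ≈ - σ x
      neg-homo {x} x∈ = begin
        σ (- x)        ≈⟨ cong (neg-closed F x∈) (trans (-‿cong (sym (*-identityˡ x))) (-‿distribˡ-* 1# x)) ⟩
        σ (- 1# * x)   ≈⟨ *-homo (-1-closed F) x∈ ⟩
        σ (- 1#) * σ x ≈⟨ *-congʳ (fixes (-1-closed A)) ⟩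
        - 1# * σ x     ≈⟨ trans (sym (-‿distribˡ-* 1# (σ x))) (-‿cong (*-identityˡ _)) ⟩
        - σ x          ∎

      hom-nonzero : ∀ {x} → x ∈ F → σ x ≈ 0# → x ≈ 0#
      hom-nonzero {x} x∈ σx≈0 = by-contradiction λ x≉0 →
        let y , xy≈1 = inverse x≉0
            y∈ = inv-closed F xy≈1 x∈
        in 1≉0 (trans (sym 1-homo) (trans (sym (cong (*-closed F x∈ y∈) xy≈1)) (trans (*-homo x∈ y∈) (trans (*-congʳ σx≈0) (zeroˡ _)))))

      hom-injective : ∀ {x y} → x ∈ F → y ∈ F → σ x ≈ σ y → x ≈ y
      hom-injective x∈ y∈ e = -≈0⇒≈ (hom-nonzero (+-closed F x∈ (neg-closed F y∈))
        (trans (+-homo x∈ (neg-closed F y∈)) (trans (+-congˡ (neg-homo y∈)) (≈⇒-≈0 e))))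

      map-eval : ∀ {f x} → f over F → x ∈ F → σ (eval f x) ≈ eval (map σ f) (σ x)
      map-eval []         x∈ = 0-homo
      map-eval (a∈ ∷ f∈) x∈ = trans (+-homo a∈ (*-closed F x∈ fx∈))
          (+-congˡ (trans (*-homo x∈ fx∈) (*-congˡ (map-eval f∈ x∈))))
        where fx∈ = horner-closed F (0-closed F) f∈ x∈

      map-fixed : ∀ {f} → f over A → ∀ x → eval (map σ f) x ≈ eval f x
      map-fixed []         x = refl
      map-fixed (a∈ ∷ f∈) x = +-cong (fixes a∈) (*-congˡ (map-fixed f∈ x))

      map-scale : ∀ {c f} → c ∈ F → f over F → ∀ x → eval (map σ (scale c f)) x ≈ σ c * eval (map σ f) x
      map-scale c∈ []         x = sym (zeroʳ _)
      map-scale {c} {a ∷ f} c∈ (a∈ ∷ f∈) x = trans (+-cong (*-homo c∈ a∈) (*-congˡ (map-scale c∈ f∈ x)))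
        (solve 4 (λ c a x y → c :* a :+ x :* (c :* y) := c :* (a :+ x :* y)) refl (σ c) (σ a) x _)

      map-+ₚ : ∀ {f g} → f over F → g over F → ∀ x → eval (map σ (f +ₚ g)) x ≈ eval (map σ f) x + eval (map σ g) x
      map-+ₚ []         g∈         x = sym (+-identityˡ _)
      map-+ₚ (a∈ ∷ f∈) []         x = sym (+-identityʳ _)
      map-+ₚ {a ∷ f} {b ∷ g} (a∈ ∷ f∈) (b∈ ∷ g∈) x = trans (+-cong (+-homo a∈ b∈) (*-congˡ (map-+ₚ f∈ g∈ x)))
        (solve 5 (λ a b x y z → (a :+ b) :+ x :* (y :+ z) := (a :+ x :* y) :+ (b :+ x :* z)) refl (σ a) (σ b) x _ _)

      map-*ₚ : ∀ {f g} → f over F → g over F → ∀ x → eval (map σ (f *ₚ g)) x ≈ eval (map σ f) x * eval (map σ g) x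
      map-*ₚ []         g∈ x = sym (zeroˡ _)
      map-*ₚ {a ∷ f} {g} (a∈ ∷ f∈) g∈ x = begin
        eval (map σ (scale a g +ₚ (0# ∷ f *ₚ g))) x
          ≈⟨ map-+ₚ (scale-over F a∈ g∈) (0-closed F ∷ *ₚ-over F f∈ g∈) x ⟩
        eval (map σ (scale a g)) x + (σ 0# + x * eval (map σ (f *ₚ g)) x)
          ≈⟨ +-cong (map-scale a∈ g∈ x) (trans (+-cong 0-homo (*-congˡ (map-*ₚ f∈ g∈ x))) (+-identityˡ _)) ⟩
        σ a * eval (map σ g) x + x * (eval (map σ f) x * eval (map σ g) x)
          ≈⟨ solve 4 (λ a x y z → a :* z :+ x :* (y :* z) := (a :+ x :* y) :* z) refl (σ a) x _ _ ⟩
        (σ a + x * eval (map σ f) x) * eval (map σ g) x ∎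

      coeff-map : ∀ f n → coeff (map σ f) n ≈ σ (coeff f n)
      coeff-map []      n       = sym 0-homo
      coeff-map (a ∷ f) zero    = refl
      coeff-map (a ∷ f) (suc n) = coeff-map f n

      coeff-∈ : ∀ {f} → f over F → ∀ n → coeff f n ∈ F
      coeff-∈ []         n       = 0-closed F
      coeff-∈ (a∈ ∷ f∈) zero    = a∈
      coeff-∈ (a∈ ∷ f∈) (suc n) = coeff-∈ f∈ n

      -- A polynomial identity over F holds coefficientwise, hence survives σ.
      transport : ∀ f g → f over F → (∀ x → eval f x ≈ eval g x) → ∀ x → eval (map σ f) x ≈ eval (map σ g) x
      transport f g f∈ e x = eval-≈ₚ (map σ f) (map σ g) x λ n →
        trans (coeff-map f n) (trans (cong (coeff-∈ f∈ n) (extensionality closed f g e n)) (sym (coeff-map g n)))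

      hom-root : ∀ {f z} → A ⊆ F → f over A → z ∈ F → Root f z → Root f (σ z)
      hom-root {f} {z} A⊆F f∈ z∈ e = trans (sym (map-fixed f∈ (σ z))) (trans (sym (map-eval (over-⊆ A F A⊆F f∈) z∈))
        (trans (cong (horner-closed F (0-closed F) (over-⊆ A F A⊆F f∈) z∈) e) 0-homo))

      module _ (A⊆F : A ⊆ F) (K⊆F : K ⊆ F) (z z′ : Carrier)
               (compatible : ∀ g → g over F → eval g z ≈ 0# → eval (map σ g) z′ ≈ 0#) where

        -- The map g(z) ↦ (σ g)(z′). A homomorphism is represented by a function on all of `K̄`, so
        -- membership in F(z) is decided and 0 is the value elsewhere.
        extend-by : ∀ {y} → Dec (Adjoined F K⊆F z y) → Carrier
        extend-by (yes (g , _)) = eval (map σ g) z′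
        extend-by (no _)        = 0#

        extension : Carrier → Carrier
        extension y = extend-by (dec (Adjoined F K⊆F z y))

        -- Well-definedness: two polynomials representing `y` differ by one that annihilates `z`,
        -- and `compatible` makes the difference of their images vanish at `z′`.
        extension-eval : ∀ {y} g → g over F → y ≈ eval g z → extension y ≈ eval (map σ g) z′
        extension-eval {y} g g∈ e = value (dec (Adjoined F K⊆F z y))
          where
          difference : ∀ h → h over F → eval (map σ (h +ₚ (-ₚ g))) z′ ≈ eval (map σ h) z′ + - eval (map σ g) z′
          difference h h∈ = trans (map-+ₚ h∈ (-ₚ-over F g∈) z′) (+-congˡ (trans (map-scale (-1-closed F) g∈ z′)
            (trans (*-congʳ (fixes (-1-closed A))) (trans (sym (-‿distribˡ-* 1# _)) (-‿cong (*-identityˡ _))))))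
          value : (d : Dec (Adjoined F K⊆F z y)) → extend-by d ≈ eval (map σ g) z′
          value (no none)            = ⊥-elim (none (g , g∈ , e))
          value (yes (h , h∈ , e′)) = -≈0⇒≈ (trans (sym (difference h h∈))
              (compatible (h +ₚ (-ₚ g)) (+ₚ-over F h∈ (-ₚ-over F g∈))
            (trans (eval-+ₚ h (-ₚ g) z) (trans (+-congˡ (eval--ₚ g z)) (≈⇒-≈0 (trans (sym e′) e))))))

        extension-extends : ∀ {y} → y ∈ F → extension y ≈ σ y
        extension-extends {y} y∈ = trans (extension-eval (y ∷ []) (y∈ ∷ []) (sym (eval-constant y z)))
            (eval-constant (σ y) z′)

        extension-generator : extension z ≈ z′
        extension-generator = trans (extension-eval (0# ∷ 1# ∷ []) (0-closed F ∷ 1-closed F ∷ [])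
            (sym (eval-X F K⊆F z z)))
          (trans (+-cong 0-homo (*-congˡ (trans (+-cong 1-homo (zeroʳ _)) (+-identityʳ _))))
              (trans (+-identityˡ _) (*-identityʳ z′)))

        extension-hom : Hom A (adjoin F K⊆F z) extension
        extension-hom = record
          { fixes = λ x∈ → trans (extension-extends (A⊆F x∈)) (fixes x∈)
          ; cong = λ x∈ x≈y → let g , g∈ , e = adjoined F K⊆F z x∈ in
              trans (extension-eval g g∈ e) (sym (extension-eval g g∈ (trans (sym x≈y) e)))
          ; +-homo = λ x∈ y∈ → let g , g∈ , e = adjoined F K⊆F z x∈ ; h , h∈ , e′ = adjoined F K⊆F z y∈ in trans
              (extension-eval (g +ₚ h) (+ₚ-over F g∈ h∈) (trans (+-cong e e′) (sym (eval-+ₚ g h z))))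
              (trans (map-+ₚ g∈ h∈ z′) (+-cong (sym (extension-eval g g∈ e)) (sym (extension-eval h h∈ e′))))
          ; *-homo = λ x∈ y∈ → let g , g∈ , e = adjoined F K⊆F z x∈ ; h , h∈ , e′ = adjoined F K⊆F z y∈ in trans
              (extension-eval (g *ₚ h) (*ₚ-over F g∈ h∈) (trans (*-cong e e′) (sym (eval-*ₚ g h z))))
              (trans (map-*ₚ g∈ h∈ z′) (*-cong (sym (extension-eval g g∈ e)) (sym (extension-eval h h∈ e′)))) }

      -- `z′` is a root of the image under σ of the minimal polynomial of `z` over `F`. That image
      -- is nonconstant since σ is injective, and `transport` carries divisibility by the minimal
      -- polynomial over to it.
      image-of-generator : K ⊆ F → ∀ z → ∃[ z′ ] (∀ g → g over F → eval g z ≈ 0# → eval (map σ g) z′ ≈ 0#)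
      image-of-generator K⊆F z = z′ , λ g g∈ e →
          let q , q∈ , g≈qm = divides m g g∈ e in
          trans (transport g (q *ₚ poly) g∈ (λ x → trans (g≈qm x)
              (trans (*-congˡ (sym (eval-poly x))) (sym (eval-*ₚ q poly x)))) z′)
                (trans (map-*ₚ q∈ poly∈ z′) (trans (*-congˡ (proj₂ σm-root)) (zeroʳ _)))
        where
        m = minimalPolynomial F K⊆F z
        open MinimalPolynomial m
        σm-root = closed (map σ poly) λ c → poly-nonconstant λ n →
          hom-nonzero (coeff-∈ poly∈ (suc n)) (trans (sym (coeff-map poly (suc n))) (c n))
        z′ = proj₁ σm-root

    -- Extending homomorphisms along finitely many generators

    Extension : (A F F′ : Subfield) → (Carrier → Carrier) → Set ℓ
    Extension A F F′ σ = ∃[ τ ] Hom A F′ τ × (∀ {x} → x ∈ F → τ x ≈ σ x)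

    extend₁ : ∀ A F (K⊆F : K ⊆ F) → A ⊆ F → ∀ {σ} → Hom A F σ → ∀ z → Extension A F (adjoin F K⊆F z) σ
    extend₁ A F K⊆F A⊆F {σ} hom z = from-image (image-of-generator hom K⊆F z)
      where
      from-image : ∃[ z′ ] (∀ g → g over F → eval g z ≈ 0# → eval (map σ g) z′ ≈ 0#) → Extension A F (adjoin F K⊆F z)
          σ
      from-image (z′ , compatible) = extension hom A⊆F K⊆F z z′ compatible , extension-hom hom A⊆F K⊆F z z′ compatible
          ,
                                     extension-extends hom A⊆F K⊆F z z′ compatible

    extension-trans : ∀ A F F′ F″ {σ} → F ⊆ F′ → (∀ {σ′} → Hom A F′ σ′ → Extension A F′ F″ σ′) → Extension A F F′ σ →
        Extension A F F″ σ
    extension-trans A F F′ F″ F⊆F′ next (σ′ , hom′ , agrees′) =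
      let τ , τ-hom , agrees = next hom′ in τ , τ-hom , λ x∈ → trans (agrees (F⊆F′ x∈)) (agrees′ x∈)

    extend : ∀ A F (K⊆F : K ⊆ F) → A ⊆ F → ∀ zs {σ} → Hom A F σ → Extension A F (adjoinList F K⊆F zs) σ
    extend A F K⊆F A⊆F []       {σ} hom = σ , hom , λ _ → refl
    extend A F K⊆F A⊆F (z ∷ zs) hom =
      extension-trans A F (adjoin F K⊆F z) (adjoinList F K⊆F (z ∷ zs)) (base⊆adjoin F K⊆F z)
        (extend A (adjoin F K⊆F z) (K⊆adjoin F K⊆F z) (λ x∈ → base⊆adjoin F K⊆F z (A⊆F x∈)) zs)
            (extend₁ A F K⊆F A⊆F hom z)

    -- Fixed elements and Galois extensions

    linear-factor : ∀ f r → Root f r → ∃[ q ] (∀ x → eval f x ≈ (x + - r) * eval q x)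
    linear-factor []      r e = [] , λ x → sym (zeroʳ _)
    linear-factor (a ∷ f) r e = quotient 0# r f , root-quotient 0# r a f e

    linears≈eval : ∀ zs x → linears zs x ≈ eval (linearPoly zs 1#) x
    linears≈eval zs x = sym (trans (eval-linearPoly zs 1# x) (*-identityʳ _))

    separable⇒distinct : ∀ zs f → (∀ x → eval f x ≈ linears zs x) → Separable f → Distinct zs
    separable⇒distinct []       f e s = []
    separable⇒distinct (z ∷ zs) f e s = All.¬Any⇒All¬ zs fresh ∷
        separable⇒distinct zs f′ (λ x → sym (linears≈eval zs x))
          (separable-factor f (X- z) f′ (λ x → trans (e x) (*-cong (sym (eval-X- z x)) (linears≈eval zs x))) s)
      where
      f′ = linearPoly zs 1#
      fresh : ¬ Any (z ≈_) zs
      fresh i = let q , h = linear-factor f′ z (trans (sym (linears≈eval zs z)) (linears-root zs i)) in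
        s z q λ x → trans (e x) (*-congˡ (trans (linears≈eval zs x) (h x)))

    cancel-linear-factor : ∀ s f g → (∀ x → (x + - s) * eval f x ≈ (x + - s) * eval g x) → ∀ x → eval f x ≈ eval g x
    cancel-linear-factor s f g e x = -≈0⇒≈ (trans (sym (difference x)) (cancel-linear closed s (f +ₚ (-ₚ g)) (λ y →
        trans (*-congˡ (difference y)) (trans (distribˡ _ _ _)
            (trans (+-congˡ (sym (-‿distribʳ-* _ _))) (≈⇒-≈0 (e y))))) x))
      where
      difference : ∀ y → eval (f +ₚ (-ₚ g)) y ≈ eval f y + - eval g y
      difference y = trans (eval-+ₚ f (-ₚ g) y) (+-congˡ (eval--ₚ g y))

    -- Induction on the factors. If the double root `r` equals the first root `s`, cancelling X - s
    -- leaves `r` as a root of the remaining factors, against distinctness. If not, `s` is a root of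
    -- `g` and X - s cancels from both sides.
    distinct⇒separable : ∀ zs → Distinct zs → ∀ r g → ¬ (∀ x → linears zs x ≈ (x + - r) * ((x + - r) * eval g x))
    distinct⇒separable []       []       r g e = 1≉0 (trans (e r) (trans (*-congʳ (-‿inverseʳ r)) (zeroˡ _)))
    distinct⇒separable (s ∷ zs) (d ∷ ds) r g e with dec (r ≈ s)
    ... | yes r≈s = let s≉s′ , r≈s′ = All.lookupAny d any in ⊥-elim (s≉s′ (trans (sym r≈s) r≈s′))
      where
      any : Any (r ≈_) zs
      any = root-linears zs (trans (linears≈eval zs r)
          (trans (cancel-linear-factor r (linearPoly zs 1#) ((X- r) *ₚ g) (λ x →
              trans (*-congˡ (sym (linears≈eval zs x))) (trans (*-congʳ (+-congˡ (-‿cong r≈s))) (trans (e x)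
                (*-congˡ (trans (*-congʳ (sym (eval-X- r x))) (sym (eval-*ₚ (X- r) g x))))))) r)
            (trans (eval-*ₚ (X- r) g r) (trans (*-congʳ (trans (eval-X- r r) (-‿inverseʳ r))) (zeroˡ _)))))
    ... | no r≉s = distinct⇒separable zs ds r h λ x → trans (linears≈eval zs x) (trans
            (cancel-linear-factor s (linearPoly zs 1#) ((X- r) *ₚ ((X- r) *ₚ h)) (λ y → begin
              (y + - s) * eval (linearPoly zs 1#) y                ≈⟨ *-congˡ (linears≈eval zs y) ⟨
              (y + - s) * linears zs y                             ≈⟨ e y ⟩
              (y + - r) * ((y + - r) * eval g y)                   ≈⟨ *-congˡ (*-congˡ (g≈ y)) ⟩
              (y + - r) * ((y + - r) * ((y + - s) * eval h y))
                ≈⟨ solve 3 (λ u v h → u :* (u :* (v :* h)) := v :* (u :* (u :* h))) refl (y + - r) (y + - s)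
                (eval h y) ⟩
              (y + - s) * ((y + - r) * ((y + - r) * eval h y))     ≈⟨ *-congˡ (eval-double r h y) ⟨
              (y + - s) * eval ((X- r) *ₚ ((X- r) *ₚ h)) y         ∎) x)
            (eval-double r h x))
      where
      s-r≉0 : ¬ s + - r ≈ 0#
      s-r≉0 s-r≈0 = r≉s (sym (-≈0⇒≈ s-r≈0))
      gs≈0 : eval g s ≈ 0#
      gs≈0 = integral (integral (trans (sym (e s)) (trans (*-congʳ (-‿inverseʳ s)) (zeroˡ _))) s-r≉0) s-r≉0
      h = proj₁ (linear-factor g s gs≈0)
      g≈ = proj₂ (linear-factor g s gs≈0)

    module _ (A E : Subfield) (y : Carrier) (fixed : ∀ {τ} → Hom A E τ → τ y ≈ y) where

      -- y = r(z) with deg r below the degree of z over F, and every conjugate of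
      -- z is a root of r − y; by separability these are too many roots.
      fixed-step : ∀ F (K⊆F : K ⊆ F) → A ⊆ F → ∀ z zs → E ⊆ adjoinList F K⊆F (z ∷ zs) → Galoisian F E z → y ∈ adjoin F
          K⊆F z → y ∈ F
      fixed-step F K⊆F A⊆F z zs E⊆ galoisian y∈ = reduced (reduce m g g∈)
        where
        m = minimalPolynomial F K⊆F z
        open MinimalPolynomial m
        distinct : Distinct roots
        distinct = separable⇒distinct roots poly (λ x → trans (eval-poly x) (factors x))
            (galoisian-minimalPolynomial galoisian m)
        g = proj₁ (adjoined F K⊆F z y∈)
        g∈ = proj₁ (proj₂ (adjoined F K⊆F z y∈))
        y≈gz = proj₂ (proj₂ (adjoined F K⊆F z y∈))
        module _ (r : Poly) (r∈ : r over F) (y≈rz : y ≈ eval r z) where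
          value-at-root : ∀ {z′} → Any (z′ ≈_) roots → eval r z′ ≈ y
          value-at-root {z′} i = conclude (extend A (adjoin F K⊆F z) (K⊆adjoin F K⊆F z)
              (λ x∈ → base⊆adjoin F K⊆F z (A⊆F x∈)) zs
                                            (extension-hom id-hom A⊆F K⊆F z z′ compatible))
            where
            id-hom : Hom A F (λ x → x)
            id-hom = hom-id A F
            compatible : ∀ g → g over F → eval g z ≈ 0# → eval (map (λ x → x) g) z′ ≈ 0#
            compatible g g∈ e = let q , _ , g≈qm = divides m g g∈ e in begin
              eval (map (λ x → x) g) z′  ≡⟨ ≡.cong (λ f → eval f z′) (map-id g) ⟩
              eval g z′                  ≈⟨ g≈qm z′ ⟩
              eval q z′ * monic lower z′ ≈⟨ *-congˡ (any⇒root i) ⟩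
              eval q z′ * 0#             ≈⟨ zeroʳ _ ⟩
              0#                         ∎
            conclude : Extension A (adjoin F K⊆F z) (adjoinList F K⊆F (z ∷ zs))
                (extension id-hom A⊆F K⊆F z z′ compatible) → eval r z′ ≈ y
            conclude (τ , τ-hom , agrees) = begin
              eval r z′                                    ≡⟨ ≡.cong (λ f → eval f z′) (map-id r) ⟨
              eval (map (λ x → x) r) z′
                ≈⟨ extension-eval id-hom A⊆F K⊆F z z′ compatible r r∈ y≈rz ⟨
              extension id-hom A⊆F K⊆F z z′ compatible y   ≈⟨ agrees y∈ ⟨
              τ y
                ≈⟨ fixed (hom-restrict A A E (adjoinList F K⊆F (z ∷ zs)) (λ x∈ → x∈) E⊆ τ-hom) ⟩
              y                                            ∎
        reduced : (∃[ q ] ∃[ r ] q over F × r over F × length r ≡ degree × eval g z ≈ eval r z ×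
            (∀ x → eval g x ≈ eval q x * monic lower x + eval r x)) → y ∈ F
        reduced (_ , []    , _ , _         , _ , e , _) = respects F (sym (trans y≈gz e)) (0-closed F)
        reduced (_ , a ∷ r , _ , (a∈ ∷ r∈) , l , e , _) = respects F (-≈0⇒≈ (vanishing-coeff closed w w≡0 0)) a∈
          where
          -- The polynomial r - y has as many entries as the minimal polynomial has roots, so it
          -- vanishes; its constant coefficient then gives y = a, which is in `F`.
          w : Poly
          w = a + - y ∷ r
          shift : ∀ x → eval w x ≈ eval (a ∷ r) x + - y
          shift x = solve 3 (λ a y t → a :- y :+ t := a :+ t :- y) refl a y (x * eval r x)
          zeros : All (Root w) roots
          zeros = tabulate-any roots λ {z′} i → trans (shift z′)
              (≈⇒-≈0 (value-at-root (a ∷ r) (a∈ ∷ r∈) (trans y≈gz e) i))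
          w≡0 : Vanishing w
          w≡0 = too-many-roots w roots (ℕ.≤-reflexive (≡.trans l (≡.sym roots-length))) distinct zeros

      -- The last generator is removed first. At each stage the conjugation is extended over the
      -- generators still above, giving a homomorphism of `E` over `A`; so invariance under those is
      -- the right hypothesis, however large `F` becomes.
      fixed⇒base : ∀ zs F (K⊆F : K ⊆ F) → A ⊆ F → E ⊆ adjoinList F K⊆F zs → All (Galoisian A E) zs → y ∈ adjoinList F
          K⊆F zs → y ∈ F
      fixed⇒base []       F K⊆F A⊆F E⊆ []       y∈ = y∈
      fixed⇒base (z ∷ zs) F K⊆F A⊆F E⊆ (g ∷ gs) y∈ = fixed-step F K⊆F A⊆F z zs E⊆
          (galoisian-mono A F E E A⊆F (λ x∈ → x∈) g)
        (fixed⇒base zs (adjoin F K⊆F z) (K⊆adjoin F K⊆F z) (λ x∈ → base⊆adjoin F K⊆F z (A⊆F x∈)) E⊆ gs y∈)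

    Endo : (A E : Subfield) → (Carrier → Carrier) → Set ℓ
    Endo A E τ = Hom A E τ × (∀ {x} → x ∈ E → τ x ∈ E)

    Fixed : (A E : Subfield) → Pred Carrier ℓ
    Fixed A E x = x ∈ E × (∀ {τ} → Endo A E τ → τ x ≈ x)

    module _ (A E : Subfield) (K⊆A : K ⊆ A) (A⊆E : A ⊆ E) where

      generated-stable : ∀ zs → E ⊆ adjoinList A K⊆A zs → All (_∈ E) zs → ∀ {τ} → Hom A E τ → All (λ z → τ z ∈ E) zs →
          ∀ {x} → x ∈ E → τ x ∈ E
      generated-stable zs E⊆ zs∈ {τ} hom τzs∈ x∈ = proj₂ (adjoinList-least A K⊆A zs {λ x → x ∈ E × τ x ∈ E}
        (record { ∈-resp = λ e (x∈ , τx∈) → respects E e x∈ , respects E (cong x∈ e) τx∈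
                ; +-∈ = λ (x∈ , τx∈) (y∈ , τy∈) → +-closed E x∈ y∈ , respects E (sym (+-homo x∈ y∈))
                    (+-closed E τx∈ τy∈)
                ; *-∈ = λ (x∈ , τx∈) (y∈ , τy∈) → *-closed E x∈ y∈ , respects E (sym (*-homo x∈ y∈))
                    (*-closed E τx∈ τy∈) })
        (λ a∈ → A⊆E a∈ , respects E (sym (fixes a∈)) (A⊆E a∈)) (All.zip (zs∈ , τzs∈)) (E⊆ x∈))
        where open Hom hom

      -- The conjugates of the generators lie in `E`, so every homomorphism from `E` to `K̄` over
      -- `A` maps `E` into itself. This turns invariance under endomorphisms into the invariance
      -- that `fixed⇒base` requires.
      generated-fixed : ∀ zs → E ⊆ adjoinList A K⊆A zs → All (_∈ E) zs → All (Galoisian A E) zs → ∀ {y} → Fixed A E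
          y → y ∈ A
      generated-fixed zs E⊆ zs∈ galoisian {y} (y∈ , fixed) =
        fixed⇒base A E y (λ hom → fixed (hom , generated-stable zs E⊆ zs∈ hom (images hom zs∈ galoisian))) zs A K⊆A
            (λ x∈ → x∈) E⊆ galoisian (E⊆ y∈)
        where
        images : ∀ {zs τ} → Hom A E τ → All (_∈ E) zs → All (Galoisian A E) zs → All (λ z → τ z ∈ E) zs
        images hom []         []       = []
        images hom (z∈ ∷ zs∈) (g ∷ gs) = Galoisian.roots∈ g
            (hom-root hom A⊆E (Galoisian.poly∈ g) z∈ (Galoisian.root g)) ∷ images hom zs∈ gs

      -- Lower coefficients of ∏ (X - s). If `t` lists those of a monic P of degree n, then X P has
      -- lower coefficients `0# ∷ t` and P itself is `t ∷ʳ 1#`, both of length n + 1, so `addScaled`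
      -- applies.
      monicFromRoots : List Carrier → Poly
      monicFromRoots []      = []
      monicFromRoots (s ∷ S) = addScaled (- s) (0# ∷ monicFromRoots S) (monicFromRoots S ∷ʳ 1#)

      length-∷ʳ : ∀ (t : Poly) c → length (t ∷ʳ c) ≡ suc (length t)
      length-∷ʳ t c = ≡.trans (length-++ t) (ℕ.+-comm (length t) 1)

      monicFromRoots-length : ∀ S → length (monicFromRoots S) ≡ length S
      monicFromRoots-length []      = ≡.refl
      monicFromRoots-length (s ∷ S) = ≡.trans (addScaled-length (- s) (0# ∷ monicFromRoots S) (monicFromRoots S ∷ʳ 1#)
          (≡.sym (length-∷ʳ (monicFromRoots S) 1#)))
                                              (≡.cong suc (monicFromRoots-length S))

      monicFromRoots-over : ∀ {S} → All (_∈ E) S → monicFromRoots S over E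
      monicFromRoots-over []         = []
      monicFromRoots-over (s∈ ∷ S∈) = addScaled-over E (neg-closed E s∈) (0-closed E ∷ monicFromRoots-over S∈)
          (∷ʳ-over E (monicFromRoots-over S∈) (1-closed E))

      module _ {τ} (hom : Hom A E τ) where
        open Hom hom

        horner-map-addScaled : ∀ {k s t} {e e′ : Carrier} → k ∈ E → s over E → t over E → length s ≡ length t → ∀ x →
          horner (e + τ k * e′) (map τ (addScaled k s t)) x ≈ horner e (map τ s) x + τ k * horner e′ (map τ t) x
        horner-map-addScaled k∈ [] [] l x = refl
        horner-map-addScaled {k} {a ∷ s} {b ∷ t} k∈ (a∈ ∷ s∈) (b∈ ∷ t∈) l x =
          trans (+-cong (trans (+-homo a∈ (*-closed E k∈ b∈)) (+-congˡ (*-homo k∈ b∈)))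
              (*-congˡ (horner-map-addScaled k∈ s∈ t∈ (ℕ.suc-injective l) x)))
            (solve 6 (λ a k b x y z → (a :+ k :* b) :+ x :* (y :+ k :* z) := (a :+ x :* y) :+ k :* (b :+ x :* z)) refl
                (τ a) (τ k) (τ b) x _ _)

        map-∷ʳ : ∀ t x → horner 0# (map τ (t ∷ʳ 1#)) x ≈ monic (map τ t) x
        map-∷ʳ []      x = trans (eval-constant (τ 1#) x) (1-homo hom)
        map-∷ʳ (a ∷ t) x = +-congˡ (*-congˡ (map-∷ʳ t x))

        map-monicFromRoots : ∀ {S} → All (_∈ E) S → ∀ x → monic (map τ (monicFromRoots S)) x ≈ linears (map τ S) x
        map-monicFromRoots []                   x = refl
        map-monicFromRoots {s ∷ S} (s∈ ∷ S∈) x = begin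
          horner 1# (map τ (addScaled (- s) (0# ∷ t) (t ∷ʳ 1#))) x
            ≈⟨ horner-cong (map τ (addScaled (- s) (0# ∷ t) (t ∷ʳ 1#)))
                (trans (sym (+-identityʳ 1#)) (+-congˡ (sym (zeroʳ _)))) refl ⟩
          horner (1# + τ (- s) * 0#) (map τ (addScaled (- s) (0# ∷ t) (t ∷ʳ 1#))) x
            ≈⟨ horner-map-addScaled (neg-closed E s∈) (0-closed E ∷ t∈) (∷ʳ-over E t∈ (1-closed E))
                (≡.sym (length-∷ʳ t 1#)) x ⟩
          (τ 0# + x * monic (map τ t) x) + τ (- s) * horner 0# (map τ (t ∷ʳ 1#)) x
            ≈⟨ +-cong (trans (+-congʳ (0-homo hom)) (+-identityˡ _)) (*-cong (neg-homo hom s∈) (map-∷ʳ t x)) ⟩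
          x * monic (map τ t) x + - τ s * monic (map τ t) x
            ≈⟨ distribʳ _ _ _ ⟨
          (x + - τ s) * monic (map τ t) x
            ≈⟨ *-congˡ (map-monicFromRoots S∈ x) ⟩
          (x + - τ s) * linears (map τ S) x ∎
          where t = monicFromRoots S
                t∈ = monicFromRoots-over S∈

      monic-monicFromRoots : ∀ {S} → All (_∈ E) S → ∀ x → monic (monicFromRoots S) x ≈ linears S x
      monic-monicFromRoots {S} S∈ x = begin
        monic (monicFromRoots S) x                 ≡⟨ ≡.cong (λ f → monic f x) (map-id (monicFromRoots S)) ⟨
        monic (map (λ x → x) (monicFromRoots S)) x ≈⟨ map-monicFromRoots (hom-id A E) S∈ x ⟩
        linears (map (λ x → x) S) x                ≡⟨ ≡.cong (λ f → linears f x) (map-id S) ⟩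
        linears S x                                ∎

      -- In the application `zs` holds all roots in `K̄`; `list` keeps those in `E` without
      -- repetition, so that ∏ (X - s) is separable even if `f` is not.
      record RootsIn (f : Poly) (zs : List Carrier) : Set ℓ where
        field
          list     : List Carrier
          list∈    : All (_∈ E) list
          distinct : Distinct list
          roots    : All (Root f) list
          complete : ∀ {r} → r ∈ E → Any (r ≈_) zs → Any (r ≈_) list

      rootsIn : ∀ f zs → All (Root f) zs → RootsIn f zs
      rootsIn f []       []       = record { list = [] ; list∈ = [] ; distinct = [] ; roots = [] ; complete = λ _ i →
          i }
      rootsIn f (z ∷ zs) (e ∷ es) = insert (rootsIn f zs es)
        where
        insert : RootsIn f zs → RootsIn f (z ∷ zs)
        insert R with dec (z ∈ E × ¬ Any (z ≈_) (RootsIn.list R))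
        ... | yes (z∈ , new) = record
          { list = z ∷ list ; list∈ = z∈ ∷ list∈ ; distinct = All.¬Any⇒All¬ list new ∷ distinct ; roots = e ∷ roots
          ; complete = λ { r∈ (here r≈z) → here r≈z ; r∈ (there i) → there (complete r∈ i) } }
          where open RootsIn R
        ... | no old = record
          { list = list ; list∈ = list∈ ; distinct = distinct ; roots = roots
          ; complete = λ { r∈ (here r≈z) → Any.map (λ z≈ → trans r≈z z≈)
              (by-contradiction λ new → old (respects E r≈z r∈ , new))
                         ; r∈ (there i) → complete r∈ i } }
          where open RootsIn R

      -- The roots in E of a polynomial over A annihilating x are permuted by the
      -- A-endomorphisms of E, hence their elementary symmetric functions are fixed.
      fixed⇒galoisian : ∀ N → (∀ {y} → Fixed A E y → y ∈ N) → ∀ {x} → x ∈ E → Galoisian N E x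
      fixed⇒galoisian N Fixed⊆N {x} x∈ = record
        { poly = t ∷ʳ 1# ; poly∈ = ∷ʳ-over N t∈N (1-closed N)
        ; root = trans (eval-t x) (linears-root list (complete x∈ (root⇒any root)))
        ; separable = λ r g e → distinct⇒separable list distinct r g (λ y → trans (sym (eval-t y)) (e y))
        ; roots∈ = λ e → any-∈ E list∈ (root-linears list (trans (sym (eval-t _)) e)) }
        where
        m = minimalPolynomial A K⊆A x
        open MinimalPolynomial m
        R = rootsIn poly roots (tabulate-any roots λ i → trans (eval-poly _) (any⇒root i))
        open RootsIn R renaming (roots to list-roots)
        t = monicFromRoots list
        t∈ : t over E
        t∈ = monicFromRoots-over list∈
        eval-t : ∀ y → eval (t ∷ʳ 1#) y ≈ linears list y
        eval-t y = trans (eval-∷ʳ t 1# y) (monic-monicFromRoots list∈ y)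
        module _ {τ} (endo : Endo A E τ) where
          hom = proj₁ endo
          -- The product minus its image under τ: the leading terms cancel, so its length is the
          -- number of roots in `list`, and it vanishes at the equally many distinct images under τ,
          -- which again lie in `list`.
          w : Poly
          w = addScaled (- 1#) t (map τ t)
          eval-w : ∀ y → eval w y ≈ linears list y + - linears (map τ list) y
          eval-w y = begin
            eval w y ≈⟨ horner-cong w (sym (trans (+-congˡ (*-identityʳ _)) (-‿inverseʳ 1#))) refl ⟩
            horner (1# + - 1# * 1#) w y ≈⟨ horner-addScaled (- 1#) t (map τ t) y (≡.sym (length-map τ t)) ⟩
            monic t y + - 1# * monic (map τ t) y
              ≈⟨ +-cong (monic-monicFromRoots list∈ y)
              (trans (sym (-‿distribˡ-* 1# _)) (-‿cong (trans (*-identityˡ _) (map-monicFromRoots hom list∈ y)))) ⟩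
            linears list y + - linears (map τ list) y ∎
          permuted : ∀ {rs} → All (_∈ E) rs → All (Root poly) rs → All (λ s → Any (s ≈_) list) rs
          permuted []         []       = []
          permuted (r∈ ∷ rs∈) (e ∷ es) = complete r∈ (root⇒any (trans (sym (eval-poly _)) e)) ∷ permuted rs∈ es
          images-∈ : ∀ {rs} → All (_∈ E) rs → All (_∈ E) (map τ rs)
          images-∈ []         = []
          images-∈ (r∈ ∷ rs∈) = proj₂ endo r∈ ∷ images-∈ rs∈
          images-root : ∀ {rs} → All (_∈ E) rs → All (Root poly) rs → All (Root poly) (map τ rs)
          images-root []         []       = []
          images-root (r∈ ∷ rs∈) (e ∷ es) = hom-root hom A⊆E poly∈ r∈ e ∷ images-root rs∈ es
          zeros : ∀ {rs} → All (λ s → Any (s ≈_) list) rs → (∀ {x} → Any (x ≈_) rs → Any (x ≈_) (map τ list)) → All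
              (Root w) rs
          zeros []       inc = []
          zeros (i ∷ is) inc = trans (eval-w _) (trans
              (+-cong (linears-root list i) (trans (-‿cong (linears-root (map τ list) (inc (here refl)))) -0#≈0#))
              (+-identityˡ _)) ∷ zeros is (λ i → inc (there i))
          images-distinct : ∀ {rs} → All (_∈ E) rs → Distinct rs → Distinct (map τ rs)
          images-distinct []         []       = []
          images-distinct (r∈ ∷ rs∈) (d ∷ ds) = fresh r∈ rs∈ d ∷ images-distinct rs∈ ds
            where
            fresh : ∀ {r rs} → r ∈ E → All (_∈ E) rs → All (λ s → ¬ r ≈ s) rs → All (λ s → ¬ τ r ≈ s) (map τ rs)
            fresh r∈ []         []       = []
            fresh r∈ (s∈ ∷ rs∈) (d ∷ ds) = (λ e → d (hom-injective hom r∈ s∈ e)) ∷ fresh r∈ rs∈ ds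
          w≡0 : Vanishing w
          w≡0 = too-many-roots w (map τ list)
            (ℕ.≤-reflexive (≡.trans (addScaled-length (- 1#) t (map τ t) (≡.sym (length-map τ t)))
                (≡.trans (monicFromRoots-length list) (≡.sym (length-map τ list)))))
            (images-distinct list∈ distinct)
            (zeros (permuted (images-∈ list∈) (images-root list∈ list-roots)) (λ i → i))
          fixed-coefficients : ∀ t → (∀ n → coeff (addScaled (- 1#) t (map τ t)) n ≈ 0#) → All (λ a → τ a ≈ a) t
          fixed-coefficients []      e = []
          fixed-coefficients (a ∷ t) e = sym (-≈0⇒≈ (trans
              (+-congˡ (sym (trans (sym (-‿distribˡ-* 1# _)) (-‿cong (*-identityˡ _))))) (e 0))) ∷ fixed-coefficients
              t (λ n → e (suc n))
          fixed : All (λ a → τ a ≈ a) t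
          fixed = fixed-coefficients t (vanishing-coeff closed w w≡0)
        all-fixed : ∀ {t} → t over E → (∀ {τ} → Endo A E τ → All (λ a → τ a ≈ a) t) → t over N
        all-fixed []         e = []
        all-fixed (a∈ ∷ t∈) e = Fixed⊆N (a∈ , λ endo → All.head (e endo)) ∷ all-fixed t∈ (λ endo → All.tail (e endo))
        t∈N : t over N
        t∈N = all-fixed t∈ fixed

    open SemiringSum semiring public using (sum; sum-cong-≋; ∑-distrib-+; *-distribˡ-sum; *-distribʳ-sum; ∑-comm;
        sum-remove; sum-init-last; sum-replicate-zero)

    -- Linear algebra over subfields

    sum-zero : ∀ {n} (f : Vector Carrier n) → (∀ i → f i ≈ 0#) → sum f ≈ 0#
    sum-zero {n} f e = trans (sum-cong-≋ e) (sum-replicate-zero n)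

    sum-∈ : ∀ E {n} {f : Vector Carrier n} → (∀ i → f i ∈ E) → sum f ∈ E
    sum-∈ E {zero}  f∈ = 0-closed E
    sum-∈ E {suc n} f∈ = +-closed E (f∈ zero) (sum-∈ E (λ i → f∈ (suc i)))

    combination-∈ : ∀ E {n} {c b : Vector Carrier n} → (∀ i → c i ∈ E) → (∀ i → b i ∈ E) → combination c b ∈ E
    combination-∈ E c∈ b∈ = sum-∈ E λ i → *-closed E (c∈ i) (b∈ i)

    Span : Subfield → ∀ {n} → Vector Carrier n → Pred Carrier ℓ
    Span A {n} b x = ∃ λ (c : Vector Carrier n) → (∀ i → c i ∈ A) × x ≈ combination c b

    Solution : Subfield → ∀ {m n} → (Fin n → Fin m → Carrier) → Set ℓ
    Solution A {m} {n} a = ∃ λ (c : Vector Carrier n) → (∀ i → c i ∈ A) × (∃[ i ] ¬ c i ≈ 0#) ×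
        (∀ j → sum (λ i → c i * a i j) ≈ 0#)

    underdetermined-system : ∀ A m n → m < n → (a : Fin n → Fin m → Carrier) → (∀ i j → a i j ∈ A) → Solution A a
    underdetermined-system A zero    (suc n) m<n a a∈ = (λ _ → 1#) , (λ _ → 1-closed A) , (zero , 1≉0) , λ ()
    underdetermined-system A (suc m) (suc n) (s≤s m<n) a a∈ = by-pivot (dec (∃[ p ] ¬ a p zero ≈ 0#))
      where
      by-pivot : Dec (∃[ p ] ¬ a p zero ≈ 0#) → Solution A a
      by-pivot (no none) = add-column (underdetermined-system A m (suc n) (ℕ.<-trans m<n (ℕ.n<1+n n))
          (λ i j → a i (suc j)) (λ i j → a∈ i (suc j)))
        where
        add-column : Solution A (λ i j → a i (suc j)) → Solution A a
        add-column (c , c∈ , nonzero , e) = c , c∈ , nonzero , λ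
          { zero → sum-zero (λ i → c i * a i zero) λ i → trans (*-congˡ (by-contradiction λ n → none (i , n)))
              (zeroʳ _)
          ; (suc j) → e j }
      by-pivot (yes (p , pivot≉0)) = eliminate (underdetermined-system A m n m<n (λ i j → b i (suc j))
          (λ i j → b∈ i (suc j)))
        where
        -- Division-free elimination of the first equation: `b i zero` vanishes identically.
        b : Fin n → Fin (suc m) → Carrier
        b i j = a (punchIn p i) j * a p zero + - (a (punchIn p i) zero * a p j)
        b∈ : ∀ i j → b i j ∈ A
        b∈ i j = +-closed A (*-closed A (a∈ _ _) (a∈ _ _)) (neg-closed A (*-closed A (a∈ _ _) (a∈ _ _)))
        eliminate : Solution A (λ i j → b i (suc j)) → Solution A a
        eliminate (c , c∈ , (i₀ , cᵢ≉0) , e) = d , d∈ ,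
            (punchIn p i₀ , λ z → cᵢ≉0 (integral (trans (*-comm _ _) (trans (sym (reflexive (d-other i₀))) z))
            pivot≉0)) , vanishes
          where
          -- A solution of the reduced system, scaled by the pivot, is completed by the coefficient
          -- at `p` that the first equation forces.
          cₚ : Carrier
          cₚ = - sum (λ i → c i * a (punchIn p i) zero)
          d : Vector Carrier (suc n)
          d = Vector.insertAt (λ i → c i * a p zero) p cₚ
          d-pivot : d p ≡ cₚ
          d-pivot = insertAt-lookup (λ i → c i * a p zero) p cₚ
          d-other : ∀ i → d (punchIn p i) ≡ c i * a p zero
          d-other = insertAt-punchIn (λ i → c i * a p zero) p cₚ
          cₚ∈ : cₚ ∈ A
          cₚ∈ = neg-closed A (sum-∈ A λ i → *-closed A (c∈ i) (a∈ _ _))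
          insert-∈ : ∀ {n} (xs : Vector Carrier n) q v → (∀ i → xs i ∈ A) → v ∈ A → ∀ i → Vector.insertAt xs q v i ∈ A
          insert-∈         xs zero    v xs∈ v∈ zero    = v∈
          insert-∈         xs zero    v xs∈ v∈ (suc i) = xs∈ i
          insert-∈ {suc n} xs (suc q) v xs∈ v∈ zero    = xs∈ zero
          insert-∈ {suc n} xs (suc q) v xs∈ v∈ (suc i) = insert-∈ (λ i → xs (suc i)) q v (λ i → xs∈ (suc i)) v∈ i
          d∈ : ∀ i → d i ∈ A
          d∈ = insert-∈ (λ i → c i * a p zero) p cₚ (λ i → *-closed A (c∈ i) (a∈ _ _)) cₚ∈
          reduced : ∀ j → sum (λ i → c i * b i j) ≈ 0#
          reduced zero    = sum-zero (λ i → c i * b i zero) λ i → trans (*-congˡ (-‿inverseʳ _)) (zeroʳ _)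
          reduced (suc j) = e j
          vanishes : ∀ j → sum (λ i → d i * a i j) ≈ 0#
          vanishes j = begin
            sum (λ i → d i * a i j)
              ≈⟨ sum-remove {i = p} (λ i → d i * a i j) ⟩
            d p * a p j + sum (λ i → d (punchIn p i) * a (punchIn p i) j)
              ≈⟨ +-cong (*-congʳ (reflexive d-pivot)) (sum-cong-≋ λ i → *-congʳ (reflexive (d-other i))) ⟩
            cₚ * a p j + sum (λ i → c i * a p zero * a (punchIn p i) j)
              ≈⟨ +-congʳ (trans (sym (-‿distribˡ-* _ _))
                  (trans (-‿distribʳ-* _ _) (*-distribʳ-sum (- a p j) (λ i → c i * a (punchIn p i) zero)))) ⟩
            sum (λ i → c i * a (punchIn p i) zero * - a p j) + sum (λ i → c i * a p zero * a (punchIn p i) j)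
              ≈⟨ ∑-distrib-+ (λ i → c i * a (punchIn p i) zero * - a p j) (λ i → c i * a p zero * a (punchIn p i) j) ⟨
            sum (λ i → c i * a (punchIn p i) zero * - a p j + c i * a p zero * a (punchIn p i) j)
              ≈⟨ (sum-cong-≋ λ i → solve 5 (λ c x y u v → c :* x :* :- y :+ c :* u :* v := c :* (v :* u :- x :* y))
                  refl
                   (c i) (a (punchIn p i) zero) (a p j) (a p zero) (a (punchIn p i) j)) ⟩
            sum (λ i → c i * b i j)
              ≈⟨ reduced j ⟩
            0# ∎

    combination-combination : ∀ {m n} (c : Vector Carrier n) (a : Fin n → Fin m → Carrier) (v : Vector Carrier m) →
      combination c (λ i → combination (a i) v) ≈ combination (λ j → sum (λ i → c i * a i j)) v
    combination-combination {m} c a v = begin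
      sum (λ i → c i * sum (λ j → a i j * v j))
        ≈⟨ (sum-cong-≋ λ i → trans (*-distribˡ-sum (c i) (λ j → a i j * v j))
        (sum-cong-≋ {n = m} λ j → sym (*-assoc (c i) (a i j) (v j)))) ⟩
      sum (λ i → sum (λ j → c i * a i j * v j))     ≈⟨ ∑-comm (λ i j → c i * a i j * v j) ⟩
      sum (λ j → sum (λ i → c i * a i j * v j))
        ≈⟨ (sum-cong-≋ λ j → sym (*-distribʳ-sum (v j) (λ i → c i * a i j))) ⟩
      sum (λ j → sum (λ i → c i * a i j) * v j)     ∎

    combination-congˡ : ∀ {n} {c d : Vector Carrier n} b → (∀ i → c i ≈ d i) → combination c b ≈ combination d b
    combination-congˡ b e = sum-cong-≋ λ i → *-congʳ (e i)

    combination-congʳ : ∀ {n} c {b b′ : Vector Carrier n} → (∀ i → b i ≈ b′ i) → combination c b ≈ combination c b′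
    combination-congʳ c e = sum-cong-≋ λ i → *-congˡ (e i)

    combination-zero : ∀ {n} {c : Vector Carrier n} b → (∀ i → c i ≈ 0#) → combination c b ≈ 0#
    combination-zero {c = c} b e = sum-zero (λ i → c i * b i) λ i → trans (*-congʳ (e i)) (zeroˡ _)

    combination-distrib-+ : ∀ {n} (c d b : Vector Carrier n) → combination (λ i → c i + d i) b ≈ combination c b +
        combination d b
    combination-distrib-+ c d b = trans (sum-cong-≋ λ i → distribʳ (b i) (c i) (d i))
        (∑-distrib-+ (λ i → c i * b i) (λ i → d i * b i))

    combination-scale : ∀ {n} k (c b : Vector Carrier n) → combination (λ i → k * c i) b ≈ k * combination c b
    combination-scale k c b = trans (sum-cong-≋ λ i → *-assoc k (c i) (b i))
        (sym (*-distribˡ-sum k (λ i → c i * b i)))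

    combination-neg : ∀ {n} (c b : Vector Carrier n) → combination (λ i → - c i) b ≈ - combination c b
    combination-neg c b = trans (combination-congˡ b λ i → trans (-‿cong (sym (*-identityˡ _)))
        (-‿distribˡ-* 1# (c i)))
      (trans (combination-scale (- 1#) c b) (trans (sym (-‿distribˡ-* 1# _)) (-‿cong (*-identityˡ _))))

    -- If n > m, the coefficients of the `w i` in terms of `v` give m equations in n unknowns, and a
    -- nonzero solution is a relation among the `w i`.
    independent⇒≤ : ∀ A {m n} (v : Vector Carrier m) (w : Vector Carrier n) → (∀ i → Span A v (w i)) →
        LinearlyIndependent A w → n ≤ m
    independent⇒≤ A {m} {n} v w span independent = ℕ.≮⇒≥ λ m<n → contradict
        (underdetermined-system A m n m<n a (λ i → proj₁ (proj₂ (span i))))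
      where
      a : Fin n → Fin m → Carrier
      a i = proj₁ (span i)
      contradict : ¬ Solution A a
      contradict (c , c∈ , (i , cᵢ≉0) , e) = cᵢ≉0 (independent c c∈
          (trans (combination-congʳ c (λ i → proj₂ (proj₂ (span i))))
        (trans (combination-combination c a v) (combination-zero v e))) i)

    cons-independent : ∀ A {n} (u : Vector Carrier n) x → LinearlyIndependent A u → ¬ Span A u x → LinearlyIndependent
        A (x Vector.∷ u)
    cons-independent A u x independent x∉ c c∈ e = λ { zero → c₀≈0 ; (suc i) → independent (λ i → c (suc i))
        (λ i → c∈ (suc i)) rest i }
      where
      c₀ = c zero
      c₀≈0 : c₀ ≈ 0#
      c₀≈0 = by-contradiction λ c₀≉0 →
        let d , c₀d≈1 = inverse c₀≉0
            d∈ = inv-closed A c₀d≈1 (c∈ zero)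
            s = combination (λ i → c (suc i)) u
        in x∉ ((λ i → - d * c (suc i)) , (λ i → *-closed A (neg-closed A d∈) (c∈ (suc i))) , (begin
          x ≈⟨ trans (sym (*-identityˡ x)) (*-congʳ (sym c₀d≈1)) ⟩
          c₀ * d * x ≈⟨ solve 4 (λ c d x s → c :* d :* x := d :* (c :* x :+ s) :+ :- d :* s) refl c₀ d x s ⟩
          d * (c₀ * x + s) + - d * s ≈⟨ trans (+-congʳ (trans (*-congˡ e) (zeroʳ d))) (+-identityˡ _) ⟩
          - d * s ≈⟨ combination-scale (- d) (λ i → c (suc i)) u ⟨
          combination (λ i → - d * c (suc i)) u ∎))
      rest : combination (λ i → c (suc i)) u ≈ 0#
      rest = trans (sym (trans (+-congʳ (trans (*-congʳ c₀≈0) (zeroˡ x))) (+-identityˡ _))) e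

    record BasisOf (A : Subfield) (S : Pred Carrier ℓ) : Set ℓ where
      field
        size        : ℕ
        vectors     : Vector Carrier size
        members     : ∀ i → S (vectors i)
        independent : LinearlyIndependent A vectors
        spanning    : ∀ {x} → S x → Span A vectors x

    -- `S` may be any set inside the span of `v`: a field, or the finitely many coefficients of a
    -- relation. Independent elements of `S` are collected greedily; after m of them another one
    -- would contradict `independent⇒≤`, so m is enough fuel.
    basisOf : ∀ A {S : Pred Carrier ℓ} {m} (v : Vector Carrier m) → (∀ {x} → S x → Span A v x) → BasisOf A S
    basisOf A {S} {m} v spanned = grow m 0 (λ ()) (λ ()) (λ _ _ _ ()) (ℕ.m≤m+n m 0)
      where
      grow : ∀ fuel k (u : Vector Carrier k) → (∀ i → S (u i)) → LinearlyIndependent A u → m ≤ fuel ℕ.+ k → BasisOf A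
          S
      grow fuel k u u∈ independent bound = step fuel bound (dec (∃[ x ] S x × ¬ Span A u x))
        where
        step : ∀ fuel → m ≤ fuel ℕ.+ k → Dec (∃[ x ] S x × ¬ Span A u x) → BasisOf A S
        step fuel bound (no none) = record { size = k ; vectors = u ; members = u∈ ; independent = independent
          ; spanning = λ {x} x∈ → by-contradiction λ x∉ → none (x , x∈ , x∉) }
        step fuel bound (yes (x , x∈ , x∉)) = continue fuel bound
          where
          members : ∀ i → S ((x Vector.∷ u) i)
          members zero    = x∈
          members (suc i) = u∈ i
          independent′ = cons-independent A u x independent x∉
          continue : ∀ fuel → m ≤ fuel ℕ.+ k → BasisOf A S
          continue zero       bound = ⊥-elim (ℕ.<-irrefl ≡.refl
              (ℕ.≤-trans (independent⇒≤ A v (x Vector.∷ u) (λ i → spanned (members i)) independent′) bound))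
          continue (suc fuel) bound = grow fuel (suc k) (x Vector.∷ u) members independent′
              (ℕ.≤-trans bound (ℕ.≤-reflexive (≡.sym (ℕ.+-suc fuel k))))

    -- A K-basis of `M` need not lie in `E`, but its span over `A` contains `E`, and that is what
    -- `basisOf` asks for.
    finite-intermediate : ∀ A E M → IsFinite K M → K ⊆ A → A ⊆ E → E ⊆ M → IsFinite A E
    finite-intermediate A E M finite K⊆A A⊆E E⊆M = record
      { base⊆ = A⊆E ; degree = size , vectors , record
          { members = members ; independent = independent ; spanning = spanning } }
      where
      b = proj₁ (proj₂ (IsFinite.degree finite))
      basis = proj₂ (proj₂ (IsFinite.degree finite))
      spanned : ∀ {x} → x ∈ E → Span A b x
      spanned x∈ = let c , c∈ , e = IsBasis.spanning basis (E⊆M x∈) in c , (λ i → K⊆A (c∈ i)) , e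
      open BasisOf (basisOf A {Member E} b spanned)

    independent-⊆ : ∀ A B {n} {u : Vector Carrier n} → A ⊆ B → LinearlyIndependent B u → LinearlyIndependent A u
    independent-⊆ A B A⊆B independent c c∈ = independent c (λ i → A⊆B (c∈ i))

    degree-antitone : ∀ A B E → A ⊆ B → ∀ {a b} → Degree A E a → Degree B E b → b ≤ a
    degree-antitone A B E A⊆B (v , v-basis) (w , w-basis) =
      independent⇒≤ A v w (λ i → IsBasis.spanning v-basis (IsBasis.members w-basis i))
          (independent-⊆ A B {u = w} A⊆B (IsBasis.independent w-basis))

    -- For β ∈ B ∖ A and a B-basis w of E, the family β w₀, w₀, w₁, … is independent over A.
    degree-injective : ∀ A B E → A ⊆ B → B ⊆ E → ∀ {a b} → Degree A E a → Degree B E b → a ≤ b → B ⊆ A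
    degree-injective A B E A⊆B B⊆E {b = zero} _ (w , w-basis) _ x∈ =
      ⊥-elim (1≉0 (proj₂ (proj₂ (IsBasis.spanning w-basis (1-closed E)))))
    degree-injective A B E A⊆B B⊆E {a} {suc b} (v , v-basis) (w , w-basis) a≤b {β} β∈ = by-contradiction λ β∉ →
      ℕ.<-irrefl ≡.refl (ℕ.≤-trans (independent⇒≤ A v w′ (λ i → IsBasis.spanning v-basis (w′∈ i)) (independent′ β∉))
          a≤b)
      where
      w′ : Vector Carrier (suc (suc b))
      w′ = (β * w zero) Vector.∷ w
      w′∈ : ∀ i → w′ i ∈ E
      w′∈ zero    = *-closed E (B⊆E β∈) (IsBasis.members w-basis zero)
      w′∈ (suc i) = IsBasis.members w-basis i
      independent′ : ¬ β ∈ A → LinearlyIndependent A w′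
      independent′ β∉ c c∈ e = λ { zero → c₀≈0 ; (suc zero) → c₁≈0 ; (suc (suc i)) → d≈0 (suc i) }
        where
        d : Vector Carrier (suc b)
        d = (c zero * β + c (suc zero)) Vector.∷ (λ i → c (suc (suc i)))
        d∈ : ∀ i → d i ∈ B
        d∈ zero    = +-closed B (*-closed B (A⊆B (c∈ zero)) β∈) (A⊆B (c∈ (suc zero)))
        d∈ (suc i) = A⊆B (c∈ (suc (suc i)))
        d≈0 : ∀ i → d i ≈ 0#
        d≈0 = IsBasis.independent w-basis d d∈ (trans
          (solve 5 (λ c β w c₁ s → (c :* β :+ c₁) :* w :+ s := c :* (β :* w) :+ (c₁ :* w :+ s)) refl (c zero) β
              (w zero) (c (suc zero)) _) e)
        c₀≈0 : c zero ≈ 0#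
        c₀≈0 = by-contradiction λ c₀≉0 → let k , c₀k≈1 = inverse c₀≉0 in
          β∉ (respects A (begin
            k * - c (suc zero)
              ≈⟨ solve 4 (λ k c β c₁ → k :* :- c₁ := c :* k :* β :- k :* (c :* β :+ c₁)) refl k (c zero) β
              (c (suc zero)) ⟩
            c zero * k * β + - (k * (c zero * β + c (suc zero)))
              ≈⟨ +-cong (trans (*-congʳ c₀k≈1) (*-identityˡ β))
              (trans (-‿cong (trans (*-congˡ (d≈0 zero)) (zeroʳ k))) -0#≈0#) ⟩
            β + 0# ≈⟨ +-identityʳ β ⟩
            β ∎) (*-closed A (inv-closed A c₀k≈1 (c∈ zero)) (neg-closed A (c∈ (suc zero)))))
        c₁≈0 : c (suc zero) ≈ 0#
        c₁≈0 = trans (sym (trans (+-congʳ (trans (*-congʳ c₀≈0) (zeroˡ β))) (+-identityˡ _))) (d≈0 zero)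

    spanned⊆ : ∀ A E F → A ⊆ F → ∀ {n} {b : Vector Carrier n} → IsBasis A E b → (∀ i → b i ∈ F) → E ⊆ F
    spanned⊆ A E F A⊆F basis b∈ x∈ = let c , c∈ , e = IsBasis.spanning basis x∈ in
      respects F (sym e) (combination-∈ F (λ i → A⊆F (c∈ i)) b∈)

    galois-fixed : ∀ A E → K ⊆ A → IsGalois A E → ∀ {y} → Fixed A E y → y ∈ A
    galois-fixed A E K⊆A galois = generated-fixed A E K⊆A (IsFinite.base⊆ finite) (tabulate b)
        (spanned⊆ A E (adjoinList A K⊆A (tabulate b)) (base⊆adjoinList A K⊆A (tabulate b)) basis
        (All.tabulate⁻ (generators∈ A K⊆A (tabulate b))))
        (All.tabulate⁺ (IsBasis.members basis)) (All.tabulate⁺ λ i → galois⇒galoisian A E K⊆A galois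
            (IsBasis.members basis i))
      where
      open IsGalois galois
      b = proj₁ (proj₂ (IsFinite.degree finite))
      basis = proj₂ (proj₂ (IsFinite.degree finite))

    -- Maximal Galois bases and composita

    fixedField : (A E : Subfield) → A ⊆ E → Subfield
    fixedField A E A⊆E = record
      { Member = Fixed A E
      ; respects = λ e (x∈ , fixed) → respects E e x∈ , λ (hom , stable) →
          trans (sym (Hom.cong hom x∈ e)) (trans (fixed (hom , stable)) e)
      ; 0-closed = base (0-closed A) ; 1-closed = base (1-closed A)
      ; +-closed = λ (x∈ , f) (y∈ , g) → +-closed E x∈ y∈ , λ endo → trans (Hom.+-homo (proj₁ endo) x∈ y∈)
          (+-cong (f endo) (g endo))
      ; *-closed = λ (x∈ , f) (y∈ , g) → *-closed E x∈ y∈ , λ endo → trans (Hom.*-homo (proj₁ endo) x∈ y∈)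
          (*-cong (f endo) (g endo))
      ; neg-closed = λ (x∈ , f) → neg-closed E x∈ , λ endo → trans (neg-homo (proj₁ endo) x∈) (-‿cong (f endo))
      ; inv-closed = λ {x} {y} xy≈1 (x∈ , f) → inv-closed E xy≈1 x∈ , λ {τ} (hom , stable) →
          let y∈ = inv-closed E xy≈1 x∈ in begin
          τ y           ≈⟨ trans (sym (*-identityʳ _)) (*-congˡ (sym xy≈1)) ⟩
          τ y * (x * y) ≈⟨ solve 3 (λ t x y → t :* (x :* y) := y :* (x :* t)) refl (τ y) x y ⟩
          y * (x * τ y) ≈⟨ *-congˡ (trans (*-congʳ (sym (f (hom , stable))))
              (trans (sym (Hom.*-homo hom x∈ y∈)) (trans (Hom.cong hom (*-closed E x∈ y∈) xy≈1) (1-homo hom)))) ⟩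
          y * 1#        ≈⟨ *-identityʳ y ⟩
          y             ∎ }
      where
      base : ∀ {x} → x ∈ A → Fixed A E x
      base x∈ = A⊆E x∈ , λ (hom , _) → Hom.fixes hom x∈

    fixed⇒galois : ∀ A E N → K ⊆ A → A ⊆ E → K ⊆ N → IsFinite N E → (∀ {y} → Fixed A E y → y ∈ N) → IsGalois N E
    fixed⇒galois A E N K⊆A A⊆E K⊆N finite Fixed⊆N = galoisian⇒galois N E K⊆N finite
        (fixed⇒galoisian A E K⊆A A⊆E N Fixed⊆N)

    module _ (E : Subfield) (finite : IsFinite K E) where
      open IsFinite finite using () renaming (base⊆ to K⊆E)

      -- Endomorphisms over `N` are endomorphisms over `K`. So the fixed field lies in every `N`
      -- over which `E` is Galois, and comparisons of degrees become inclusions.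
      fixed⊆base : ∀ N → K ⊆ N → IsGalois N E → ∀ {y} → Fixed K E y → y ∈ N
      fixed⊆base N K⊆N galois (y∈ , fixed) = galois-fixed N E K⊆N galois
        (y∈ , λ (hom , stable) → fixed (hom-restrict K N E E K⊆N (λ x∈ → x∈) hom , stable))

      hasMaximalDegree : ∀ N → K ⊆ N → N ⊆ E → (∀ {y} → Fixed K E y → y ∈ N) → (∀ {y} → y ∈ N → Fixed K E y) →
          HasMaximalGaloisDegree K E N
      hasMaximalDegree N K⊆N N⊆E Fixed⊆N N⊆Fixed = record
        { base⊆ = K⊆N
        ; galois = fixed⇒galois K E N (λ x∈ → x∈) K⊆E K⊆N (finite-intermediate N E E finite K⊆N N⊆E (λ x∈ → x∈))
            Fixed⊆N
        ; maximal = λ N′ K⊆N′ galois → degree-antitone N N′ E (λ x∈ → fixed⊆base N′ K⊆N′ galois (N⊆Fixed x∈)) }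

      -- `N` is any field with the same members as the fixed field, so that a compositum can take
      -- its place. A competitor of maximal degree contains `N`, and `degree-injective` gives the
      -- reverse inclusion.
      fixed⇒maximalBase : ∀ N → N ⊆ E → (∀ {y} → Fixed K E y → y ∈ N) → (∀ {y} → y ∈ N → Fixed K E y) →
          IsMaximalGaloisBase K E N
      fixed⇒maximalBase N N⊆E Fixed⊆N N⊆Fixed = record
        { hasMaximalDegree = maximal
        ; unique = λ N′ maximal′ →
            let open HasMaximalGaloisDegree maximal′ renaming (base⊆ to K⊆N′; galois to galois′; maximal to maximality′)
                galois = HasMaximalGaloisDegree.galois maximal
                N⊆N′ : N ⊆ N′
                N⊆N′ = λ x∈ → fixed⊆base N′ K⊆N′ galois′ (N⊆Fixed x∈)
                degree = proj₂ (IsFinite.degree (IsGalois.finite galois))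
                degree′ = proj₂ (IsFinite.degree (IsGalois.finite galois′))
            in degree-injective N N′ E N⊆N′ (IsFinite.base⊆ (IsGalois.finite galois′)) degree degree′ (maximality′ N K⊆N galois degree′ degree) , N⊆N′ }
        where
        K⊆N : K ⊆ N
        K⊆N x∈ = Fixed⊆N (K⊆E x∈ , λ (hom , _) → Hom.fixes hom x∈)
        maximal = hasMaximalDegree N K⊆N N⊆E Fixed⊆N N⊆Fixed

      -- The fixed field has maximal degree itself, so the uniqueness clause identifies it with `N`.
      maximalBase⊆fixed : ∀ N → IsMaximalGaloisBase K E N → ∀ {y} → y ∈ N → Fixed K E y
      maximalBase⊆fixed N isMaximal = proj₂ (IsMaximalGaloisBase.unique isMaximal Fix
          (hasMaximalDegree Fix (λ x∈ → K⊆E x∈ , λ (hom , _) → Hom.fixes hom x∈) proj₁ (λ y∈ → y∈) (λ y∈ → y∈)))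
        where Fix = fixedField K E K⊆E

    compositum-least : ∀ E F M → E ⊆ M → F ⊆ M → E ∙ F ⊆ M
    compositum-least E F M E⊆M F⊆M = go
      where
      go : ∀ {x} → Generated (λ x → x ∈ E ⊎ x ∈ F) x → x ∈ M
      go (gen (inj₁ x∈)) = E⊆M x∈
      go (gen (inj₂ x∈)) = F⊆M x∈
      go (resp e g)       = respects M e (go g)
      go zero             = 0-closed M
      go one              = 1-closed M
      go (add g h)        = +-closed M (go g) (go h)
      go (mul g h)        = *-closed M (go g) (go h)
      go (neg g)          = neg-closed M (go g)
      go (inv e g)        = inv-closed M e (go g)

    ⊆-compositumˡ : ∀ E F → E ⊆ E ∙ F
    ⊆-compositumˡ E F x∈ = gen (inj₁ x∈)

    ⊆-compositumʳ : ∀ E F → F ⊆ E ∙ F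
    ⊆-compositumʳ E F x∈ = gen (inj₂ x∈)

    compositum-mono : ∀ E F E′ F′ → E ⊆ E′ → F ⊆ F′ → E ∙ F ⊆ E′ ∙ F′
    compositum-mono E F E′ F′ E⊆ F⊆ = compositum-least E F (E′ ∙ F′) (λ x∈ → gen (inj₁ (E⊆ x∈)))
        (λ x∈ → gen (inj₂ (F⊆ x∈)))

    compositum-comm : ∀ E F → E ∙ F ⊆ F ∙ E
    compositum-comm E F = compositum-least E F (F ∙ E) (⊆-compositumʳ F E) (⊆-compositumˡ F E)

    module _ (A X A′ X′ : Subfield) (K⊆A : K ⊆ A) (K⊆A′ : K ⊆ A′) (galois : IsGalois A X) (galois′ : IsGalois A′ X′)
        where

      private
        A⊆X = IsFinite.base⊆ (IsGalois.finite galois)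
        A′⊆X′ = IsFinite.base⊆ (IsGalois.finite galois′)
        AA′⊆XX′ = compositum-mono A A′ X X′ A⊆X A′⊆X′
        K⊆AA′ : K ⊆ A ∙ A′
        K⊆AA′ x∈ = ⊆-compositumˡ A A′ (K⊆A x∈)

      -- Bases of X/A and X′/A′ together generate X X′ over A A′, and each of their elements stays
      -- separable with all its conjugates in X X′.
      compositum-fixed : ∀ {y} → Fixed (A ∙ A′) (X ∙ X′) y → y ∈ A ∙ A′
      compositum-fixed = generated-fixed (A ∙ A′) (X ∙ X′) K⊆AA′ AA′⊆XX′ zs generated
          (All.++⁺ (All.tabulate⁺ λ i → ⊆-compositumˡ X X′ (IsBasis.members basis i))
              (All.tabulate⁺ λ i → ⊆-compositumʳ X X′ (IsBasis.members basis′ i)))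
          (All.++⁺ (All.tabulate⁺ λ i → galoisian-mono A (A ∙ A′) X (X ∙ X′) (⊆-compositumˡ A A′) (⊆-compositumˡ X X′)
              (galois⇒galoisian A X K⊆A galois (IsBasis.members basis i)))
                   (All.tabulate⁺ λ i → galoisian-mono A′ (A ∙ A′) X′ (X ∙ X′) (⊆-compositumʳ A A′)
                       (⊆-compositumʳ X X′) (galois⇒galoisian A′ X′ K⊆A′ galois′ (IsBasis.members basis′ i))))
        where
        b = proj₁ (proj₂ (IsFinite.degree (IsGalois.finite galois)))
        basis = proj₂ (proj₂ (IsFinite.degree (IsGalois.finite galois)))
        b′ = proj₁ (proj₂ (IsFinite.degree (IsGalois.finite galois′)))
        basis′ = proj₂ (proj₂ (IsFinite.degree (IsGalois.finite galois′)))
        zs = tabulate b ++ tabulate b′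
        Z = adjoinList (A ∙ A′) K⊆AA′ zs
        generated : X ∙ X′ ⊆ Z
        generated = compositum-least X X′ Z
          (spanned⊆ A X Z (λ x∈ → base⊆adjoinList (A ∙ A′) K⊆AA′ zs (⊆-compositumˡ A A′ x∈)) basis
            (All.tabulate⁻ (All.++⁻ˡ (tabulate b) (generators∈ (A ∙ A′) K⊆AA′ zs))))
          (spanned⊆ A′ X′ Z (λ x∈ → base⊆adjoinList (A ∙ A′) K⊆AA′ zs (⊆-compositumʳ A A′ x∈)) basis′
            (All.tabulate⁻ (All.++⁻ʳ (tabulate b) (generators∈ (A ∙ A′) K⊆AA′ zs))))

      compositum-galois : IsFinite (A ∙ A′) (X ∙ X′) → IsGalois (A ∙ A′) (X ∙ X′)
      compositum-galois finite = fixed⇒galois (A ∙ A′) (X ∙ X′) (A ∙ A′) K⊆AA′ AA′⊆XX′ K⊆AA′ finite compositum-fixed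

    -- Linear disjointness and membership in composita

    select : ∀ A {n} (c : Vector Carrier n) j → Span A c (c j)
    select A c zero = (1# Vector.∷ λ _ → 0#) , (λ { zero → 1-closed A ; (suc i) → 0-closed A }) ,
      sym (trans (+-cong (*-identityˡ _) (combination-zero (λ i → c (suc i)) λ _ → refl)) (+-identityʳ _))
    select A c (suc j) = let d , d∈ , e = select A (λ i → c (suc i)) j in
      (0# Vector.∷ d) , (λ { zero → 0-closed A ; (suc i) → d∈ i }) , trans e
          (sym (trans (+-congʳ (zeroˡ _)) (+-identityˡ _)))

    -- The coefficients `c j` are expanded in a K-basis chosen among themselves, which stays
    -- independent over `F`. A relation ∑ cⱼ bⱼ = 0 thus splits into one relation among the `b j`
    -- over `K` for each basis vector, and these are trivial.
    linearlyDisjoint-sym : ∀ E F → LinearlyDisjoint K E F →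
      ∀ {n} (b : Vector Carrier n) → (∀ i → b i ∈ F) → LinearlyIndependent K b → K ⊆ F → LinearlyIndependent E b
    linearlyDisjoint-sym E F disjoint {n} b b∈ independent K⊆F c c∈ e j =
        trans (proj₂ (proj₂ (k-span j))) (combination-zero U.vectors λ i → coefficients-zero i j)
      where
      IsEntry : Carrier → Set ℓ
      IsEntry x = ∃[ j ] x ≈ c j
      entry-span : ∀ {x} → IsEntry x → Span K c x
      entry-span (j , x≈c) = let d , d∈ , e = select K c j in d , d∈ , trans x≈c e
      module U = BasisOf (basisOf K {IsEntry} c entry-span)
      k-span : ∀ j → Span K U.vectors (c j)
      k-span j = U.spanning (j , refl)
      k : Fin n → Fin U.size → Carrier
      k j = proj₁ (k-span j)
      k∈ : ∀ j i → k j i ∈ K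
      k∈ j = proj₁ (proj₂ (k-span j))
      U-independent : LinearlyIndependent F U.vectors
      U-independent = disjoint U.vectors (λ i → let j , u≈c = U.members i in respects E (sym u≈c) (c∈ j)) U.independent
      inner : ∀ i → sum (λ j → b j * k j i) ≈ 0#
      inner = U-independent (λ i → sum (λ j → b j * k j i)) (λ i → sum-∈ F λ j → *-closed F (b∈ j) (K⊆F (k∈ j i)))
          (begin
        combination (λ i → sum (λ j → b j * k j i)) U.vectors ≈⟨ combination-combination b k U.vectors ⟨
        combination b (λ j → combination (k j) U.vectors)
          ≈⟨ (sum-cong-≋ {n} λ j → trans (*-comm _ _) (*-congʳ (sym (proj₂ (proj₂ (k-span j)))))) ⟩
        combination c b                                       ≈⟨ e ⟩
        0#                                                    ∎)
      coefficients-zero : ∀ i j → k j i ≈ 0#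
      coefficients-zero i = independent (λ j → k j i) (λ j → k∈ j i)
          (trans (sum-cong-≋ {n} λ j → *-comm (k j i) (b j)) (inner i))

    -- Write 1 = ∑ kⱼ βⱼ and x = ∑ aⱼ βⱼ. Then ∑ (x kⱼ - aⱼ) βⱼ = 0, so x kⱼ = aⱼ for all j by
    -- independence over `Ω`; some kⱼ is nonzero, and x = aⱼ / kⱼ. In this form 1 does not have to
    -- be one of the βⱼ.
    intersect-span : ∀ A Ω {n} (β : Vector Carrier n) → LinearlyIndependent Ω β → A ⊆ Ω → Span A β 1# → ∀ {x} → x ∈
        Ω → Span A β x → x ∈ A
    intersect-span A Ω {n} β independent A⊆Ω (k , k∈ , 1≈) {x} x∈ (a , a∈ , x≈) = conclude (dec (∃[ j ] ¬ k j ≈ 0#))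
      where
      d : Vector Carrier n
      d j = x * k j + - a j
      d≈0 : ∀ j → d j ≈ 0#
      d≈0 = independent d (λ j → +-closed Ω (*-closed Ω x∈ (A⊆Ω (k∈ j))) (neg-closed Ω (A⊆Ω (a∈ j)))) (begin
        combination d β
          ≈⟨ combination-distrib-+ (λ j → x * k j) (λ j → - a j) β ⟩
        combination (λ j → x * k j) β + combination (λ j → - a j) β
          ≈⟨ +-cong (combination-scale x k β) (combination-neg a β) ⟩
        x * combination k β + - combination a β
          ≈⟨ +-cong (trans (*-congˡ (sym 1≈)) (*-identityʳ x)) (-‿cong (sym x≈)) ⟩
        x + - x                                                   ≈⟨ -‿inverseʳ x ⟩
        0#                                                        ∎)
      conclude : Dec (∃[ j ] ¬ k j ≈ 0#) → x ∈ A
      conclude (no none) = ⊥-elim (1≉0 (trans 1≈ (combination-zero β λ j → by-contradiction λ n → none (j , n))))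
      conclude (yes (j , kⱼ≉0)) = let m , km≈1 = inverse kⱼ≉0 in respects A (begin
        a j * m       ≈⟨ *-congʳ (sym (-≈0⇒≈ (d≈0 j))) ⟩
        x * k j * m   ≈⟨ *-assoc _ _ _ ⟩
        x * (k j * m) ≈⟨ trans (*-congˡ km≈1) (*-identityʳ x) ⟩
        x             ∎) (*-closed A (a∈ j) (inv-closed A km≈1 (k∈ j)))

    module _ (A : Subfield) {n} (β : Vector Carrier n) where

      span-resp : ∀ {x y} → x ≈ y → Span A β x → Span A β y
      span-resp e (c , c∈ , e′) = c , c∈ , trans (sym e) e′

      span-+ : ∀ {x y} → Span A β x → Span A β y → Span A β (x + y)
      span-+ (c , c∈ , e) (d , d∈ , e′) = (λ i → c i + d i) , (λ i → +-closed A (c∈ i) (d∈ i)) , trans (+-cong e e′)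
          (sym (combination-distrib-+ c d β))

      span-scale : ∀ {k x} → k ∈ A → Span A β x → Span A β (k * x)
      span-scale {k} k∈ (c , c∈ , e) = (λ i → k * c i) , (λ i → *-closed A k∈ (c∈ i)) , trans (*-congˡ e)
          (sym (combination-scale k c β))

      span-combination : ∀ {m} {c v : Vector Carrier m} → (∀ i → c i ∈ A) → (∀ i → Span A β (v i)) → Span A β
          (combination c v)
      span-combination {m} {c} {v} c∈ v∈ = (λ j → sum (λ i → c i * a i j)) ,
          (λ j → sum-∈ A λ i → *-closed A (c∈ i) (proj₁ (proj₂ (v∈ i)) j)) ,
        trans (combination-congʳ c (λ i → proj₂ (proj₂ (v∈ i)))) (combination-combination c a β)
        where
        a : Fin m → Fin n → Carrier
        a i = proj₁ (v∈ i)

    span-⊆ : ∀ A B {n} {β : Vector Carrier n} → B ⊆ A → ∀ {x} → Span B β x → Span A β x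
    span-⊆ A B B⊆A (c , c∈ , e) = c , (λ i → B⊆A (c∈ i)) , e

    -- Products of the βᵢ lie in `J`, hence in their span over `B`, so the span over `A` is a ring.
    -- As it contains `K` it is a field, and therefore contains the compositum.
    compositum⊆span : ∀ A B J → K ⊆ A → B ⊆ A → K ⊆ J → ∀ {n} {β : Vector Carrier n} → IsBasis B J β → ∀ {x} → x ∈ A ∙
        J → Span A β x
    compositum⊆span A B J K⊆A B⊆A K⊆J {n} {β} basis = compositum-least A J S
        (λ {a} a∈ → span-resp A β (*-identityʳ a) (span-scale A β a∈ (J⊆S (1-closed J)))) J⊆S
      where
      J⊆S : ∀ {x} → x ∈ J → Span A β x
      J⊆S x∈ = span-⊆ A B B⊆A (IsBasis.spanning basis x∈)
      S : Subfield
      S = subringField {Span A β} (record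
        { ∈-resp = span-resp A β ; +-∈ = span-+ A β
        ; *-∈ = λ {x} {y} (c , c∈ , x≈) (d , d∈ , y≈) → span-resp A β (begin
            combination c (λ i → combination d (λ j → β j * β i))
              ≈⟨ (sum-cong-≋ {n} λ i → *-congˡ (trans (sum-cong-≋ {n} λ j → sym (*-assoc (d j) (β j) (β i)))
                                                                      (sym (*-distribʳ-sum (β i) (λ j → d j * β j)))))
                                                                          ⟩
            sum (λ i → c i * (combination d β * β i))
              ≈⟨ (sum-cong-≋ {n} λ i → solve 3 (λ c y b → c :* (y :* b) := (c :* b) :* y) refl (c i) (combination d β)
              (β i)) ⟩
            sum (λ i → c i * β i * combination d β)
              ≈⟨ *-distribʳ-sum (combination d β) (λ i → c i * β i) ⟨
            combination c β * combination d β                     ≈⟨ *-cong x≈ y≈ ⟨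
            x * y                                                 ∎)
            (span-combination A β c∈ λ i → span-combination A β d∈ λ j → J⊆S
                (*-closed J (IsBasis.members basis j) (IsBasis.members basis i))) })
        (λ x∈ → J⊆S (K⊆J x∈))

    -- What the magnification hypothesis gives about one of the two factors L and J.
    record Disjoint (L L̃ J : Subfield) : Set ℓ where
      field
        L-finite    : IsFinite K L
        J-finite    : IsFinite K J
        L⊆L̃         : L ⊆ L̃
        L̃-normal    : IsNormal K L̃
        independent : ∀ {n} (b : Vector Carrier n) → (∀ i → b i ∈ J) → LinearlyIndependent K b → LinearlyIndependent
            L̃ b

    module _ (L L̃ J : Subfield) (disjoint : Disjoint L L̃ J) where
      open Disjoint disjoint

      intersect-compositum : ∀ A X′ → K ⊆ A → A ⊆ L̃ → X′ ⊆ J → ∀ {x} → x ∈ L̃ → x ∈ A ∙ X′ → x ∈ A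
      intersect-compositum A X′ K⊆A A⊆L̃ X′⊆J x∈L̃ x∈ =
          intersect-span A L̃ b (independent b (IsBasis.members basis) (IsBasis.independent basis)) A⊆L̃
            (span (⊆-compositumˡ A J (1-closed A))) x∈L̃ (span (compositum-mono A X′ A J (λ y∈ → y∈) X′⊆J x∈))
        where
        b = proj₁ (proj₂ (IsFinite.degree J-finite))
        basis = proj₂ (proj₂ (IsFinite.degree J-finite))
        span : ∀ {x} → x ∈ A ∙ J → Span A b x
        span = compositum⊆span A K J K⊆A K⊆A (IsFinite.base⊆ J-finite) basis

      -- τ may move `x` out of `L` but not out of the normal closure; a conjugate is therefore first
      -- located in `L̃` and only then brought back by `intersect-compositum`.
      conjugate∈ : ∀ E → K ⊆ E → ∀ {τ x} → Hom K E τ → x ∈ E → x ∈ L̃ → τ x ∈ L̃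
      conjugate∈ E K⊆E {τ} {x} hom x∈E x∈L̃ = normal-roots∈ K L̃ L̃-normal m x∈L̃
          (trans (sym (eval-poly (τ x))) (hom-root hom K⊆E poly∈ x∈E (trans (eval-poly x) root)))
        where
        m = minimalPolynomial K (λ y∈ → y∈) x
        open MinimalPolynomial m

      endo-preserves : ∀ X X′ → K ⊆ X → X ⊆ L → X′ ⊆ J → ∀ {τ} → Endo K (X ∙ X′) τ → ∀ {x} → x ∈ X → τ x ∈ X
      endo-preserves X X′ K⊆X X⊆L X′⊆J (hom , stable) x∈ =
        intersect-compositum X X′ K⊆X (λ y∈ → L⊆L̃ (X⊆L y∈)) X′⊆J
          (conjugate∈ (X ∙ X′) (λ y∈ → ⊆-compositumˡ X X′ (K⊆X y∈)) hom (⊆-compositumˡ X X′ x∈) (L⊆L̃ (X⊆L x∈)))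
          (stable (⊆-compositumˡ X X′ x∈))

      maximalBase-fixed : ∀ X X′ N → K ⊆ X → X ⊆ L → X′ ⊆ J → IsMaximalGaloisBase K X N → ∀ {x τ} → x ∈ N → Endo K
          (X ∙ X′) τ → τ x ≈ x
      maximalBase-fixed X X′ N K⊆X X⊆L X′⊆J isMaximal x∈ endo =
        proj₂ (maximalBase⊆fixed X (finite-intermediate K X L L-finite (λ y∈ → y∈) K⊆X X⊆L) N isMaximal x∈)
          (hom-restrict K K X (X ∙ X′) (λ y∈ → y∈) (⊆-compositumˡ X X′) (proj₁ endo) , endo-preserves X X′ K⊆X X⊆L
              X′⊆J endo)

      -- An inclusion B B′ ⊆ A A′ would put B into L̃ ∩ A A′, which is A.
      strict-compositum : ∀ A A′ B B′ → K ⊆ A → A ⊆ B → B ⊆ L → A′ ⊆ J → ¬ B ⊆ A → ¬ B ∙ B′ ⊆ A ∙ A′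
      strict-compositum A A′ B B′ K⊆A A⊆B B⊆L A′⊆J B⊈A BB′⊆AA′ = B⊈A λ x∈ →
        intersect-compositum A A′ K⊆A (λ y∈ → L⊆L̃ (B⊆L (A⊆B y∈))) A′⊆J (L⊆L̃ (B⊆L x∈))
            (BB′⊆AA′ (⊆-compositumˡ B B′ x∈))

    module _ (L L̃ J J̃ : Subfield) (disjoint : Disjoint L L̃ J) (disjoint′ : Disjoint J J̃ L) where

      compositum-maximalBase : ∀ X N X′ N′ → IsFinite K (X ∙ X′) → K ⊆ X → X ⊆ L → K ⊆ X′ → X′ ⊆ J →
        IsMaximalGaloisBase K X N → IsMaximalGaloisBase K X′ N′ → IsMaximalGaloisBase K (X ∙ X′) (N ∙ N′)
      compositum-maximalBase X N X′ N′ finite K⊆X X⊆L K⊆X′ X′⊆J isMaximal isMaximal′ =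
          fixed⇒maximalBase XX′ finite (N ∙ N′) NN′⊆XX′ fixed⊆
              (compositum-least N N′ (fixedField K XX′ (IsFinite.base⊆ finite))
            (λ x∈ → ⊆-compositumˡ X X′ (N⊆X x∈) , maximalBase-fixed L L̃ J disjoint X X′ N K⊆X X⊆L X′⊆J isMaximal x∈)
            (λ x∈ → ⊆-compositumʳ X X′ (N′⊆X′ x∈) , λ endo → maximalBase-fixed J J̃ L disjoint′ X′ X N′ K⊆X′ X′⊆J X⊆L
                isMaximal′ x∈ (swap endo)))
        where
        open HasMaximalGaloisDegree (IsMaximalGaloisBase.hasMaximalDegree isMaximal) using () renaming
            (base⊆ to K⊆N; galois to galois)
        open HasMaximalGaloisDegree (IsMaximalGaloisBase.hasMaximalDegree isMaximal′) using () renaming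
            (base⊆ to K⊆N′; galois to galois′)
        XX′ = X ∙ X′
        N⊆X : N ⊆ X
        N⊆X = IsFinite.base⊆ (IsGalois.finite galois)
        N′⊆X′ : N′ ⊆ X′
        N′⊆X′ = IsFinite.base⊆ (IsGalois.finite galois′)
        NN′⊆XX′ : N ∙ N′ ⊆ XX′
        NN′⊆XX′ = compositum-mono N N′ X X′ N⊆X N′⊆X′
        swap : ∀ {τ} → Endo K XX′ τ → Endo K (X′ ∙ X) τ
        swap (hom , stable) = hom-restrict K K (X′ ∙ X) XX′ (λ y∈ → y∈) (compositum-comm X′ X) hom ,
          λ x∈ → compositum-comm X X′ (stable (compositum-comm X′ X x∈))
        fixed⊆ : ∀ {y} → Fixed K XX′ y → y ∈ N ∙ N′
        fixed⊆ (y∈ , fixed) = compositum-fixed N X N′ X′ K⊆N K⊆N′ galois galois′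
          (y∈ , λ (hom , stable) → fixed (hom-restrict K (N ∙ N′) XX′ XX′ (λ x∈ → ⊆-compositumˡ N N′ (K⊆N x∈))
              (λ x∈ → x∈) hom , stable))

    open SemiringExp semiring public using (_^_; ^-congˡ; ^-assocʳ)
    open CommutativeSemiringExp commutativeSemiring public using (^-distrib-*)

    -- Powers of the Frobenius

    -- Stands for: q is a power of the characteristic exponent. What matters is only that x ↦ x^q is
    -- additive on `K̄`, so characteristic zero and positive characteristic can be treated together.
    Additive : ℕ → Set ℓ
    Additive q = ∀ x y → (x + y) ^ q ≈ x ^ q + y ^ q

    additive-* : ∀ p q → Additive p → Additive q → Additive (p ℕ.* q)
    additive-* p q p-additive q-additive x y = begin
      (x + y) ^ (p ℕ.* q)             ≈⟨ ^-assocʳ (x + y) p q ⟨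
      ((x + y) ^ p) ^ q               ≈⟨ ^-congˡ q (p-additive x y) ⟩
      (x ^ p + y ^ p) ^ q             ≈⟨ q-additive (x ^ p) (y ^ p) ⟩
      (x ^ p) ^ q + (y ^ p) ^ q       ≈⟨ +-cong (^-assocʳ x p q) (^-assocʳ y p q) ⟩
      x ^ (p ℕ.* q) + y ^ (p ℕ.* q)   ∎

    power-zero : ∀ q {x} → x ^ q ≈ 0# → x ≈ 0#
    power-zero zero    e = ⊥-elim (1≉0 e)
    power-zero (suc q) {x} e = by-contradiction λ x≉0 → x≉0 (power-zero q (integral e x≉0))

    additive-injective : ∀ q → Additive q → ∀ {x y} → x ^ q ≈ y ^ q → x ≈ y
    additive-injective q additive {x} {y} e = -≈0⇒≈ (power-zero q (+-cancel (begin
      (x + - y) ^ q + y ^ q ≈⟨ additive (x + - y) y ⟨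
      (x + - y + y) ^ q     ≈⟨ ^-congˡ q (solve 2 (λ x y → x :- y :+ y := x) refl x y) ⟩
      x ^ q                 ≈⟨ e ⟩
      y ^ q                 ≈⟨ +-identityˡ _ ⟨
      0# + y ^ q            ∎)))

    ·-as-* : ∀ n x → n · x ≈ (n · 1#) * x
    ·-as-* n x = sym (trans (×-assoc-* n 1# x) (×-congʳ n (*-identityˡ x)))

    -- p = suc p′ is the characteristic; its minimality replaces primality, since j! ≠ 0 in K̄ for j < p.
    module Characteristic (p′ : ℕ) (p·1≈0 : suc p′ · 1# ≈ 0#) (smallest : ∀ k → k < p′ → ¬ suc k · 1# ≈ 0#) where
      private p = suc p′

      factorial≉0 : ∀ j → j < p → ¬ (j !) · 1# ≈ 0#
      factorial≉0 zero    j<p e = 1≉0 (trans (sym (+-identityʳ 1#)) e)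
      factorial≉0 (suc j) (s≤s j<p′) e =
        factorial≉0 j (ℕ.<-trans j<p′ (ℕ.n<1+n p′)) (integral (trans (sym (×1-homo-* (suc j) (j !))) e)
            (smallest j j<p′))

      -- C(p, k) k! (p - k)! = p!, which is 0 in `K̄`, while k! and (p - k)! are products of
      -- positive integers below p and so nonzero.
      binomial≈0 : ∀ k → 0 < k → k < p → ((p C k) · 1#) ≈ 0#
      binomial≈0 (suc k) _ k<p = by-contradiction λ C≉0 → nonzero (integral (begin
          ((p C suc k) · 1#) * ((suc k ! ℕ.* (p ∸ suc k) !) · 1#)
            ≈⟨ ×1-homo-* (p C suc k) (suc k ! ℕ.* (p ∸ suc k) !) ⟨
          ((p C suc k) ℕ.* (suc k ! ℕ.* (p ∸ suc k) !)) · 1#      ≈⟨ ×-congˡ C*k![p-k]!≡p! ⟩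
          (p !) · 1#                                              ≈⟨ ×1-homo-* p (p′ !) ⟩
          (p · 1#) * ((p′ !) · 1#)                                ≈⟨ trans (*-congʳ p·1≈0) (zeroˡ _) ⟩
          0#                                                      ∎) C≉0)
        where
        instance _ = (suc k) ℕ.!* (p ∸ suc k) !≢0
        C*k![p-k]!≡p! : (p C suc k) ℕ.* (suc k ! ℕ.* (p ∸ suc k) !) ≡ p !
        C*k![p-k]!≡p! = ≡.trans (≡.cong (ℕ._* (suc k ! ℕ.* (p ∸ suc k) !)) (nCk≡n!/k![n-k]! (ℕ.<⇒≤ k<p)))
            (m/n*n≡m (k![n∸k]!∣n! (ℕ.<⇒≤ k<p)))
        nonzero : ¬ (suc k ! ℕ.* (p ∸ suc k) !) · 1# ≈ 0#
        nonzero e = factorial≉0 (p ∸ suc k) (s≤s (ℕ.m∸n≤m p′ k))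
            (integral (trans (sym (×1-homo-* (suc k !) ((p ∸ suc k) !))) e) (factorial≉0 (suc k) k<p))

      frobenius-additive : Additive p
      frobenius-additive x y = begin
        (x + y) ^ p                                              ≈⟨ Binomial.theorem commutativeSemiring p x y ⟩
        term zero + sum (λ i → term (suc i))                     ≈⟨ +-congˡ (sum-init-last (λ i → term (suc i))) ⟩
        term zero + (sum (λ i → term (suc (inject₁ i))) + term (suc (fromℕ p′)))
          ≈⟨ +-cong first (+-cong (sum-zero (λ i → term (suc (inject₁ i))) middle) last) ⟩
        y ^ p + (0# + x ^ p)                                     ≈⟨ trans (+-congˡ (+-identityˡ _)) (+-comm _ _) ⟩
        x ^ p + y ^ p                                            ∎
        where
        term : Fin (suc p) → Carrier
        term = Binomial.binomialTerm commutativeSemiring x y p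
        first : term zero ≈ y ^ p
        first = trans (×-homo-1 (1# * y ^ p)) (*-identityˡ _)
        middle : ∀ i → term (suc (inject₁ i)) ≈ 0#
        middle i = trans (·-as-* (p C toℕ (suc (inject₁ i))) _)
            (trans (*-congʳ (binomial≈0 (suc (toℕ (inject₁ i))) (s≤s z≤n)
          (s≤s (≡.subst (_< p′) (≡.sym (Fin.toℕ-inject₁ i)) (Fin.toℕ<n i))))) (zeroˡ _))
        last : term (suc (fromℕ p′)) ≈ x ^ p
        last = trans (reflexive (≡.cong (λ k → (p C suc k) · (x ^ suc k * y ^ (p ∸ suc k))) (Fin.toℕ-fromℕ p′)))
          (trans (reflexive (≡.cong₂ (λ c k → c · (x ^ p * y ^ k)) (nCn≡1 p) (ℕ.n∸n≡0 p)))
            (trans (×-homo-1 (x ^ p * 1#)) (*-identityʳ _)))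

      -- In `K̄` the multiplier equals its residue, which lies strictly between 0 and p and is
      -- nonzero by minimality of p.
      vanishing-multiple : ∀ i x → i · x ≈ 0# → ¬ i % p ≡ 0 → x ≈ 0#
      vanishing-multiple i x ix≈0 i%p≢0 = integral (trans (sym (·-as-* i x)) ix≈0) λ i≈0 →
          nonzero (i % p) (m%n<n i p) i%p≢0 (begin
            (i % p) · 1#
              ≈⟨ trans (sym (+-identityʳ _)) (+-congˡ (sym
              (trans (×1-homo-* (i / p) p) (trans (*-congˡ p·1≈0) (zeroʳ _))))) ⟩
            (i % p) · 1# + ((i / p) ℕ.* p) · 1#  ≈⟨ ×-homo-+ 1# (i % p) ((i / p) ℕ.* p) ⟨
            (i % p ℕ.+ (i / p) ℕ.* p) · 1#       ≈⟨ ×-congˡ (m≡m%n+[m/n]*n i p) ⟨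
            i · 1#                               ≈⟨ i≈0 ⟩
            0#                                   ∎)
        where
        nonzero : ∀ j → j < p → ¬ j ≡ 0 → ¬ j · 1# ≈ 0#
        nonzero zero    j<p        j≢0 = ⊥-elim (j≢0 ≡.refl)
        nonzero (suc j) (s≤s j<p′) j≢0 = smallest j j<p′

      Periodic : Poly → Set ℓ
      Periodic f = ∀ i → ¬ i % p ≡ 0 → coeff f i ≈ 0#

      -- The polynomial g with f = g(X^p).
      contract : ℕ → Poly → Poly
      contract zero    f = []
      contract (suc k) f = coeff f 0 ∷ contract k (drop p f)

      coeff-drop : ∀ j f i → coeff (drop j f) i ≡ coeff f (i ℕ.+ j)
      coeff-drop zero    f       i = ≡.cong (coeff f) (≡.sym (ℕ.+-identityʳ i))
      coeff-drop (suc j) []      i = ≡.refl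
      coeff-drop (suc j) (a ∷ f) i = ≡.trans (coeff-drop j f i) (≡.cong (coeff (a ∷ f)) (≡.sym (ℕ.+-suc i j)))

      eval-drop : ∀ j f x → (∀ i → i < j → coeff f i ≈ 0#) → eval f x ≈ x ^ j * eval (drop j f) x
      eval-drop zero    f       x z = sym (*-identityˡ _)
      eval-drop (suc j) []      x z = sym (zeroʳ _)
      eval-drop (suc j) (a ∷ f) x z = trans (+-cong (z 0 (s≤s z≤n))
          (*-congˡ (eval-drop j f x λ i i<j → z (suc i) (s≤s i<j))))
        (trans (+-identityˡ _) (sym (*-assoc _ _ _)))

      small% : ∀ i → i < p′ → ¬ suc i % p ≡ 0
      small% i i<p′ e = ℕ.0≢1+n (≡.trans (≡.sym e) (m<n⇒m%n≡m (s≤s i<p′)))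

      -- Among the first p coefficients only the constant one can be nonzero, so f = a + X^p f₁ with
      -- f₁ obtained by dropping p entries, and f₁ is again periodic.
      eval-contract : ∀ k f x → Periodic f → length f ≤ k ℕ.* p → eval (contract k f) (x ^ p) ≈ eval f x
      eval-contract zero    []      x periodic l = refl
      eval-contract (suc k) []      x periodic l = trans (+-identityˡ _)
          (trans (*-congˡ (eval-contract k [] x (λ _ _ → refl) z≤n)) (zeroʳ _))
      eval-contract (suc k) (a ∷ t) x periodic l = +-congˡ (begin
        x ^ p * eval (contract k (drop p′ t)) (x ^ p) ≈⟨ *-congˡ (eval-contract k (drop p′ t) x periodic′ l′) ⟩
        x ^ p * eval (drop p′ t) x                    ≈⟨ *-assoc x (x ^ p′) _ ⟩
        x * (x ^ p′ * eval (drop p′ t) x)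
          ≈⟨ *-congˡ (eval-drop p′ t x (λ i i<p′ → periodic (suc i) (small% i i<p′))) ⟨
        x * eval t x                                  ∎)
        where
        periodic′ : Periodic (drop p′ t)
        periodic′ i i%p≢0 = trans (reflexive (coeff-drop p (a ∷ t) i))
            (periodic (i ℕ.+ p) λ e → i%p≢0 (≡.trans (≡.sym ([m+n]%n≡m%n i p)) e))
        l′ : length (drop p′ t) ≤ k ℕ.* p
        l′ = ≡.subst (_≤ k ℕ.* p) (≡.sym (length-drop p (a ∷ t))) (ℕ.m≤n+o⇒m∸n≤o (suc (length t)) p l)

      contract-length : ∀ k f → length (contract k f) ≡ k
      contract-length zero    f = ≡.refl
      contract-length (suc k) f = ≡.cong suc (contract-length k (drop p f))

      contract-over : ∀ (A : Subfield) k {f} → f over A → contract k f over A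
      contract-over A zero    f∈ = []
      contract-over A (suc k) f∈ = coeff-∈ (hom-id A A) f∈ 0 ∷ contract-over A k (All.drop⁺ p f∈)

    coeff-tailDerivative : ∀ t n → coeff (tailDerivative t) n ≈ suc n · coeff t n
    coeff-tailDerivative []      n       = sym (zero-multiple (suc n))
      where
      zero-multiple : ∀ n → n · 0# ≈ 0#
      zero-multiple n = trans (·-as-* n 0#) (zeroʳ _)
    coeff-tailDerivative (b ∷ t) zero    = refl
    coeff-tailDerivative (b ∷ t) (suc n) = trans (coeff-+ₚ t (tailDerivative t) n)
        (+-congˡ (coeff-tailDerivative t n))

    length-+ₚ : ∀ (f g : Poly) → length g ≤ length f → length (f +ₚ g) ≡ length f
    length-+ₚ []      []      l       = ≡.refl
    length-+ₚ (a ∷ f) []      l       = ≡.refl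
    length-+ₚ (a ∷ f) (b ∷ g) (s≤s l) = ≡.cong suc (length-+ₚ f g l)

    tailDerivative-length : ∀ t → length (tailDerivative t) ≡ length t
    tailDerivative-length []      = ≡.refl
    tailDerivative-length (b ∷ t) = length-+ₚ (b ∷ t) (0# ∷ tailDerivative t)
        (s≤s (ℕ.≤-reflexive (tailDerivative-length t)))

    tailDerivative-over : ∀ A {t} → t over A → tailDerivative t over A
    tailDerivative-over A []         = []
    tailDerivative-over A (b∈ ∷ t∈) = +ₚ-over A (b∈ ∷ t∈) (0-closed A ∷ tailDerivative-over A t∈)

    -- A polynomial not vanishing at z is invertible modulo the minimal polynomial of z.
    root-of-minimalPolynomial : ∀ {A z} → K ⊆ A → (m : MinimalPolynomial A z) → ∀ {r} → monic
        (MinimalPolynomial.lower m) r ≈ 0# →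
      ∀ g → g over A → eval g r ≈ 0# → eval g z ≈ 0#
    root-of-minimalPolynomial {A} {z} K⊆A m {r} mr≈0 g g∈ gr≈0 = by-contradiction λ gz≉0 →
      let y , gz*y≈1 = inverse gz≉0
          h , h∈ , y≈hz = adjoined A K⊆A z (inv-closed (adjoin A K⊆A z) gz*y≈1 (adjoined⁻¹ A K⊆A z (g , g∈ , refl)))
          w = (g *ₚ h) +ₚ (- 1# ∷ [])
          eval-w : ∀ x → eval w x ≈ eval g x * eval h x + - 1#
          eval-w x = trans (eval-+ₚ (g *ₚ h) (- 1# ∷ []) x) (+-cong (eval-*ₚ g h x) (eval-constant (- 1#) x))
          q , _ , w≈qm = divides m w (+ₚ-over A (*ₚ-over A g∈ h∈) (-1-closed A ∷ []))
              (trans (eval-w z) (≈⇒-≈0 (trans (*-congˡ (sym y≈hz)) gz*y≈1)))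
      in 1≉0 (trans (sym (-≈0⇒≈ (trans (sym (eval-w r)) (trans (w≈qm r) (trans (*-congˡ mr≈0) (zeroʳ _)))))) (trans (*-congʳ gr≈0) (zeroˡ _)))

    record SeparablePower (A : Subfield) (z : Carrier) : Set ℓ where
      field
        exponent  : ℕ
        additive  : Additive exponent
        poly      : Poly
        poly∈     : poly over A
        root      : Root poly (z ^ exponent)
        separable : Separable poly

    -- If the minimal polynomial has a multiple root, then its derivative
    -- vanishes, so it is a polynomial in X^p and z^p has smaller degree.
    separablePower : ∀ A → K ⊆ A → ∀ n z f → f over A → length f ≤ n → ¬ Vanishing f → Root f z → SeparablePower A z
    separablePower A K⊆A zero    z []  f∈ l f≢0 e = ⊥-elim (f≢0 λ _ → refl)
    separablePower A K⊆A (suc n) z f f∈ l f≢0 e = by-separability (dec (Separable poly))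
      where
      m = minimalPolynomial A K⊆A z
      open MinimalPolynomial m
      degree≤n : degree ≤ n
      degree≤n = ℕ.≮⇒≥ λ n<d → f≢0 (minimal f f∈ (ℕ.≤-trans l n<d) e)
      module _ (a : Carrier) (t : Poly) (lower≡ : lower ≡ a ∷ t) (r : Carrier) (g : Poly)
               (double : ∀ x → eval poly x ≈ (x + - r) * ((x + - r) * eval g x)) where
        tail = t ∷ʳ 1#
        poly≡ : poly ≡ a ∷ tail
        poly≡ = ≡.cong (_∷ʳ 1#) lower≡
        double′ : ∀ x → eval (a ∷ tail) x ≈ (x + - r) * ((x + - r) * eval g x)
        double′ x = trans (reflexive (≡.cong (λ f → eval f x) (≡.sym poly≡))) (double x)
        poly-r : eval (a ∷ tail) r ≈ 0#
        poly-r = trans (double′ r) (trans (*-congʳ (-‿inverseʳ r)) (zeroˡ _))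
        tail∈ : tail over A
        tail∈ = All.tail (≡.subst (_over A) poly≡ poly∈)
        derivative-r : eval (tailDerivative tail) r ≈ 0#
        -- The quotient of the polynomial by X - r is (X - r) g, which vanishes at `r`; its value
        -- there is the derivative.
        derivative-r = trans (sym (quotient-derivative r tail)) (trans
          (cancel-linear-factor r (quotient 0# r tail) ((X- r) *ₚ g)
              (λ x → trans (sym (root-quotient 0# r a tail poly-r x))
            (trans (double′ x) (*-congˡ (sym (trans (eval-*ₚ (X- r) g x) (*-congʳ (eval-X- r x))))))) r)
          (trans (eval-*ₚ (X- r) g r) (trans (*-congʳ (trans (eval-X- r r) (-‿inverseʳ r))) (zeroˡ _))))
        length-tail : length tail ≡ degree
        length-tail = ≡.trans (≡.trans (length-++ t) (ℕ.+-comm (length t) 1)) (≡.cong length (≡.sym lower≡))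
        derivative-vanishing : Vanishing (tailDerivative tail)
        -- The zero of the derivative at `r` is carried to `z` by `root-of-minimalPolynomial`; the
        -- derivative has smaller degree than the minimal polynomial of `z`, so it vanishes.
        derivative-vanishing = minimal (tailDerivative tail) (tailDerivative-over A tail∈)
          (ℕ.≤-reflexive (≡.trans (tailDerivative-length tail) length-tail))
          (root-of-minimalPolynomial K⊆A m (trans (sym (eval-poly r))
              (trans (reflexive (≡.cong (λ f → eval f r) poly≡)) poly-r))
            (tailDerivative tail) (tailDerivative-over A tail∈) derivative-r)
        multiples : ∀ i → suc i · coeff tail i ≈ 0#
        multiples i = trans (sym (coeff-tailDerivative tail i))
            (vanishing-coeff closed (tailDerivative tail) derivative-vanishing i)
        descend : ∃[ p′ ] suc p′ · 1# ≈ 0# × (∀ k → k < p′ → ¬ suc k · 1# ≈ 0#) → SeparablePower A z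
        descend (zero   , p·1≈0 , smallest) = ⊥-elim (1≉0 (trans (sym (+-identityʳ 1#)) p·1≈0))
        descend (suc p″ , p·1≈0 , smallest) = record
            { exponent = p ℕ.* S.exponent ; additive = additive-* p S.exponent frobenius-additive S.additive
            ; poly = S.poly ; poly∈ = S.poly∈ ; separable = S.separable
            ; root = trans (horner-cong S.poly refl (sym (^-assocʳ z p S.exponent))) S.root }
          where
          p = suc (suc p″)
          open Characteristic (suc p″) p·1≈0 smallest
          periodic : Periodic (a ∷ tail)
          periodic zero    i%p≢0 = ⊥-elim (i%p≢0 ≡.refl)
          periodic (suc i) i%p≢0 = vanishing-multiple (suc i) (coeff tail i) (multiples i) i%p≢0
          -- Here p ≥ 2 enters: the `degree` + 1 coefficients contract to `degree` many, which is at
          -- most n, so the recursion on the length bound goes through.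
          bound : length (a ∷ tail) ≤ suc (length t) ℕ.* p
          bound = ℕ.≤-trans (ℕ.≤-reflexive (≡.cong suc (≡.trans (length-++ t) (ℕ.+-comm (length t) 1))))
            (ℕ.+-mono-≤ {2} {p} (s≤s (s≤s z≤n)) (ℕ.m≤m*n (length t) p))
          g′ = contract (suc (length t)) (a ∷ tail)
          g′≈ : ∀ x → eval g′ (x ^ p) ≈ eval (a ∷ tail) x
          g′≈ x = eval-contract (suc (length t)) (a ∷ tail) x periodic bound
          poly≈ : ∀ x → eval (a ∷ tail) x ≈ eval poly x
          poly≈ x = reflexive (≡.cong (λ f → eval f x) (≡.sym poly≡))
          module S = SeparablePower (separablePower A K⊆A n (z ^ p) g′
              (contract-over A (suc (length t)) (≡.subst (_over A) poly≡ poly∈))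
            (ℕ.≤-trans (ℕ.≤-reflexive (≡.trans (contract-length (suc (length t)) (a ∷ tail))
                (≡.cong length (≡.sym lower≡)))) degree≤n)
            (λ v → minimalPolynomial-nonvanishing m λ x → trans (sym (poly≈ x)) (trans (sym (g′≈ x)) (v (x ^ p))))
            (trans (g′≈ z) (trans (poly≈ z) (trans (eval-poly z) root))))
        multiple-root : SeparablePower A z
        -- The top coefficient of the derivative is `suc (length t)` times the leading coefficient
        -- 1, so this positive integer vanishes in `K̄`; the least such one is the characteristic.
        multiple-root = descend (least (λ k → suc k · 1# ≈ 0#) (length t)
          (trans (×-congʳ (suc (length t)) (reflexive (≡.sym (coeff-last t 1#)))) (multiples (length t))))
      by-separability : Dec (Separable poly) → SeparablePower A z
      by-separability (yes separable) = record
        { exponent = 1 ; additive = λ x y → trans (*-identityʳ _) (+-cong (sym (*-identityʳ x)) (sym (*-identityʳ y)))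
        ; poly = poly ; poly∈ = poly∈ ; root = trans (horner-cong poly refl (*-identityʳ z))
            (trans (eval-poly z) root) ; separable = separable }
      -- Inseparability is a negated statement, so a double root is available only inside a proof by
      -- contradiction.
      by-separability (no inseparable) = by-contradiction λ none → inseparable λ r g double → none
          (by-shape lower ≡.refl r g double)
        where
        by-shape : ∀ t → lower ≡ t → ∀ r g → (∀ x → eval poly x ≈ (x + - r) * ((x + - r) * eval g x)) → SeparablePower
            A z
        by-shape []      eq r g double = ⊥-elim (1≉0 (trans (reflexive (≡.cong (λ t → monic t z) (≡.sym eq))) root))
        by-shape (a ∷ t) eq r g double = multiple-root a t eq r g double

    -- Largest Galois subextensions

    -- Expressed by annihilating polynomials of any shape, so that passing from `A` to A J can be
    -- checked coordinate by coordinate.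
    Conjugate : Subfield → Carrier → Carrier → Set ℓ
    Conjugate A z z′ = ∀ g → g over A → eval g z ≈ 0# → eval g z′ ≈ 0#

    conjugation : ∀ A (K⊆A : K ⊆ A) z z′ → Conjugate A z z′ → ∀ zs →
      ∃[ τ ] Hom A (adjoinList A K⊆A (z ∷ zs)) τ × τ z ≈ z′
    conjugation A K⊆A z z′ conjugate zs = conclude (extend A (adjoin A K⊆A z) (K⊆adjoin A K⊆A z) (base⊆adjoin A K⊆A z)
        zs
        (extension-hom (hom-id A A) (λ x∈ → x∈) K⊆A z z′ compatible))
      where
      compatible : ∀ g → g over A → eval g z ≈ 0# → eval (map (λ x → x) g) z′ ≈ 0#
      compatible g g∈ e = trans (reflexive (≡.cong (λ f → eval f z′) (map-id g))) (conjugate g g∈ e)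
      σ = extension (hom-id A A) (λ x∈ → x∈) K⊆A z z′ compatible
      conclude : Extension A (adjoin A K⊆A z) (adjoinList A K⊆A (z ∷ zs)) σ → ∃[ τ ] Hom A (adjoinList A K⊆A (z ∷ zs))
          τ × τ z ≈ z′
      conclude (τ , τ-hom , agrees) = τ , τ-hom ,
        trans (agrees (generator∈ A K⊆A z)) (extension-generator (hom-id A A) (λ x∈ → x∈) K⊆A z z′ compatible)

    power-closed : ∀ F q {x} → x ∈ F → x ^ q ∈ F
    power-closed F zero    x∈ = 1-closed F
    power-closed F (suc q) x∈ = *-closed F x∈ (power-closed F q x∈)

    hom-power : ∀ {A F τ} → Hom A F τ → ∀ q {x} → x ∈ F → τ (x ^ q) ≈ τ x ^ q
    hom-power         hom zero    x∈ = 1-homo hom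
    hom-power {F = F} hom (suc q) x∈ = trans (Hom.*-homo hom x∈ (power-closed F q x∈)) (*-congˡ (hom-power hom q x∈))

    hom-combination : ∀ {A F τ} → A ⊆ F → Hom A F τ → ∀ {n} {c b : Vector Carrier n} → (∀ i → c i ∈ F) →
        (∀ i → b i ∈ A) →
      τ (combination c b) ≈ combination (λ i → τ (c i)) b
    hom-combination A⊆F hom {zero}  c∈ b∈ = 0-homo hom
    hom-combination {A} {F} {τ} A⊆F hom {suc n} {c} {b} c∈ b∈ = trans
      (+-homo (*-closed F (c∈ zero) (A⊆F (b∈ zero))) (combination-∈ F {c = λ i → c (suc i)} {b = λ i → b (suc i)}
          (λ i → c∈ (suc i)) (λ i → A⊆F (b∈ (suc i)))))
      (+-cong (trans (*-homo (c∈ zero) (A⊆F (b∈ zero))) (*-congˡ (fixes (b∈ zero))))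
              (hom-combination A⊆F hom {c = λ i → c (suc i)} {b = λ i → b (suc i)} (λ i → c∈ (suc i))
                  (λ i → b∈ (suc i))))
      where open Hom hom

    PowerIn : Subfield → Carrier → Set ℓ
    PowerIn B e = ∃[ q ] Additive q × e ^ q ∈ B

    module _ (A L B : Subfield) (K⊆A : K ⊆ A) (A⊆L : A ⊆ L) (L-finite : IsFinite K L)
        (isLargest : IsLargestGaloisSubextension A L B) where

      -- Adjoining all roots of the separable minimal polynomial of `z` to `A` gives a Galois
      -- extension inside `L`, hence inside `B`.
      separable-conjugates∈ : ∀ {z} (m : MinimalPolynomial A z) → Separable (MinimalPolynomial.poly m) →
        (∀ {r} → monic (MinimalPolynomial.lower m) r ≈ 0# → r ∈ L) → z ∈ B
      separable-conjugates∈ {z} m separable roots∈L =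
          IsLargestGaloisSubextension.largest isLargest B₀ B₀⊆L galois (any-∈ B₀ roots∈ (root⇒any root))
        where
        open MinimalPolynomial m
        B₀ = adjoinList A K⊆A roots
        A⊆B₀ : A ⊆ B₀
        A⊆B₀ = base⊆adjoinList A K⊆A roots
        roots∈ : All (_∈ B₀) roots
        roots∈ = generators∈ A K⊆A roots
        galoisian : All (Galoisian A B₀) roots
        galoisian = tabulate-any roots λ i → record
          { poly = poly ; poly∈ = poly∈ ; root = trans (eval-poly _) (any⇒root i) ; separable = separable
          ; roots∈ = λ e → any-∈ B₀ roots∈ (root⇒any (trans (sym (eval-poly _)) e)) }
        B₀⊆L : B₀ ⊆ L
        B₀⊆L = adjoinList-least A K⊆A roots (subfield-isSubring L) A⊆L (tabulate-any roots λ i → roots∈L (any⇒root i))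
        galois : IsGalois A B₀
        galois = fixed⇒galois A B₀ A K⊆A A⊆B₀ K⊆A (finite-intermediate A B₀ L L-finite K⊆A A⊆B₀ B₀⊆L)
          (generated-fixed A B₀ K⊆A A⊆B₀ roots (λ x∈ → x∈) roots∈ galoisian)

      conjugates∈⇒power∈ : ∀ {e} → (∀ e′ → Conjugate A e e′ → e′ ∈ L) → PowerIn B e
      conjugates∈⇒power∈ {e} conjugates∈ = from-power (separablePower′ (algebraic-over A K⊆A e))
        where
        separablePower′ : AlgebraicOver A e → SeparablePower A e
        separablePower′ (f , f∈ , f≢0 , e-root) = separablePower A K⊆A (length f) e f f∈ ℕ.≤-refl
            (nonzero⇒nonvanishing f f≢0) e-root
        from-power : SeparablePower A e → PowerIn B e
        from-power P = q , P.additive , separable-conjugates∈ m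
            (separable-factor P.poly (proj₁ factor) poly
                (λ x → trans (proj₂ (proj₂ factor) x) (*-congˡ (sym (eval-poly x)))) P.separable)
            roots∈L
          where
          module P = SeparablePower P
          q = P.exponent
          z = e ^ q
          m = minimalPolynomial A K⊆A z
          open MinimalPolynomial m
          factor : ∃[ h ] h over A × (∀ x → eval P.poly x ≈ eval h x * monic lower x)
          factor = divides m P.poly P.poly∈ P.root
          roots∈L : ∀ {r} → monic lower r ≈ 0# → r ∈ L
          -- A conjugate r of z = e^q is the q-th power of a conjugate of `e`: some homomorphism τ
          -- over `A`, defined at `e` as well, sends z to r; then r = τ(e)^q with τ(e) in `L`.
          roots∈L {r} mr≈0 = image (conjugation A K⊆A z r conjugate (e ∷ []))
            where
            conjugate : Conjugate A z r
            conjugate g g∈ gz≈0 = let h , _ , g≈hm = divides m g g∈ gz≈0 in trans (g≈hm r) (trans (*-congˡ mr≈0) (zeroʳ _))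
            F = adjoinList A K⊆A (z ∷ e ∷ [])
            e∈F : e ∈ F
            e∈F = All.head (All.tail (generators∈ A K⊆A (z ∷ e ∷ [])))
            image : ∃[ τ ] Hom A F τ × τ z ≈ r → r ∈ L
            image (τ , hom , τz≈r) = respects L (trans (sym (hom-power hom q e∈F)) τz≈r)
              (power-closed L q (conjugates∈ (τ e) λ g g∈ ge≈0 → hom-root hom (base⊆adjoinList A K⊆A (z ∷ e ∷ [])) g∈
                  e∈F ge≈0))

    -- The exponents are multiplied: a product of additive exponents is additive, and further powers
    -- stay in `B`.
    common-exponent : ∀ B {n} (e : Vector Carrier n) → (∀ j → PowerIn B (e j)) → ∃[ q ] Additive q ×
        (∀ j → e j ^ q ∈ B)
    common-exponent B {zero}  e powers = 1 , (λ x y → trans (*-identityʳ _)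
        (+-cong (sym (*-identityʳ x)) (sym (*-identityʳ y)))) , λ ()
    common-exponent B {suc n} e powers =
      let q , q-additive , e₀∈ = powers zero
          q′ , q′-additive , e∈ = common-exponent B (λ j → e (suc j)) (λ j → powers (suc j))
      in q ℕ.* q′ , additive-* q q′ q-additive q′-additive , λ
        { zero    → respects B (^-assocʳ (e zero) q q′) (power-closed B q′ e₀∈)
        ; (suc j) → respects B (trans (^-assocʳ (e (suc j)) q′ q) (reflexive (≡.cong (e (suc j) ^_) (ℕ.*-comm q′ q))))
            (power-closed B q (e∈ j)) }

    additive-sum : ∀ q → Additive q → ∀ {n} (f : Vector Carrier n) → sum f ^ q ≈ sum (λ i → f i ^ q)
    additive-sum q additive {zero}  f = +-cancel (trans (sym (additive 0# 0#))
        (trans (^-congˡ q (+-identityˡ 0#)) (sym (+-identityˡ _))))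
    additive-sum q additive {suc n} f = trans (additive (f zero) _)
        (+-congˡ (additive-sum q additive (λ i → f (suc i))))

    X^ : ℕ → Poly
    X^ zero    = 1# ∷ []
    X^ (suc q) = 0# ∷ X^ q

    eval-X^ : ∀ q x → eval (X^ q) x ≈ x ^ q
    eval-X^ zero    x = eval-constant 1# x
    eval-X^ (suc q) x = trans (+-identityˡ _) (*-congˡ (eval-X^ q x))

    X^-over : ∀ F q → X^ q over F
    X^-over F zero    = 1-closed F ∷ []
    X^-over F (suc q) = 0-closed F ∷ X^-over F q

    -- The minimal polynomial of y divides X^q − y^q = (X − y)^q and is separable, so it is X − y.
    separable-power∈ : ∀ F E → K ⊆ F → ∀ {y} → Galoisian F E y → ∀ q → Additive q → y ^ q ∈ F → y ∈ F
    separable-power∈ F E K⊆F {y} galoisian q additive yq∈ = by-roots lower lower∈ roots roots-length distinct factors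
        root-unique root
      where
      m = minimalPolynomial F K⊆F y
      open MinimalPolynomial m
      distinct = separable⇒distinct roots poly (λ x → trans (eval-poly x) (factors x))
          (galoisian-minimalPolynomial galoisian m)
      g = X^ q +ₚ (- (y ^ q) ∷ [])
      eval-g : ∀ x → eval g x ≈ x ^ q + - (y ^ q)
      eval-g x = trans (eval-+ₚ (X^ q) (- (y ^ q) ∷ []) x) (+-cong (eval-X^ q x) (eval-constant (- (y ^ q)) x))
      factor : ∃[ h ] h over F × (∀ x → eval g x ≈ eval h x * monic lower x)
      factor = divides m g (+ₚ-over F (X^-over F q) (neg-closed F yq∈ ∷ [])) (trans (eval-g y) (-‿inverseʳ _))
      root-unique : ∀ {r} → monic lower r ≈ 0# → r ≈ y
      root-unique {r} mr≈0 = additive-injective q additive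
          (-≈0⇒≈ (trans (sym (eval-g r)) (trans (proj₂ (proj₂ factor) r) (trans (*-congˡ mr≈0) (zeroʳ _)))))
      by-roots : ∀ t → t over F → ∀ rs → length rs ≡ length t → Distinct rs → (∀ x → monic t x ≈ linears rs x) →
        (∀ {r} → monic t r ≈ 0# → r ≈ y) → monic t y ≈ 0# → y ∈ F
      by-roots []      t∈          rs           l d t≈ unique ty≈0 = ⊥-elim (1≉0 ty≈0)
      by-roots (a ∷ []) (a∈ ∷ []) rs           l d t≈ unique ty≈0 = respects F (sym (-≈0⇒≈ (trans
        (trans (+-cong (sym (*-identityʳ y)) (-‿involutive a)) (+-comm _ a)) ty≈0))) (neg-closed F a∈)
      by-roots (a ∷ b ∷ t) t∈ (r ∷ s ∷ rs) l ((r≉s ∷ _) ∷ _) t≈ unique ty≈0 =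
        ⊥-elim (r≉s (trans (unique (trans (t≈ r) (linears-root (r ∷ s ∷ rs) (here refl))))
            (sym (unique (trans (t≈ s) (linears-root (r ∷ s ∷ rs) (there (here refl))))))))

    module _ (L L̃ J : Subfield) (disjoint : Disjoint L L̃ J) where
      open Disjoint disjoint
      private
        K⊆L = IsFinite.base⊆ L-finite
        K⊆J = IsFinite.base⊆ J-finite
        n = proj₁ (IsFinite.degree J-finite)
        b : Vector Carrier n
        b = proj₁ (proj₂ (IsFinite.degree J-finite))
        basis = proj₂ (proj₂ (IsFinite.degree J-finite))
        b-independent : LinearlyIndependent L̃ b
        b-independent = independent b (IsBasis.members basis) (IsBasis.independent basis)

      module _ (A B : Subfield) (K⊆A : K ⊆ A) (A⊆L : A ⊆ L) (isLargest : IsLargestGaloisSubextension A L B) where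
        private
          AJ = A ∙ J
          LJ = L ∙ J
          K⊆AJ : K ⊆ AJ
          K⊆AJ x∈ = ⊆-compositumˡ A J (K⊆A x∈)
          AJ⊆LJ : AJ ⊆ LJ
          AJ⊆LJ = compositum-mono A J L J A⊆L (λ x∈ → x∈)

        Coordinates : Poly → Set ℓ
        Coordinates g = ∃ λ (G : Fin n → Poly) → (∀ j → G j over A) ×
            (∀ x → eval g x ≈ combination (λ j → eval (G j) x) b)

        cons-coordinates : ∀ {a g} → Span A b a → Coordinates g → Coordinates (a ∷ g)
        cons-coordinates (a , a∈ , e) (G , G∈ , e′) = (λ j → a j ∷ G j) , (λ j → a∈ j ∷ G∈ j) , λ x →
          trans (+-cong e (trans (*-congˡ (e′ x)) (sym (combination-scale x (λ j → eval (G j) x) b))))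
                (sym (combination-distrib-+ a (λ j → x * eval (G j) x) b))

        coordinates : ∀ {g} → g over AJ → Coordinates g
        coordinates []         = (λ _ → []) , (λ _ → []) , λ x → sym (combination-zero b λ _ → refl)
        coordinates {a ∷ g} (a∈ ∷ g∈) = cons-coordinates {a} {g} (compositum⊆span A K J K⊆A K⊆A K⊆J basis a∈)
            (coordinates g∈)

        -- A polynomial over A J annihilating `e` splits into coordinates over `A` along the basis
        -- `b` of J. Their values at `e` lie in `L̃`, over which `b` is independent, so each
        -- coordinate annihilates `e` and therefore `e′`.
        conjugate-compositum : ∀ {e e′} → e ∈ L → Conjugate A e e′ → Conjugate AJ e e′
        conjugate-compositum {e} {e′} e∈ conjugate g g∈ ge≈0 = from-coordinates (coordinates g∈)
          where
          from-coordinates : Coordinates g → eval g e′ ≈ 0#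
          from-coordinates (G , G∈ , g≈) = trans (g≈ e′) (combination-zero b λ j → conjugate (G j) (G∈ j) (zeros j))
            where
            zeros : ∀ j → eval (G j) e ≈ 0#
            zeros = b-independent (λ j → eval (G j) e)
                (λ j → L⊆L̃ (horner-closed L (0-closed L) (over-⊆ A L A⊆L (G∈ j)) e∈)) (trans (sym (g≈ e)) ge≈0)

        -- Some τ over A J sends eⱼ to e′. Being a conjugate of y, τ y lies in L J and has
        -- coordinates in `L`; it also has the coordinates τ eᵢ, which lie in `L̃`. Independence of
        -- `b` over `L̃` identifies the two, so e′ = τ eⱼ is in `L`.
        coordinate-conjugates : ∀ {y} → Galoisian AJ LJ y → ∀ (e : Vector Carrier n) → (∀ j → e j ∈ L) → y ≈
            combination e b →
          ∀ j e′ → Conjugate A (e j) e′ → e′ ∈ L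
        coordinate-conjugates {y} galoisian e e∈ y≈ j e′ conjugate =
            from-hom (conjugation AJ K⊆AJ (e j) e′ (conjugate-compositum (e∈ j) conjugate) zs)
          where
          L-basis = proj₂ (proj₂ (IsFinite.degree L-finite))
          -- A K-basis of `L`, adjoined so that τ is defined on all of L J.
          zs = tabulate (proj₁ (proj₂ (IsFinite.degree L-finite)))
          F = adjoinList AJ K⊆AJ (e j ∷ zs)
          AJ⊆F : AJ ⊆ F
          AJ⊆F = base⊆adjoinList AJ K⊆AJ (e j ∷ zs)
          LJ⊆F : LJ ⊆ F
          LJ⊆F = compositum-least L J F
            (spanned⊆ K L F (λ x∈ → AJ⊆F (K⊆AJ x∈)) L-basis
                (All.tabulate⁻ (All.tail (generators∈ AJ K⊆AJ (e j ∷ zs)))))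
            (λ x∈ → AJ⊆F (⊆-compositumʳ A J x∈))
          y∈ : y ∈ LJ
          y∈ = Galoisian.roots∈ galoisian (Galoisian.root galoisian)
          e∈LJ : ∀ i → e i ∈ LJ
          e∈LJ i = ⊆-compositumˡ L J (e∈ i)
          from-hom : ∃[ τ ] Hom AJ F τ × τ (e j) ≈ e′ → e′ ∈ L
          from-hom (τ , hom-F , τe≈e′) = respects L (trans (-≈0⇒≈ (difference j)) τe≈e′) (c∈ j)
            where
            hom : Hom AJ LJ τ
            hom = hom-restrict AJ AJ LJ F (λ x∈ → x∈) LJ⊆F hom-F
            τy∈ : τ y ∈ LJ
            τy∈ = Galoisian.roots∈ galoisian (hom-root hom AJ⊆LJ (Galoisian.poly∈ galoisian) y∈
                (Galoisian.root galoisian))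
            τy-span : Span L b (τ y)
            τy-span = compositum⊆span L K J K⊆L K⊆L K⊆J basis τy∈
            c = proj₁ τy-span
            c∈ = proj₁ (proj₂ τy-span)
            τe∈ : ∀ i → τ (e i) ∈ L̃
            τe∈ i = conjugate∈ L L̃ J disjoint LJ (λ x∈ → AJ⊆LJ (K⊆AJ x∈))
                (hom-restrict K AJ LJ LJ K⊆AJ (λ x∈ → x∈) hom) (e∈LJ i) (L⊆L̃ (e∈ i))
            τy≈ : τ y ≈ combination (λ i → τ (e i)) b
            τy≈ = trans (Hom.cong hom y∈ y≈) (hom-combination {AJ} {LJ} AJ⊆LJ hom {c = e} {b = b} e∈LJ
                (λ i → ⊆-compositumʳ A J (IsBasis.members basis i)))
            difference : ∀ i → c i + - τ (e i) ≈ 0#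
            difference = b-independent (λ i → c i + - τ (e i))
                (λ i → +-closed L̃ (L⊆L̃ (c∈ i)) (neg-closed L̃ (τe∈ i))) (begin
              combination (λ i → c i + - τ (e i)) b
                ≈⟨ combination-distrib-+ c (λ i → - τ (e i)) b ⟩
              combination c b + combination (λ i → - τ (e i)) b
                ≈⟨ +-cong (sym (proj₂ (proj₂ τy-span))) (trans (combination-neg (λ i → τ (e i)) b) (-‿cong (sym τy≈)))
                ⟩
              τ y + - τ y                                               ≈⟨ -‿inverseʳ _ ⟩
              0#                                                        ∎)

        galoisian∈compositum : ∀ {y} → Galoisian AJ LJ y → y ∈ B ∙ J
        galoisian∈compositum {y} galoisian = from-exponent (common-exponent B e λ j →
            conjugates∈⇒power∈ A L B K⊆A A⊆L L-finite isLargest (coordinate-conjugates galoisian e e∈ y≈ j))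
          where
          A⊆B : A ⊆ B
          A⊆B = IsFinite.base⊆ (IsGalois.finite (IsLargestGaloisSubextension.galois isLargest))
          y-span : Span L b y
          y-span = compositum⊆span L K J K⊆L K⊆L K⊆J basis (Galoisian.roots∈ galoisian (Galoisian.root galoisian))
          e = proj₁ y-span
          e∈ = proj₁ (proj₂ y-span)
          y≈ = proj₂ (proj₂ y-span)
          from-exponent : ∃[ q ] Additive q × (∀ j → e j ^ q ∈ B) → y ∈ B ∙ J
          from-exponent (q , additive , eq∈) = separable-power∈ (B ∙ J) LJ (λ x∈ → ⊆-compositumʳ B J (K⊆J x∈))
            (galoisian-mono AJ (B ∙ J) LJ LJ (compositum-mono A J B J A⊆B (λ x∈ → x∈)) (λ x∈ → x∈) galoisian) q
                additive
            (respects (B ∙ J) (sym (trans (^-congˡ q y≈)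
                (trans (additive-sum q additive (λ i → e i * b i)) (sum-cong-≋ {n} λ i → ^-distrib-* (e i) (b i) q))))
              (combination-∈ (B ∙ J) (λ i → ⊆-compositumˡ B J (eq∈ i))
                  (λ i → ⊆-compositumʳ B J (power-closed J q (IsBasis.members basis i)))))

    module _ (L L̃ J J̃ : Subfield) (disjoint : Disjoint L L̃ J) (disjoint′ : Disjoint J J̃ L) where
      private
        L-finite = Disjoint.L-finite disjoint
        J-finite = Disjoint.J-finite disjoint
        K⊆L = IsFinite.base⊆ L-finite
        K⊆J = IsFinite.base⊆ J-finite

      -- `intersect-span` applied to a B′-basis β of J, which spans (B B′) J over B B′. It stays
      -- independent over L B′: the coefficients of a relation are expanded in a K-basis of `L` with
      -- coefficients in B′; that basis is independent over `J̃`, which leaves relations among the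
      -- βⱼ over B′.
      intersect-composita : ∀ B B′ → K ⊆ B → B ⊆ L → K ⊆ B′ → B′ ⊆ J → ∀ {y} → y ∈ B ∙ J → y ∈ L ∙ B′ → y ∈ B ∙ B′
      intersect-composita B B′ K⊆B B⊆L K⊆B′ B′⊆J y∈BJ y∈LB′ =
          intersect-span (B ∙ B′) (L ∙ B′) β β-independent (compositum-mono B B′ L B′ B⊆L (λ x∈ → x∈))
            (span (⊆-compositumʳ (B ∙ B′) J (1-closed J))) y∈LB′
                (span (compositum-mono B J (B ∙ B′) J (⊆-compositumˡ B B′) (λ x∈ → x∈) y∈BJ))
        where
        degree = IsFinite.degree (finite-intermediate B′ J J J-finite K⊆B′ B′⊆J (λ x∈ → x∈))
        n = proj₁ degree
        β : Vector Carrier n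
        β = proj₁ (proj₂ degree)
        β-basis = proj₂ (proj₂ degree)
        span : ∀ {x} → x ∈ B ∙ B′ ∙ J → Span (B ∙ B′) β x
        span = compositum⊆span (B ∙ B′) B′ J (λ x∈ → ⊆-compositumˡ B B′ (K⊆B x∈)) (⊆-compositumʳ B B′) K⊆J β-basis
        a = proj₁ (proj₂ (IsFinite.degree L-finite))
        a-basis = proj₂ (proj₂ (IsFinite.degree L-finite))
        β-independent : LinearlyIndependent (L ∙ B′) β
        β-independent c c∈ e j = trans (proj₂ (proj₂ (k-span j))) (combination-zero a λ i → zeros i j)
          where
          k-span : ∀ j → Span B′ a (c j)
          k-span j = compositum⊆span B′ K L K⊆B′ K⊆B′ K⊆L a-basis (compositum-comm L B′ (c∈ j))
          k = λ j → proj₁ (k-span j)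
          k∈ : ∀ j i → k j i ∈ B′
          k∈ j = proj₁ (proj₂ (k-span j))
          inner : ∀ i → sum (λ j → β j * k j i) ≈ 0#
          inner = Disjoint.independent disjoint′ a (IsBasis.members a-basis) (IsBasis.independent a-basis)
              (λ i → sum (λ j → β j * k j i))
            (λ i → Disjoint.L⊆L̃ disjoint′ (sum-∈ J λ j → *-closed J (IsBasis.members β-basis j) (B′⊆J (k∈ j i))))
                (begin
            combination (λ i → sum (λ j → β j * k j i)) a ≈⟨ combination-combination β k a ⟨
            combination β (λ j → combination (k j) a)
              ≈⟨ (sum-cong-≋ {n} λ j → trans (*-comm _ _) (*-congʳ (sym (proj₂ (proj₂ (k-span j)))))) ⟩
            combination c β                               ≈⟨ e ⟩
            0#                                            ∎)
          zeros : ∀ i j → k j i ≈ 0#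
          zeros i = IsBasis.independent β-basis (λ j → k j i) (λ j → k∈ j i)
              (trans (sum-cong-≋ {n} λ j → *-comm (k j i) (β j)) (inner i))

      compositum-largest : ∀ M A B A′ B′ → M ≐ L ∙ J → IsFinite K M → K ⊆ A → A ⊆ L → K ⊆ A′ → A′ ⊆ J →
        IsLargestGaloisSubextension A L B → IsLargestGaloisSubextension A′ J B′ → IsLargestGaloisSubextension (A ∙ A′)
            M (B ∙ B′)
      compositum-largest M A B A′ B′ (M⊆LJ , LJ⊆M) M-finite K⊆A A⊆L K⊆A′ A′⊆J isLargest isLargest′ = record
          { ⊆top = BB′⊆M
          ; galois = compositum-galois A B A′ B′ K⊆A K⊆A′ G.galois G′.galois
              (finite-intermediate (A ∙ A′) (B ∙ B′) M M-finite K⊆AA′ (compositum-mono A A′ B B′ A⊆B A′⊆B′) BB′⊆M)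
          ; largest = λ D D⊆M galois {y} y∈ →
              let galoisian = galois⇒galoisian (A ∙ A′) D K⊆AA′ galois y∈
              in intersect-composita B B′ (λ x∈ → A⊆B (K⊆A x∈)) G.⊆top (λ x∈ → A′⊆B′ (K⊆A′ x∈)) G′.⊆top
                   (galoisian∈compositum L L̃ J disjoint A B K⊆A A⊆L isLargest
                     (galoisian-mono (A ∙ A′) (A ∙ J) D (L ∙ J) (compositum-mono A A′ A J (λ x∈ → x∈) A′⊆J)
                         (λ x∈ → M⊆LJ (D⊆M x∈)) galoisian))
                   (compositum-comm B′ L (galoisian∈compositum J J̃ L disjoint′ A′ B′ K⊆A′ A′⊆J isLargest′
                     (galoisian-mono (A ∙ A′) (A′ ∙ L) D (J ∙ L)
                         (λ x∈ → compositum-comm L A′ (compositum-mono A A′ L A′ A⊆L (λ z∈ → z∈) x∈))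
                       (λ x∈ → compositum-comm L J (M⊆LJ (D⊆M x∈))) galoisian))) }
        where
        module G = IsLargestGaloisSubextension isLargest
        module G′ = IsLargestGaloisSubextension isLargest′
        A⊆B : A ⊆ B
        A⊆B = IsFinite.base⊆ (IsGalois.finite G.galois)
        A′⊆B′ : A′ ⊆ B′
        A′⊆B′ = IsFinite.base⊆ (IsGalois.finite G′.galois)
        K⊆AA′ : K ⊆ A ∙ A′
        K⊆AA′ x∈ = ⊆-compositumˡ A A′ (K⊆A x∈)
        BB′⊆M : B ∙ B′ ⊆ M
        BB′⊆M x∈ = LJ⊆M (compositum-mono B B′ L J G.⊆top G′.⊆top x∈)

    -- Chains

    -- Members may repeat, so that a chain can be padded to the length of another one.
    record WeakDescendingChain (E : Subfield) (k : ℕ) (N : ℕ → Subfield) : Set (Level.suc ℓ) where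
      field
        start  : N 0 ≐ E
        ⊆top   : ∀ i → i ≤ k → N i ⊆ E
        base⊆  : ∀ i → i ≤ k → K ⊆ N i
        step   : ∀ i → i < k → IsMaximalGaloisBase K (N i) (N (suc i))
        stable : IsMaximalGaloisBase K (N k) (N k)

    record WeakAscendingChain (E : Subfield) (l : ℕ) (F : ℕ → Subfield) : Set (Level.suc ℓ) where
      field
        start  : F 0 ≐ K
        ⊆top   : ∀ j → j ≤ l → F j ⊆ E
        base⊆  : ∀ j → j ≤ l → K ⊆ F j
        step   : ∀ j → j < l → IsLargestGaloisSubextension (F j) E (F (suc j))
        stable : IsLargestGaloisSubextension (F l) E (F l)

    maximalBase⊆ : ∀ E N → IsMaximalGaloisBase K E N → N ⊆ E
    maximalBase⊆ E N isMaximal = IsFinite.base⊆ (IsGalois.finite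
        (HasMaximalGaloisDegree.galois (IsMaximalGaloisBase.hasMaximalDegree isMaximal)))

    largest⊇ : ∀ A E F → IsLargestGaloisSubextension A E F → A ⊆ F
    largest⊇ A E F isLargest = IsFinite.base⊆ (IsGalois.finite (IsLargestGaloisSubextension.galois isLargest))

    weakenDescending : ∀ E k N → K ⊆ E → IsDescendingChain K E k N → WeakDescendingChain E k N
    weakenDescending E k N K⊆E chain = record { start = start ; ⊆top = ⊆top ; base⊆ = base⊆ ; step = step ; stable =
        stable }
      where
      open IsDescendingChain chain
      ⊆top : ∀ i → i ≤ k → N i ⊆ E
      ⊆top zero    _   = proj₁ start
      ⊆top (suc i) i<k = λ x∈ → ⊆top i (ℕ.<⇒≤ i<k) (maximalBase⊆ (N i) (N (suc i)) (step i i<k) x∈)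
      base⊆ : ∀ i → i ≤ k → K ⊆ N i
      base⊆ zero    _   = λ x∈ → proj₂ start (K⊆E x∈)
      base⊆ (suc i) i<k = HasMaximalGaloisDegree.base⊆ (IsMaximalGaloisBase.hasMaximalDegree (step i i<k))

    weakenAscending : ∀ E l F → K ⊆ E → IsAscendingChain K E l F → WeakAscendingChain E l F
    weakenAscending E l F K⊆E chain = record { start = start ; ⊆top = ⊆top ; base⊆ = base⊆ ; step = step ; stable =
        stable }
      where
      open IsAscendingChain chain
      ⊆top : ∀ j → j ≤ l → F j ⊆ E
      ⊆top zero    _   = λ x∈ → K⊆E (proj₁ start x∈)
      ⊆top (suc j) j<l = IsLargestGaloisSubextension.⊆top (step j j<l)
      base⊆ : ∀ j → j ≤ l → K ⊆ F j
      base⊆ zero    _   = proj₂ start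
      base⊆ (suc j) j<l = λ x∈ → largest⊇ (F j) E (F (suc j)) (step j j<l) (base⊆ j (ℕ.<⇒≤ j<l) x∈)

    module _ (R : Subfield → Subfield → Set (Level.suc ℓ)) (k : ℕ) (N : ℕ → Subfield)
             (step : ∀ i → i < k → R (N i) (N (suc i))) (stable : R (N k) (N k)) where

      -- Up to k nothing changes; from k on both members are `N k`, and the required step is
      -- `stable`.
      pad-step : ∀ i → R (N (i ⊓ k)) (N (suc i ⊓ k))
      pad-step i with i ℕ.<? k
      ... | yes i<k = ≡.subst₂ (λ a b → R (N a) (N b)) (≡.sym (ℕ.m≤n⇒m⊓n≡m (ℕ.<⇒≤ i<k))) (≡.sym (ℕ.m≤n⇒m⊓n≡m i<k))
          (step i i<k)
      ... | no  i≮k = ≡.subst₂ (λ a b → R (N a) (N b)) (≡.sym (ℕ.m≥n⇒m⊓n≡n (ℕ.≮⇒≥ i≮k)))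
                        (≡.sym (ℕ.m≥n⇒m⊓n≡n (ℕ.≤-trans (ℕ.≮⇒≥ i≮k) (ℕ.n≤1+n i)))) stable

      pad-stable : ∀ m → k ≤ m → R (N (m ⊓ k)) (N (m ⊓ k))
      pad-stable m k≤m = ≡.subst (λ a → R (N a) (N a)) (≡.sym (ℕ.m≥n⇒m⊓n≡n k≤m)) stable

    padDescending : ∀ E k m N → k ≤ m → WeakDescendingChain E k N → WeakDescendingChain E m (λ i → N (i ⊓ k))
    padDescending E k m N k≤m chain = record
      { start = start ; ⊆top = λ i _ → ⊆top (i ⊓ k) (ℕ.m⊓n≤n i k) ; base⊆ = λ i _ → base⊆ (i ⊓ k) (ℕ.m⊓n≤n i k)
      ; step = λ i _ → pad-step (IsMaximalGaloisBase K) k N step stable i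
      ; stable = pad-stable (IsMaximalGaloisBase K) k N step stable m k≤m }
      where open WeakDescendingChain chain

    padAscending : ∀ E l m F → l ≤ m → WeakAscendingChain E l F → WeakAscendingChain E m (λ j → F (j ⊓ l))
    padAscending E l m F l≤m chain = record
      { start = start ; ⊆top = λ j _ → ⊆top (j ⊓ l) (ℕ.m⊓n≤n j l) ; base⊆ = λ j _ → base⊆ (j ⊓ l) (ℕ.m⊓n≤n j l)
      ; step = λ j _ → pad-step (λ A F → IsLargestGaloisSubextension A E F) l F step stable j
      ; stable = pad-stable (λ A F → IsLargestGaloisSubextension A E F) l F step stable m l≤m }
      where open WeakAscendingChain chain

    -- Composita of chains

    module _ (L L̃ J J̃ M : Subfield) (disjoint : Disjoint L L̃ J) (disjoint′ : Disjoint J J̃ L)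
             (M-finite : IsFinite K M) (M≐LJ : M ≐ L ∙ J) where

      compositum-strict : ∀ A A′ B B′ → K ⊆ A → A ⊆ B → B ⊆ L → K ⊆ A′ → A′ ⊆ B′ → B′ ⊆ J → (¬ B ⊆ A) ⊎ (¬ B′ ⊆ A′) →
          ¬ B ∙ B′ ⊆ A ∙ A′
      compositum-strict A A′ B B′ K⊆A A⊆B B⊆L K⊆A′ A′⊆B′ B′⊆J (inj₁ B⊈A) =
        strict-compositum L L̃ J disjoint A A′ B B′ K⊆A A⊆B B⊆L (λ x∈ → B′⊆J (A′⊆B′ x∈)) B⊈A
      compositum-strict A A′ B B′ K⊆A A⊆B B⊆L K⊆A′ A′⊆B′ B′⊆J (inj₂ B′⊈A′) BB′⊆AA′ =
        strict-compositum J J̃ L disjoint′ A′ A B′ B K⊆A′ A′⊆B′ B′⊆J (λ x∈ → B⊆L (A⊆B x∈)) B′⊈A′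
          (λ x∈ → compositum-comm A A′ (BB′⊆AA′ (compositum-comm B′ B x∈)))

      -- By `compositum-strict` it suffices that one factor changes at each index, so the
      -- repetitions in a padded chain are harmless while the longer chain still moves.
      descendingCompositum : ∀ k N N′ → WeakDescendingChain L k N → WeakDescendingChain J k N′ →
        (∀ i → i < k → (¬ N i ⊆ N (suc i)) ⊎ (¬ N′ i ⊆ N′ (suc i))) → IsDescendingChain K M k (λ i → N i ∙ N′ i)
      descendingCompositum k N N′ chain chain′ strict = record
        { start = (λ x∈ → proj₂ M≐LJ (compositum-mono (N 0) (N′ 0) L J (proj₁ C.start) (proj₁ C′.start) x∈)) ,
                  (λ x∈ → compositum-mono L J (N 0) (N′ 0) (proj₂ C.start) (proj₂ C′.start) (proj₁ M≐LJ x∈))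
        ; strict = λ i i<k → compositum-mono (N (suc i)) (N′ (suc i)) (N i) (N′ i) (decreasing i i<k)
            (decreasing′ i i<k) ,
            compositum-strict (N (suc i)) (N′ (suc i)) (N i) (N′ i) (C.base⊆ (suc i) i<k) (decreasing i i<k)
                (C.⊆top i (ℕ.<⇒≤ i<k))
              (C′.base⊆ (suc i) i<k) (decreasing′ i i<k) (C′.⊆top i (ℕ.<⇒≤ i<k)) (strict i i<k)
        ; step = λ i i<k → maximalBase i (suc i) (ℕ.<⇒≤ i<k) (C.step i i<k) (C′.step i i<k)
        ; stable = maximalBase k k ℕ.≤-refl C.stable C′.stable }
        where
        module C = WeakDescendingChain chain
        module C′ = WeakDescendingChain chain′
        decreasing : ∀ i → i < k → N (suc i) ⊆ N i
        decreasing i i<k = maximalBase⊆ (N i) (N (suc i)) (C.step i i<k)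
        decreasing′ : ∀ i → i < k → N′ (suc i) ⊆ N′ i
        decreasing′ i i<k = maximalBase⊆ (N′ i) (N′ (suc i)) (C′.step i i<k)
        maximalBase : ∀ i j → i ≤ k → IsMaximalGaloisBase K (N i) (N j) → IsMaximalGaloisBase K (N′ i) (N′ j) →
            IsMaximalGaloisBase K (N i ∙ N′ i) (N j ∙ N′ j)
        maximalBase i j i≤k = compositum-maximalBase L L̃ J J̃ disjoint disjoint′ (N i) (N j) (N′ i) (N′ j)
          (finite-intermediate K (N i ∙ N′ i) M M-finite (λ x∈ → x∈)
              (λ x∈ → ⊆-compositumˡ (N i) (N′ i) (C.base⊆ i i≤k x∈))
            (λ x∈ → proj₂ M≐LJ (compositum-mono (N i) (N′ i) L J (C.⊆top i i≤k) (C′.⊆top i i≤k) x∈)))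
          (C.base⊆ i i≤k) (C.⊆top i i≤k) (C′.base⊆ i i≤k) (C′.⊆top i i≤k)

      ascendingCompositum : ∀ l F F′ → WeakAscendingChain L l F → WeakAscendingChain J l F′ →
        (∀ j → j < l → (¬ F (suc j) ⊆ F j) ⊎ (¬ F′ (suc j) ⊆ F′ j)) → IsAscendingChain K M l (λ j → F j ∙ F′ j)
      ascendingCompositum l F F′ chain chain′ strict = record
        { start = compositum-least (F 0) (F′ 0) K (proj₁ C.start) (proj₁ C′.start) , λ x∈ → ⊆-compositumˡ (F 0) (F′ 0)
            (proj₂ C.start x∈)
        ; strict = λ j j<l → compositum-mono (F j) (F′ j) (F (suc j)) (F′ (suc j)) (increasing j j<l)
            (increasing′ j j<l) ,
            compositum-strict (F j) (F′ j) (F (suc j)) (F′ (suc j)) (C.base⊆ j (ℕ.<⇒≤ j<l)) (increasing j j<l)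
                (C.⊆top (suc j) j<l)
              (C′.base⊆ j (ℕ.<⇒≤ j<l)) (increasing′ j j<l) (C′.⊆top (suc j) j<l) (strict j j<l)
        ; step = λ j j<l → largest j (suc j) (ℕ.<⇒≤ j<l) (C.step j j<l) (C′.step j j<l)
        ; stable = largest l l ℕ.≤-refl C.stable C′.stable }
        where
        module C = WeakAscendingChain chain
        module C′ = WeakAscendingChain chain′
        increasing : ∀ j → j < l → F j ⊆ F (suc j)
        increasing j j<l = largest⊇ (F j) L (F (suc j)) (C.step j j<l)
        increasing′ : ∀ j → j < l → F′ j ⊆ F′ (suc j)
        increasing′ j j<l = largest⊇ (F′ j) J (F′ (suc j)) (C′.step j j<l)
        largest : ∀ i j → i ≤ l → IsLargestGaloisSubextension (F i) L (F j) → IsLargestGaloisSubextension (F′ i) J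
            (F′ j) →
          IsLargestGaloisSubextension (F i ∙ F′ i) M (F j ∙ F′ j)
        largest i j i≤l = compositum-largest L L̃ J J̃ disjoint disjoint′ M (F i) (F j) (F′ i) (F′ j) M≐LJ M-finite
          (C.base⊆ i i≤l) (C.⊆top i i≤l) (C′.base⊆ i i≤l) (C′.⊆top i i≤l)

    module _ (L J M : Subfield) (magnification : IsGeneralNormalMagnification K L J M) where
      open IsGeneralNormalMagnification magnification renaming (disjoint to linearlyDisjoint)
      private
        module L̃ = IsNormalClosure L̃-closure
        module J̃ = IsNormalClosure J̃-closure
        K⊆L = IsFinite.base⊆ L-finite
        K⊆J = IsFinite.base⊆ J-finite
        M≐LJ : M ≐ L ∙ J
        M≐LJ = proj₂ compositum , proj₁ compositum

      -- `LinearlyDisjoint` is one-sided: it speaks of vectors from `L̃` and scalars from `J̃`. Here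
      -- the vectors come from `J` and the scalars from `L̃`, so symmetry is required, whereas
      -- `disjointʳ` reads it off directly.
      disjointˡ : Disjoint L L̃ J
      disjointˡ = record
        { L-finite = L-finite ; J-finite = J-finite ; L⊆L̃ = L̃.contains ; L̃-normal = L̃.normal
        ; independent = λ b b∈ b-independent →
            linearlyDisjoint-sym L̃ J̃ linearlyDisjoint b (λ i → J̃.contains (b∈ i)) b-independent
                (λ x∈ → J̃.contains (K⊆J x∈)) }

      disjointʳ : Disjoint J J̃ L
      disjointʳ = record
        { L-finite = J-finite ; J-finite = L-finite ; L⊆L̃ = J̃.contains ; L̃-normal = J̃.normal
        ; independent = λ a a∈ → linearlyDisjoint a (λ i → L̃.contains (a∈ i)) }

      magnification-descending : ∀ (k k′ : ℕ) (N N′ : ℕ → Subfield) → IsDescendingChain K L k N → IsDescendingChain K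
          J k′ N′ →
          (k ≥ k′ → IsDescendingChain K M k (λ i → N i ∙ N′ (i ⊓ k′)))
        × (k < k′ → IsDescendingChain K M k′ (λ i → N (i ⊓ k) ∙ N′ i))
      magnification-descending k k′ N N′ chain chain′ =
          (λ k≥k′ → descendingCompositum L L̃ J J̃ M disjointˡ disjointʳ M-finite M≐LJ k N (λ i → N′ (i ⊓ k′)) weak
              (padDescending J k′ k N′ k≥k′ weak′)
            (λ i i<k → inj₁ (proj₂ (IsDescendingChain.strict chain i i<k))))
        , (λ k<k′ → descendingCompositum L L̃ J J̃ M disjointˡ disjointʳ M-finite M≐LJ k′ (λ i → N (i ⊓ k)) N′
            (padDescending L k k′ N (ℕ.<⇒≤ k<k′) weak) weak′
            (λ i i<k′ → inj₂ (proj₂ (IsDescendingChain.strict chain′ i i<k′))))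
        where
        weak = weakenDescending L k N K⊆L chain
        weak′ = weakenDescending J k′ N′ K⊆J chain′

      magnification-ascending : ∀ (l l′ : ℕ) (F F′ : ℕ → Subfield) → IsAscendingChain K L l F → IsAscendingChain K J
          l′ F′ →
          (l ≥ l′ → IsAscendingChain K M l (λ j → F j ∙ F′ (j ⊓ l′)))
        × (l < l′ → IsAscendingChain K M l′ (λ j → F (j ⊓ l) ∙ F′ j))
      magnification-ascending l l′ F F′ chain chain′ =
          (λ l≥l′ → ascendingCompositum L L̃ J J̃ M disjointˡ disjointʳ M-finite M≐LJ l F (λ j → F′ (j ⊓ l′)) weak
              (padAscending J l′ l F′ l≥l′ weak′)
            (λ j j<l → inj₁ (proj₂ (IsAscendingChain.strict chain j j<l))))
        , (λ l<l′ → ascendingCompositum L L̃ J J̃ M disjointˡ disjointʳ M-finite M≐LJ l′ (λ j → F (j ⊓ l)) F′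
            (padAscending L l l′ F (ℕ.<⇒≤ l<l′) weak) weak′
            (λ j j<l′ → inj₂ (proj₂ (IsAscendingChain.strict chain′ j j<l′))))
        where
        weak = weakenAscending L l F K⊆L chain
        weak′ = weakenAscending J l′ F′ K⊆J chain′

open import Level using (suc)

proposition3p13 : ∀ {ℓ : Level} → ExcludedMiddle (suc ℓ) →
    (K̄ : HeytingField ℓ ℓ ℓ) → let open FieldExtensions K̄ in
    (K : Subfield) → IsAlgebraicClosureOf K →
    (L J M : Subfield) → IsGeneralNormalMagnification K L J M →
    ( ∀ (k k′ : ℕ) (N N′ : ℕ → Subfield) →
    IsDescendingChain K L k N → IsDescendingChain K J k′ N′ →
    (k ≥ k′ → IsDescendingChain K M k (λ i → N i ∙ N′ (i ⊓ k′)))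
    × (k < k′ → IsDescendingChain K M k′ (λ i → N (i ⊓ k) ∙ N′ i)) )
    ×
    ( ∀ (l l′ : ℕ) (F F′ : ℕ → Subfield) →
    IsAscendingChain K L l F → IsAscendingChain K J l′ F′ →
    (l ≥ l′ → IsAscendingChain K M l (λ j → F j ∙ F′ (j ⊓ l′)))
    × (l < l′ → IsAscendingChain K M l′ (λ j → F (j ⊓ l) ∙ F′ j)) )
proposition3p13 em K̄ K closure L J M magnification =
    magnification-descending L J M magnification , magnification-ascending L J M magnification
  where open Magnification.OverBase em K̄ K closure
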